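{- Let $\lambda:\mathbb{N}\to\mathbb{N}$ be any function with $\lambda(n)\to\infty$ as $n\to\infty$, let $\delta:\mathbb{N}\to\mathbb{R}_{\ge 0}$ be any function with $\delta(n)\to 0$ as $n\to\infty$, and let $\gamma>0$. Then there is a function $\eta(n)\to 0$ (depending only on $\lambda,\delta,\gamma$) such that for every $\lambda$-well-behaved feasible degree sequence $\mathcal{D}$ of length $n$ with $R_{\mathcal D}\le \delta(n)M_{\mathcal D}$, the probability that $G(\mathcal D)$ has a component of order at least $\gamma n$ is at most $\eta(n)$; i.e. this probability is $o(1)$.
   Context: A degree sequence $\mathcal D=(d_1,\dots,d_n)$ consists of positive integers (the paper only considers sequences with no zero entries) and is feasible if some simple graph on $\{1,\dots,n\}$ has vertex $i$ of degree $d_i$; $G(\mathcal D)$ denotes a uniformly random simple graph on $\{1,\dots,n\}$ in which vertex $i$ has degree $d_i$. Let $\pi$ be a permutation with $d_{\pi_1}\le\dots\le d_{\pi_n}$. Define $j_{\mathcal D}=\min\big(\{j\in[n]:\sum_{i=1}^j d_{\pi_i}(d_{\pi_i}-2)>0\}\cup\{n\}\big)$, $R_{\mathcal D}=\sum_{i=j_{\mathcal D}}^n d_{\pi_i}$, and $M_{\mathcal D}=\sum_{i\in[n]:d_i\ne 2} d_i$ (these do not depend on the choice of $\pi$). For a function $\lambda:\mathbb N\to\mathbb N$, $\mathcal D$ is $\lambda$-well-behaved if $M_{\mathcal D}\ge\lambda(n)$. The order of a component is its number of vertices.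
   Formalization: The function δ and the number γ are taken to be rational-valued rather than real (and η is rational-valued); the real case follows by replacing δ with a rational majorant tending to 0 and γ with a smaller positive rational. -}

module Defs where

open import Data.Nat as ℕ using (ℕ; zero; suc; _≤_)
open import Data.Nat.Properties using (≤-decTotalOrder)
open import Data.Integer as ℤ using (ℤ; +_)
open import Data.Rational as ℚ using (ℚ; _/_; 0ℚ)
open import Data.Fin using (Fin; toℕ)
open import Data.Fin.Properties using () renaming (_≟_ to _≟ᶠ_)
open import Data.Vec as Vec using (Vec)
open import Data.Bool using (Bool; true; false; T; if_then_else_; _∨_)
import Data.List as List
open List using (List; []; _∷_; length; filter; map; zip; allFin; cartesianProduct)
open import Data.Nat.ListAction using (sum)
open import Data.List.Membership.Propositional using (_∈_)
open import Data.Product using (_×_; _,_; proj₁; proj₂; Σ; ∃)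
open import Data.Sum using (_⊎_)
open import Relation.Nullary using (does; ¬_)
open import Relation.Binary.PropositionalEquality using (_≡_)
open import Data.List.Sort ≤-decTotalOrder using (sort)

ℕ→ℚ : ℕ → ℚ
ℕ→ℚ k = + k / 1

pairs : (n : ℕ) → List (Fin n × Fin n)
pairs n = filter (λ p → toℕ (proj₁ p) ℕ.<? toℕ (proj₂ p))
                 (cartesianProduct (allFin n) (allFin n))

-- A simple graph on Fin n: for every unordered pair, whether it is an edge.
record Graph (n : ℕ) : Set where
  constructor mkGraph
  field bits : Vec Bool (length (pairs n))

edges : {n : ℕ} → Graph n → List (Fin n × Fin n)
edges {n} g = map proj₁ (filter (λ q → T? (proj₂ q)) (zip (pairs n) (Vec.toList (Graph.bits g))))
  where
  open import Relation.Nullary.Decidable using () renaming (T? to T?)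

degree : {n : ℕ} → Graph n → Fin n → ℕ
degree g v = length (filter (λ e → does (proj₁ e ≟ᶠ v) ∨ does (proj₂ e ≟ᶠ v) ≟ᵇ true) (edges g))
  where
  open import Data.Bool.Properties using () renaming (_≟_ to _≟ᵇ_)

DegSeq : ℕ → Set
DegSeq n = Fin n → ℕ

HasDegrees : {n : ℕ} → Graph n → DegSeq n → Set
HasDegrees g D = ∀ v → degree g v ≡ D v

Feasible : {n : ℕ} → DegSeq n → Set
Feasible {n} D = Σ (Graph n) λ g → HasDegrees g D

allVecs : (m : ℕ) → List (Vec Bool m)
allVecs zero = Vec.[] ∷ []
allVecs (suc m) = List.concatMap (λ v → (true Vec.∷ v) ∷ (false Vec.∷ v) ∷ []) (allVecs m)

allGraphs : (n : ℕ) → List (Graph n)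
allGraphs n = map mkGraph (allVecs (length (pairs n)))

-- number of simple graphs with degree sequence D (the size of the
-- probability space of G(D), which is uniform on these graphs)
numGraphs : {n : ℕ} → DegSeq n → ℕ
numGraphs {n} D = length (filter (λ g → all? (λ v → degree g v ℕ.≟ D v)) (allGraphs n))
  where
  open import Relation.Unary.Properties using ()
  open import Data.Fin.Properties using (all?)

Adj : {n : ℕ} → Graph n → Fin n → Fin n → Set
Adj g u v = ((u , v) ∈ edges g) ⊎ ((v , u) ∈ edges g)

data Reach {n : ℕ} (g : Graph n) (u : Fin n) : Fin n → Set where
  here : Reach g u u
  step : ∀ {w v} → Reach g u w → Adj g w v → Reach g u v

HasLargeComponent : {n : ℕ} → ℚ → Graph n → Set
HasLargeComponent {n} γ g =
  ∃ λ (u : Fin n) → ∃ λ (vs : List (Fin n)) →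
    Unique vs × All (Reach g u) vs × (γ ℚ.* ℕ→ℚ n) ℚ.≤ ℕ→ℚ (length vs)
  where
  open import Data.List.Relation.Unary.Unique.Propositional using (Unique)
  open import Data.List.Relation.Unary.All using (All)

ProbAtMost : {n : ℕ} → DegSeq n → (Graph n → Set) → ℚ → Set
ProbAtMost {n} D E p =
  ∀ (gs : List (Graph n)) → Unique gs → All (λ g → HasDegrees g D × E g) gs →
    ℕ→ℚ (length gs) ℚ.≤ p ℚ.* ℕ→ℚ (numGraphs D)
  where
  open import Data.List.Relation.Unary.Unique.Propositional using (Unique)
  open import Data.List.Relation.Unary.All using (All)

Positive : {n : ℕ} → DegSeq n → Set
Positive D = ∀ i → 1 ≤ D i

M : {n : ℕ} → DegSeq n → ℕ
M {n} D = sum (filter (λ d → ¬? (d ℕ.≟ 2)) (List.tabulate D))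
  where open import Relation.Nullary.Decidable using (¬?)

w : ℕ → ℤ
w d = + d ℤ.* (+ d ℤ.- + 2)

-- Given the running sum s = Σ_{i<j} d_{π_i}(d_{π_i}-2) and the remaining
-- sorted entries d_{π_j} ≤ … ≤ d_{π_n}, return Σ_{i ≥ j_D} d_{π_i}.
Rgo : ℤ → List ℕ → ℕ
Rgo s [] = 0
Rgo s (d ∷ []) = d
Rgo s (d ∷ rest@(_ ∷ _)) =
  if does (+ 0 ℤ.<? (s ℤ.+ w d)) then d ℕ.+ sum rest else Rgo (s ℤ.+ w d) rest

R : {n : ℕ} → DegSeq n → ℕ
R D = Rgo (+ 0) (sort (List.tabulate D))

TendsToInfinity : (ℕ → ℕ) → Set
TendsToInfinity f = ∀ (K : ℕ) → ∃ λ N → ∀ n → N ≤ n → K ≤ f n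

TendsToZero : (ℕ → ℚ) → Set
TendsToZero f = ∀ (ε : ℚ) → 0ℚ ℚ.< ε → ∃ λ N → ∀ n → N ≤ n → f n ℚ.≤ ε

{-# OPTIONS --safe #-}
module Submission where

-- Fix a vertex u and let p be the probability that a random leaf lies in its component C.
-- A tree inequality gives Σ_{v ∈ C} (d_v − 2) ≥ −2 in every graph.  Conversely, for v of bounded
-- degree d ≥ 2, the neighbours of v can be exchanged, by switchings v y, ℓ z ↦ v z, ℓ y that keep
-- the graph without v and without the leaves fixed, for the neighbours of random leaves ℓ.
-- With x the share of leaves hanging on the part of that core reachable from u, inclusion–exclusion
-- yields P(v ∈ C) ≤ d E x − (d − 1) E x² + o(d) ≤ d p − (d − 1)(2 t p − t²) + o(d) for each t ≤ 1/2.
-- R = o(M) says that vertices of large degree carry o(M) half-edges and that the other vertices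
-- satisfy Σ d (d − 2) ≤ o(M), so weighting with d − 2 makes the linear terms cancel and the quadratic
-- gain forces p = o(1), even in the critical case.  Then P(v ∈ C) ≤ d p + o(d) shows that a fixed
-- vertex is connected to o(n) vertices in expectation, which rules out components of order γ n.

open import Defs
open import Data.Bool using (Bool; true; false; _∧_; _∨_; not; _xor_)
open import Data.Bool.Properties using (∧-zeroʳ; ∨-comm; ∨-zeroʳ) renaming (_≟_ to _≟ᵇ_)
open import Data.Empty using (⊥-elim)
open import Data.Fin using (Fin; zero; suc; toℕ)
open import Data.Fin.Properties using (any?; all?; toℕ-injective) renaming (_≟_ to _≟ᶠ_)
open import Data.List using (List; []; _∷_; _++_; map; concatMap; filter; length; lookup; zip; allFin; cartesianProduct; tabulate)
open import Data.List.Membership.Propositional using (_∈_)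
open import Data.List.Membership.Propositional.Properties using (∈-allFin; ∈-filter⁺; ∈-filter⁻; ∈-cartesianProduct⁺; ∈-lookup; ∈-map⁺; ∈-concatMap⁺)
open import Data.List.Properties using (map-tabulate; length-tabulate)
import Data.List.Relation.Binary.Permutation.Propositional as Perm
open Perm using (_↭_)
open import Data.List.Relation.Unary.All as All using (All; []; _∷_)
open import Data.List.Relation.Unary.Any as Any using (here; there; index)
open import Data.List.Relation.Unary.Any.Properties using (lookup-index)
open import Data.List.Relation.Unary.Unique.Propositional using (Unique; []; _∷_)
open import Data.List.Relation.Unary.Unique.Propositional.Properties using (filter⁺; cartesianProduct⁺; allFin⁺)
import Data.Nat as ℕ
open import Data.Nat using (ℕ; zero; suc; _≤_; _<_; _+_; _*_; _∸_; z≤n; s≤s; NonZero; >-nonZero)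
open import Data.Nat.ListAction using (sum)
open import Data.Nat.Properties
open import Data.List.Sort ≤-decTotalOrder using (sort; sort-↭)
open import Data.Nat.Tactic.RingSolver using (solve-∀)
open import Data.Product using (_×_; _,_; proj₁; proj₂; Σ; ∃; ∃₂)
open import Data.Rational as ℚ using (ℚ; 0ℚ; mkℚ; _/_; toℚᵘ)
import Data.Rational.Properties as ℚ
open import Data.Rational.Unnormalised as ℚᵘ using (mkℚᵘ; *≤*; *≡*)
import Data.Rational.Unnormalised.Properties as ℚᵘ
open import Data.Sum using (_⊎_; inj₁; inj₂)
open import Data.Vec as Vec using (Vec)
open import Data.Vec.Properties using (lookup-zipWith; lookup∘tabulate)
open import Function using (_∘_; id)
open import Relation.Binary.Definitions using (tri<; tri≈; tri>)
open import Relation.Binary.PropositionalEquality using (_≡_; _≢_; refl; sym; trans; cong; cong₂; subst; subst₂; module ≡-Reasoning)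
open import Relation.Nullary using (Dec; does; yes; no; ¬_; contradiction; _×-dec_)
open import Relation.Nullary.Decidable using (T?; dec-true; dec-false; ¬?)
open import Relation.Unary using (Decidable)


-- The obstacle is criticality: Σ d (d - 2) over the bounded degrees may be as large as the number m
-- of leaves, and then the first-moment bound P(v ∈ C) ≤ d p + o(d) only returns p ≤ p + o(1). So
-- the event that several neighbours of v lead to u has to be counted as well. Leaves are the
-- exchange partners for two reasons. A leaf ℓ has a single edge ℓ z, so a switching is legal as
-- soon as z is neither v nor adjacent to v. And m is of the order of M, however many vertices of
-- degree two there are, so the errors in the bound on p are measured against m and not against n.
-- Deleting v and the leaves makes the set reached from u the same before and after a switching. One
-- parameter K governs all sizes: t = 1/K, p ≤ 6/K, and a degree cutoff of order K³. At length n the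
-- largest K ≤ n that λ(n) and δ(n) allow is used, which gives the rate η. Probabilities are
-- multiplied by the number of graphs, so the counting is a chain of inequalities in ℕ, and each
-- elimination is checked by one polynomial identity.

-- Certificate form of linear arithmetic: slack s and a combination p ≤ q of the hypotheses.
linear : ∀ a b s {p q} → p ≤ q → a + q + s ≡ b + p → a ≤ b
linear a b s {p} {q} p≤q e = +-cancelʳ-≤ q a b (begin
  a + q       ≤⟨ m≤m+n _ s ⟩
  a + q + s   ≡⟨ e ⟩
  b + p       ≤⟨ +-monoʳ-≤ b p≤q ⟩
  b + q       ∎)
  where open ≤-Reasoning

-- Arithmetic of the counting argument

two-products : ∀ a c → 2 * (a * c) ≤ a * a + c * c
two-products a c with ≤-total a c
... | inj₁ a≤c with t , refl ← m≤n⇒∃[o]m+o≡n a≤c = linear (2 * (a * (a + t))) (a * a + (a + t) * (a + t)) (t * t) {0} z≤n (square a t)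
  where
  square : ∀ a t → 2 * (a * (a + t)) + 0 + t * t ≡ a * a + (a + t) * (a + t) + 0
  square = solve-∀
... | inj₂ c≤a with t , refl ← m≤n⇒∃[o]m+o≡n c≤a = linear (2 * ((c + t) * c)) ((c + t) * (c + t) + c * c) (t * t) {0} z≤n (square c t)
  where
  square : ∀ c t → 2 * ((c + t) * c) + 0 + t * t ≡ (c + t) * (c + t) + c * c + 0
  square = solve-∀

-- The hypotheses are, in order: inclusion–exclusion at v, the three switching estimates, the
-- linearised square x² ≥ 2 x / K − 1 / K², and two trivial bounds.  P, Sk, Sp, SX, SXX, SkX, SN sum
-- over the g graphs the indicator of v ∈ C, the number k of live neighbours of v, k (k − 1), the
-- number X of live leaves, X², k X and the number of leaves in C; m counts the leaves.
critical-arithmetic : ∀ K m d e g β P Sp Sk SX SXX SkX SN → 2 ≤ K → 1 ≤ m → d ≡ suc e →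
  d * P + Sp ≤ d * Sk →
  m * Sk ≤ d * SX + g * (d * β) →
  e * SkX ≤ m * Sp + g * (d * (d * β)) →
  d * SXX ≤ m * SkX + g * (d * (m * β)) + d * SX →
  2 * K * m * SX ≤ K * K * SXX + g * (m * m) →
  SX ≤ SN →
  SX ≤ g * m →
  K * K * m * P + 2 * K * e * SN ≤ K * K * d * SN + e * g * m + K * K * g * d * (3 * β + 1)
critical-arithmetic K m d e g β P Sp Sk SX SXX SkX SN 2≤K 1≤m refl h₀ h₁ h₂ h₃ h₄ SX≤SN SX≤gm = replaced
  where
  instance
    m≢0 : NonZero m
    m≢0 = >-nonZero 1≤m

  -- `h₂` removes `Sp` from `h₀`, then `h₃` removes `SkX`, and `SX≤gm` disposes of the diagonal term
  -- of `h₃`. All that is left carries a factor `d`.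
  divided-by-d : m * m * P + e * SXX ≤ m * m * Sk + m * g * d * β + e * g * m * β + e * g * m
  divided-by-d = *-cancelˡ-≤ d (linear _ _ 0
    (+-mono-≤ (*-monoʳ-≤ (m * m) h₀) (+-mono-≤ (*-monoʳ-≤ m h₂) (+-mono-≤ (*-monoʳ-≤ e h₃) (*-monoʳ-≤ (e * d) SX≤gm))))
    (certificate m d e g β P Sp Sk SX SXX SkX))
    where
    certificate : ∀ m d e g β P Sp Sk SX SXX SkX →
      d * (m * m * P + e * SXX)
        + (m * m * (d * Sk) + (m * (m * Sp + g * (d * (d * β))) + (e * (m * SkX + g * (d * (m * β)) + d * SX) + e * d * (g * m)))) + 0
      ≡ d * (m * m * Sk + m * g * d * β + e * g * m * β + e * g * m)
        + (m * m * (d * P + Sp) + (m * (e * SkX) + (e * (d * SXX) + e * d * SX)))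
    certificate = solve-∀

  -- `h₁` trades `Sk`, and `h₄` trades `SXX`, for `SX`; now `m` is a common factor.
  divided-by-m : K * K * m * P + 2 * K * e * SX ≤ K * K * d * SX + e * g * m + K * K * g * d * (3 * β + 1)
  divided-by-m = *-cancelˡ-≤ m (linear _ _ (K * K * (g * m * (β + 1)))
    (+-mono-≤ (*-monoʳ-≤ (K * K) divided-by-d) (+-mono-≤ (*-monoʳ-≤ (K * K * m) h₁) (*-monoʳ-≤ e h₄)))
    (certificate K m e g β P Sk SX SXX))
    where
    certificate : ∀ K m e g β P Sk SX SXX →
      m * (K * K * m * P + 2 * K * e * SX)
        + (K * K * (m * m * Sk + m * g * suc e * β + e * g * m * β + e * g * m)
          + (K * K * m * (suc e * SX + g * (suc e * β)) + e * (K * K * SXX + g * (m * m))))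
        + K * K * (g * m * (β + 1))
      ≡ m * (K * K * suc e * SX + e * g * m + K * K * g * suc e * (3 * β + 1))
        + (K * K * (m * m * P + e * SXX) + (K * K * m * (m * Sk) + e * (2 * K * m * SX)))
    certificate = solve-∀

  -- The net coefficient of `SX` is K² d - 2 K e, which is nonnegative because 2 ≤ K, so the larger
  -- `SN` may take its place.
  replaced : K * K * m * P + 2 * K * e * SN ≤ K * K * d * SN + e * g * m + K * K * g * d * (3 * β + 1)
  replaced with t , refl ← m≤n⇒∃[o]m+o≡n SX≤SN | j , refl ← m≤n⇒∃[o]m+o≡n 2≤K =
    linear _ _ ((j * (2 + j) * e + (2 + j) * (2 + j)) * t) divided-by-m (certificate j m e g β P SX t)
    where
    certificate : ∀ j m e g β P SX t →
      (2 + j) * (2 + j) * m * P + 2 * (2 + j) * e * (SX + t)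
        + ((2 + j) * (2 + j) * suc e * SX + e * g * m + (2 + j) * (2 + j) * g * suc e * (3 * β + 1))
        + (j * (2 + j) * e + (2 + j) * (2 + j)) * t
      ≡ (2 + j) * (2 + j) * suc e * (SX + t) + e * g * m + (2 + j) * (2 + j) * g * suc e * (3 * β + 1)
        + ((2 + j) * (2 + j) * m * P + 2 * (2 + j) * e * SX)
    certificate = solve-∀

-- The linear terms cancel up to the deficit m + e - Q. If Q is close to m, the quadratic term
-- survives, worth at least K Q SN by Q ≤ 2 A; if Q is smaller, the deficit itself is worth K² (m +
-- e - Q) SN. Since K ≤ K², the two together always leave K m SN on the left.
density-arithmetic : ∀ K m e g β s T SN A Q → 1 ≤ K → 1 ≤ m →
  K * K * m * T + 2 * K * SN * A ≤ (K * K * SN + K * K * g * (3 * β + 1)) * Q + g * m * A →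
  SN ≤ T + g * s → A ≤ Q → Q ≤ 2 * A → Q ≤ m + e → SN ≤ g * m →
  K * K * K * e ≤ m → K * K * K * (3 * β + 1) ≤ m → K * K * K * s ≤ m →
  K * SN ≤ 6 * g * m
density-arithmetic K m e g β s T SN A Q 1≤K 1≤m crit SN≤ A≤Q Q≤2A Q≤m+e SN≤gm e-small β-small s-small
  with j , refl ← m≤n⇒∃[o]m+o≡n 1≤K =
  *-cancelˡ-≤ K (*-cancelˡ-≤ m (linear _ _ (4 * j * g * m * m)
    (+-mono-≤ (*-monoʳ-≤ K raw) (+-mono-≤ (*-monoʳ-≤ (g * m) e-small) (+-mono-≤ (*-monoʳ-≤ (g * (m + e)) β-small)
      (+-mono-≤ (*-monoʳ-≤ (g * m) s-small) (*-monoʳ-≤ (K * g * m + g * m) e≤m)))))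
    (certificate₂ j m e g β s SN)))
  where
  instance
    m≢0 : NonZero m
    m≢0 = >-nonZero 1≤m
  e≤m : e ≤ m
  e≤m = ≤-trans (≤-trans (≤-reflexive (sym (*-identityˡ e))) (*-monoˡ-≤ e (*-mono-≤ (*-mono-≤ 1≤K 1≤K) 1≤K))) e-small
  raw : K * SN * m ≤ g * (K * K * e * m + m * (m + e) + K * K * (3 * β + 1) * (m + e) + K * K * m * s)
  raw = linear _ _ (K * SN * e)
    (+-mono-≤ crit (+-mono-≤ (*-monoʳ-≤ (K * K * m) SN≤) (+-mono-≤ (*-monoʳ-≤ (K * SN) Q≤2A) (+-mono-≤ (*-monoʳ-≤ (K * K * e) SN≤gm)
      (+-mono-≤ (*-monoʳ-≤ (g * m) (≤-trans A≤Q Q≤m+e)) (*-monoʳ-≤ (K * K * g * (3 * β + 1) + K * j * SN) Q≤m+e))))))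
    (certificate₁ j m e g β s T SN A Q)
    where
    certificate₁ : ∀ j m e g β s T SN A Q →
      (1 + j) * SN * m
        + ((((1 + j) * (1 + j) * SN + (1 + j) * (1 + j) * g * (3 * β + 1)) * Q + g * m * A)
          + ((1 + j) * (1 + j) * m * (T + g * s) + ((1 + j) * SN * (2 * A) + ((1 + j) * (1 + j) * e * (g * m)
            + (g * m * (m + e) + ((1 + j) * (1 + j) * g * (3 * β + 1) + (1 + j) * j * SN) * (m + e))))))
        + (1 + j) * SN * e
      ≡ g * ((1 + j) * (1 + j) * e * m + m * (m + e) + (1 + j) * (1 + j) * (3 * β + 1) * (m + e) + (1 + j) * (1 + j) * m * s)
        + (((1 + j) * (1 + j) * m * T + 2 * (1 + j) * SN * A)
          + ((1 + j) * (1 + j) * m * SN + ((1 + j) * SN * Q + ((1 + j) * (1 + j) * e * SN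
            + (g * m * A + ((1 + j) * (1 + j) * g * (3 * β + 1) + (1 + j) * j * SN) * Q)))))
    certificate₁ = solve-∀
  certificate₂ : ∀ j m e g β s SN →
    m * ((1 + j) * ((1 + j) * SN))
      + ((1 + j) * (g * ((1 + j) * (1 + j) * e * m + m * (m + e) + (1 + j) * (1 + j) * (3 * β + 1) * (m + e) + (1 + j) * (1 + j) * m * s))
        + (g * m * m + (g * (m + e) * m + (g * m * m + ((1 + j) * g * m + g * m) * m))))
      + 4 * j * g * m * m
    ≡ m * ((1 + j) * (6 * g * m))
      + ((1 + j) * ((1 + j) * SN * m)
        + (g * m * ((1 + j) * (1 + j) * (1 + j) * e) + (g * (m + e) * ((1 + j) * (1 + j) * (1 + j) * (3 * β + 1))
          + (g * m * ((1 + j) * (1 + j) * (1 + j) * s) + ((1 + j) * g * m + g * m) * e))))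
  certificate₂ = solve-∀

-- Origin of 42: the leaf density contributes 6 (m + 5 n), `β-small` contributes 5 n and `S-small`
-- contributes m, at most 42 n altogether.
total-arithmetic : ∀ K m n g β S SN H Σd → 1 ≤ m → m ≤ n →
  m * H ≤ m * SN + ((SN + g * β) * Σd + (m * g + m * g * S)) →
  K * SN ≤ 6 * g * m → Σd ≤ 5 * n → K * β ≤ m → K * (1 + S) ≤ m →
  K * H ≤ 42 * g * n
total-arithmetic K m n g β S SN H Σd 1≤m m≤n total SN-small Σd≤ β-small S-small =
  *-cancelˡ-≤ m (linear _ _ 0
    (+-mono-≤ (*-monoʳ-≤ K total) (+-mono-≤ (*-monoʳ-≤ (m + 5 * n) SN-small) (+-mono-≤ (*-monoʳ-≤ (K * (SN + g * β)) Σd≤)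
      (+-mono-≤ (*-monoʳ-≤ (5 * n * g) β-small) (+-mono-≤ (*-monoʳ-≤ (m * g) S-small) (*-monoʳ-≤ (7 * g * m) m≤n))))))
    (certificate K m n g β S SN H Σd))
  where
  instance
    m≢0 : NonZero m
    m≢0 = >-nonZero 1≤m
  certificate : ∀ K m n g β S SN H Σd →
    m * (K * H)
      + (K * (m * SN + ((SN + g * β) * Σd + (m * g + m * g * S)))
        + ((m + 5 * n) * (6 * g * m) + (K * (SN + g * β) * (5 * n) + (5 * n * g * m + (m * g * m + 7 * g * m * n))))) + 0
    ≡ m * (42 * g * n)
      + (K * (m * H) + ((m + 5 * n) * (K * SN) + (K * (SN + g * β) * Σd + (5 * n * g * (K * β) + (m * g * (K * (1 + S)) + 7 * g * m * m)))))
  certificate = solve-∀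

-- The thresholds: with c = K³, the choice B = 1 + 12c makes the degrees above B negligible
-- compared with m / K³, and R ≤ M / (1 + 24cB) does the same for the R-vertices.
cutoff precision threshold : ℕ → ℕ
cutoff c = 1 + 12 * c
precision c = 1 + 24 * c * cutoff c
threshold c = 4 * (4 * c * (3 * cutoff c * cutoff c + 3 * cutoff c + 1) + 2) + 4

-- Here r, S and n₁ stand for `R D`, `bigDegrees` and the number of vertices of degree one; m counts
-- the latter without the root u, hence n₁ ≤ m + 1.
module Smallness (c r S n₁ m M : ℕ) (1≤c : 1 ≤ c)
  (S-bound : 12 * c * S ≤ 12 * c * r + n₁) (M-bound : M ≤ 2 * n₁ + r) (n₁≤ : n₁ ≤ m + 1)
  (r-small : precision c * r ≤ M) (M-large : threshold c ≤ M) where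

  private
    B = cutoff c
    -- `threshold c` is 4 W + 4, so that `M≤4m+4` turns into W ≤ m.
    W = 4 * c * (3 * B * B + 3 * B + 1) + 2

    2r≤M : 2 * r ≤ M
    2r≤M with i , refl ← m≤n⇒∃[o]m+o≡n 1≤c = linear _ _ ((311 + 600 * i + 288 * i * i) * r) r-small (certificate i r M)
      where
      certificate : ∀ i r M →
        2 * r + M + (311 + 600 * i + 288 * i * i) * r
        ≡ M + (1 + 24 * (1 + i) * (1 + 12 * (1 + i))) * r
      certificate = solve-∀

    M≤4m+4 : M ≤ 4 * m + 4
    M≤4m+4 = linear _ _ 0 (+-mono-≤ (*-monoʳ-≤ 2 M-bound) (+-mono-≤ (*-monoʳ-≤ 4 n₁≤) 2r≤M)) (certificate M n₁ m r)
      where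
      certificate : ∀ M n₁ m r → M + (2 * (2 * n₁ + r) + (4 * (m + 1) + M)) + 0 ≡ 4 * m + 4 + (2 * M + (4 * n₁ + 2 * r))
      certificate = solve-∀

    W≤m : W ≤ m
    W≤m = *-cancelˡ-≤ 4 (+-cancelʳ-≤ 4 (4 * W) (4 * m) (≤-trans M-large M≤4m+4))

    -- The summand 1 of `precision c` cancels the r of `M-bound`, leaving 24 c B r ≤ 2 n₁.
    12cBr≤ : 12 * c * B * r ≤ m + 1
    12cBr≤ = *-cancelˡ-≤ 2 (linear _ _ 0 (+-mono-≤ r-small (+-mono-≤ M-bound (*-monoʳ-≤ 2 n₁≤))) (certificate c r n₁ m M))
      where
      certificate : ∀ c r n₁ m M →
        2 * (12 * c * (1 + 12 * c) * r) + (M + (2 * n₁ + r + 2 * (m + 1))) + 0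
        ≡ 2 * (m + 1) + ((1 + 24 * c * (1 + 12 * c)) * r + (M + 2 * n₁))
      certificate = solve-∀

  1≤m : 1 ≤ m
  1≤m = ≤-trans (≤-trans (s≤s z≤n) (m≤n+m 2 _)) W≤m

  excess-small : c * (1 + B * r) ≤ m
  excess-small = *-cancelˡ-≤ 12 (linear _ _ (10 * m + (1728 * c * c * c + 432 * c * c + 16 * c + 1)) (+-mono-≤ 12cBr≤ W≤m) (certificate c r m))
    where
    certificate : ∀ c r m →
      12 * (c * (1 + (1 + 12 * c) * r)) + (m + 1 + m) + (10 * m + (1728 * c * c * c + 432 * c * c + 16 * c + 1))
      ≡ 12 * m + (12 * c * (1 + 12 * c) * r + (4 * c * (3 * (1 + 12 * c) * (1 + 12 * c) + 3 * (1 + 12 * c) + 1) + 2))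
    certificate = solve-∀

  bad-small : c * (3 * (B + (B * B + S)) + 1) ≤ m
  bad-small = *-cancelˡ-≤ 4 (linear _ _ (m + 144 * c * c * r)
    (+-mono-≤ S-bound (+-mono-≤ n₁≤ (+-mono-≤ 12cBr≤ W≤m))) (certificate c r S n₁ m))
    where
    certificate : ∀ c r S n₁ m →
      4 * (c * (3 * ((1 + 12 * c) + ((1 + 12 * c) * (1 + 12 * c) + S)) + 1))
        + (12 * c * r + n₁ + (m + 1 + (m + 1 + m))) + (m + 144 * c * c * r)
      ≡ 4 * m + (12 * c * S + (n₁ + (12 * c * (1 + 12 * c) * r + (4 * c * (3 * (1 + 12 * c) * (1 + 12 * c) + 3 * (1 + 12 * c) + 1) + 2))))
    certificate = solve-∀

  big-small : c * (S + B + 2) ≤ m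
  big-small = ≤-trans (*-monoʳ-≤ c (linear _ _ (2 * S + (4 + 96 * c + 432 * c * c)) {0} z≤n (certificate c S))) bad-small
    where
    certificate : ∀ c S →
      S + (1 + 12 * c) + 2 + 0 + (2 * S + (4 + 96 * c + 432 * c * c))
      ≡ 3 * ((1 + 12 * c) + ((1 + 12 * c) * (1 + 12 * c) + S)) + 1 + 0
    certificate = solve-∀

  M≤3m : M ≤ 3 * m
  M≤3m with i , refl ← m≤n⇒∃[o]m+o≡n 1≤c = *-cancelˡ-≤ 2 (linear _ _
    ((154 + 300 * i + 144 * i * i) * r + (2185 + 6076 * i + 5616 * i * i + 1728 * i * i * i))
    (+-mono-≤ (*-monoʳ-≤ 2 M-bound) (+-mono-≤ (*-monoʳ-≤ 4 n₁≤) (+-mono-≤ 12cBr≤ W≤m))) (certificate i r n₁ m M))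
    where
    certificate : ∀ i r n₁ m M →
      2 * M + (2 * (2 * n₁ + r) + (4 * (m + 1) + (m + 1 + m)))
        + ((154 + 300 * i + 144 * i * i) * r + (2185 + 6076 * i + 5616 * i * i + 1728 * i * i * i))
      ≡ 2 * (3 * m) + (2 * M + (4 * n₁ + (12 * (1 + i) * (1 + 12 * (1 + i)) * r
        + (4 * (1 + i) * (3 * (1 + 12 * (1 + i)) * (1 + 12 * (1 + i)) + 3 * (1 + 12 * (1 + i)) + 1) + 2))))
    certificate = solve-∀

private variable
  Ix Jx : Set

-- Finite sums and indicators

⟦_⟧ : Bool → ℕ
⟦ true ⟧ = 1
⟦ false ⟧ = 0

⟦⟧≤1 : ∀ b → ⟦ b ⟧ ≤ 1
⟦⟧≤1 true = ≤-refl
⟦⟧≤1 false = z≤n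

∑ : List Ix → (Ix → ℕ) → ℕ
∑ [] f = 0
∑ (x ∷ xs) f = f x + ∑ xs f

infix 5 ∑
syntax ∑ xs (λ x → e) = ∑[ x ∈ xs ] e

∑-cong : ∀ (xs : List Ix) {f g : Ix → ℕ} → (∀ x → f x ≡ g x) → ∑ xs f ≡ ∑ xs g
∑-cong [] h = refl
∑-cong (x ∷ xs) h = cong₂ _+_ (h x) (∑-cong xs h)

∑-mono : ∀ (xs : List Ix) {f g : Ix → ℕ} → (∀ x → f x ≤ g x) → ∑ xs f ≤ ∑ xs g
∑-mono [] h = z≤n
∑-mono (x ∷ xs) h = +-mono-≤ (h x) (∑-mono xs h)

∑-+ : ∀ (xs : List Ix) (f g : Ix → ℕ) → ∑[ x ∈ xs ] (f x + g x) ≡ ∑ xs f + ∑ xs g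
∑-+ [] f g = refl
∑-+ (x ∷ xs) f g = trans (cong (f x + g x +_) (∑-+ xs f g)) (shuffle (f x) (g x) _ _)
  where
  shuffle : ∀ a b c d → a + b + (c + d) ≡ a + c + (b + d)
  shuffle = solve-∀

∑-*ˡ : ∀ (xs : List Ix) c (f : Ix → ℕ) → ∑[ x ∈ xs ] (c * f x) ≡ c * ∑ xs f
∑-*ˡ [] c f = sym (*-zeroʳ c)
∑-*ˡ (x ∷ xs) c f = trans (cong (c * f x +_) (∑-*ˡ xs c f)) (sym (*-distribˡ-+ c (f x) _))

∑-*ʳ : ∀ (xs : List Ix) c (f : Ix → ℕ) → ∑[ x ∈ xs ] (f x * c) ≡ ∑ xs f * c
∑-*ʳ xs c f = trans (∑-cong xs λ x → *-comm (f x) c) (trans (∑-*ˡ xs c f) (*-comm c _))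

∑-0 : ∀ (xs : List Ix) → ∑[ x ∈ xs ] 0 ≡ 0
∑-0 [] = refl
∑-0 (x ∷ xs) = ∑-0 xs

∑-const : ∀ (xs : List Ix) c → ∑[ x ∈ xs ] c ≡ length xs * c
∑-const [] c = refl
∑-const (x ∷ xs) c = cong (c +_) (∑-const xs c)

∑-swap : ∀ (xs : List Ix) (ys : List Jx) (f : Ix → Jx → ℕ) →
  ∑[ x ∈ xs ] (∑[ y ∈ ys ] f x y) ≡ ∑[ y ∈ ys ] (∑[ x ∈ xs ] f x y)
∑-swap [] ys f = sym (∑-0 ys)
∑-swap (x ∷ xs) ys f =
  trans (cong (∑ ys (f x) +_) (∑-swap xs ys f)) (sym (∑-+ ys (f x) _))

∑-++ : ∀ (xs ys : List Ix) f → ∑ (xs ++ ys) f ≡ ∑ xs f + ∑ ys f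
∑-++ [] ys f = refl
∑-++ (x ∷ xs) ys f = trans (cong (f x +_) (∑-++ xs ys f)) (sym (+-assoc (f x) _ _))

∑-map : ∀ (h : Ix → Jx) (xs : List Ix) f → ∑ (map h xs) f ≡ ∑ xs (f ∘ h)
∑-map h [] f = refl
∑-map h (x ∷ xs) f = cong (f (h x) +_) (∑-map h xs f)

∑-concatMap : ∀ (h : Ix → List Jx) (xs : List Ix) f →
  ∑ (concatMap h xs) f ≡ ∑[ x ∈ xs ] ∑ (h x) f
∑-concatMap h [] f = refl
∑-concatMap h (x ∷ xs) f = trans (∑-++ (h x) _ f) (cong (∑ (h x) f +_) (∑-concatMap h xs f))

length-filter-∑ : ∀ {P : Ix → Set} (P? : Decidable P) xs →
  length (filter P? xs) ≡ ∑[ x ∈ xs ] ⟦ does (P? x) ⟧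
length-filter-∑ P? [] = refl
length-filter-∑ P? (x ∷ xs) with does (P? x)
... | true = cong suc (length-filter-∑ P? xs)
... | false = length-filter-∑ P? xs

∑-member : ∀ {xs : List Ix} {x} f → x ∈ xs → f x ≤ ∑ xs f
∑-member f (here refl) = m≤m+n _ _
∑-member f (there p) = ≤-trans (∑-member f p) (m≤n+m _ _)

private
  remove : ∀ {xs : List Ix} {x} → x ∈ xs → List Ix
  remove {xs = _ ∷ xs} (here _) = xs
  remove {xs = x ∷ _} (there p) = x ∷ remove p

  ∑-remove : ∀ {xs : List Ix} {x} (p : x ∈ xs) f → ∑ xs f ≡ f x + ∑ (remove p) f
  ∑-remove (here refl) f = refl
  ∑-remove {xs = y ∷ xs} {x} (there p) f =
    trans (cong (f y +_) (∑-remove p f)) (rot (f y) (f x) _)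
    where
    rot : ∀ a b c → a + (b + c) ≡ b + (a + c)
    rot = solve-∀

  ∈-remove : ∀ {xs : List Ix} {x y} (p : x ∈ xs) → y ∈ xs → x ≢ y → y ∈ remove p
  ∈-remove (here refl) (here refl) ne = ⊥-elim (ne refl)
  ∈-remove (here refl) (there q) ne = q
  ∈-remove (there p) (here q) ne = here q
  ∈-remove (there p) (there q) ne = there (∈-remove p q ne)

-- Events and components are presented as duplicate-free lists; this compares them with sums over
-- all graphs or all vertices.
∑-⊆ : ∀ {xs ys : List Ix} f → Unique xs → All (_∈ ys) xs → ∑ xs f ≤ ∑ ys f
∑-⊆ f [] [] = z≤n
∑-⊆ {xs = x ∷ xs} {ys} f (x≢ ∷ uniq) (p ∷ ps) = begin
  f x + ∑ xs f          ≤⟨ +-monoʳ-≤ (f x) (∑-⊆ f uniq (All.zipWith (λ (ne , q) → ∈-remove p q ne) (x≢ , ps))) ⟩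
  f x + ∑ (remove p) f  ≡⟨ ∑-remove p f ⟨
  ∑ ys f                ∎
  where open ≤-Reasoning

_==_ : ∀ {n} → Fin n → Fin n → Bool
a == b = does (a ≟ᶠ b)

==-refl : ∀ {n} (a : Fin n) → (a == a) ≡ true
==-refl a = dec-true (a ≟ᶠ a) refl

==-≢ : ∀ {n} {a b : Fin n} → a ≢ b → (a == b) ≡ false
==-≢ {a = a} {b} = dec-false (a ≟ᶠ b)

==-sound : ∀ {n} {a b : Fin n} → (a == b) ≡ true → a ≡ b
==-sound {a = a} {b} e with a ≟ᶠ b
... | yes p = p

==-sym : ∀ {n} (a b : Fin n) → (a == b) ≡ (b == a)
==-sym a b with a ≟ᶠ b
... | yes refl = sym (==-refl a)
... | no ne = sym (==-≢ (ne ∘ sym))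

∑-allFin-suc : ∀ n (f : Fin (suc n) → ℕ) → ∑ (allFin (suc n)) f ≡ f zero + ∑ (allFin n) (f ∘ suc)
∑-allFin-suc n f = cong (f zero +_)
  (trans (cong (λ l → ∑ l f) (sym (map-tabulate id suc))) (∑-map suc (allFin n) f))

∑-δ : ∀ {n} (a : Fin n) (f : Fin n → ℕ) → ∑[ w ∈ allFin n ] ⟦ w == a ⟧ * f w ≡ f a
∑-δ {suc n} zero f = begin
  ∑[ w ∈ allFin (suc n) ] ⟦ w == zero ⟧ * f w  ≡⟨ ∑-allFin-suc n _ ⟩
  1 * f zero + (∑[ w ∈ allFin n ] 0)            ≡⟨ cong₂ _+_ (*-identityˡ _) (∑-0 (allFin n)) ⟩
  f zero + 0                                    ≡⟨ +-identityʳ _ ⟩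
  f zero                                        ∎
  where open ≡-Reasoning
∑-δ {suc n} (suc a) f = trans (∑-allFin-suc n λ w → ⟦ w == suc a ⟧ * f w) (∑-δ a (f ∘ suc))

∑-δ1 : ∀ {n} (a : Fin n) → ∑[ w ∈ allFin n ] ⟦ w == a ⟧ ≡ 1
∑-δ1 {n} a = trans (∑-cong (allFin n) λ w → sym (*-identityʳ ⟦ w == a ⟧)) (∑-δ a λ _ → 1)

∑-allFin-≤ : ∀ n {f : Fin n → ℕ} → (∀ v → f v ≤ 1) → ∑ (allFin n) f ≤ n
∑-allFin-≤ n {f} h = begin
  ∑ (allFin n) f          ≤⟨ ∑-mono (allFin n) h ⟩
  ∑[ w ∈ allFin n ] 1     ≡⟨ ∑-const (allFin n) 1 ⟩
  length (allFin n) * 1   ≡⟨ *-identityʳ _ ⟩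
  length (allFin n)       ≡⟨ length-tabulate id ⟩
  n                       ∎
  where open ≤-Reasoning

∧-true : ∀ {a b} → a ∧ b ≡ true → a ≡ true × b ≡ true
∧-true {true} {true} _ = refl , refl

∧-intro : ∀ {a b} → a ≡ true → b ≡ true → a ∧ b ≡ true
∧-intro refl refl = refl

not-true : ∀ {a} → not a ≡ true → a ≡ false
not-true {false} _ = refl

iff-≡ : ∀ {a b} → (a ≡ true → b ≡ true) → (b ≡ true → a ≡ true) → a ≡ b
iff-≡ {true} {b} f g = sym (f refl)
iff-≡ {false} {true} f g = g refl
iff-≡ {false} {false} f g = refl

⟦⟧-mono : ∀ {a b} → (a ≡ true → b ≡ true) → ⟦ a ⟧ ≤ ⟦ b ⟧
⟦⟧-mono {true} {b} f rewrite f refl = ≤-refl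
⟦⟧-mono {false} f = z≤n

⟦⟧*≤ : ∀ {m o} b → (b ≡ true → m ≤ o) → ⟦ b ⟧ * m ≤ ⟦ b ⟧ * o
⟦⟧*≤ true f = *-monoʳ-≤ 1 (f refl)
⟦⟧*≤ false f = z≤n

⟦⟧*≤ʳ : ∀ b m → ⟦ b ⟧ * m ≤ m
⟦⟧*≤ʳ true m = ≤-reflexive (*-identityˡ m)
⟦⟧*≤ʳ false m = z≤n

-- One row of the adjacency matrix under a switching: the neighbour p gives way to q, so the degree
-- stays. Adding a point mass to each side avoids subtraction.
∑-move : ∀ {n} (f f′ : Fin n → Bool) {p q} → f p ≡ true → f q ≡ false → f′ p ≡ false → f′ q ≡ true →
  (∀ w → w ≢ p → w ≢ q → f′ w ≡ f w) → ∑[ w ∈ allFin n ] ⟦ f′ w ⟧ ≡ ∑[ w ∈ allFin n ] ⟦ f w ⟧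
∑-move {n} f f′ {p} {q} fp fq f′p f′q same = +-cancelʳ-≡ 1 _ _ (begin
  ∑ V (λ w → ⟦ f′ w ⟧) + 1                         ≡⟨ cong (∑ V (λ w → ⟦ f′ w ⟧) +_) (∑-δ1 p) ⟨
  ∑ V (λ w → ⟦ f′ w ⟧) + ∑ V (λ w → ⟦ w == p ⟧)    ≡⟨ ∑-+ V _ _ ⟨
  ∑ V (λ w → ⟦ f′ w ⟧ + ⟦ w == p ⟧)                ≡⟨ ∑-cong V pointwise ⟩
  ∑ V (λ w → ⟦ f w ⟧ + ⟦ w == q ⟧)                 ≡⟨ ∑-+ V _ _ ⟩
  ∑ V (λ w → ⟦ f w ⟧) + ∑ V (λ w → ⟦ w == q ⟧)     ≡⟨ cong (∑ V (λ w → ⟦ f w ⟧) +_) (∑-δ1 q) ⟩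
  ∑ V (λ w → ⟦ f w ⟧) + 1                          ∎)
  where
  open ≡-Reasoning
  V = allFin n
  pointwise : ∀ w → ⟦ f′ w ⟧ + ⟦ w == p ⟧ ≡ ⟦ f w ⟧ + ⟦ w == q ⟧
  pointwise w with w ≟ᶠ p | w ≟ᶠ q
  ... | yes refl | yes refl = contradiction (trans (sym fp) fq) λ ()
  ... | yes refl | no _ rewrite fp | f′p = refl
  ... | no _ | yes refl rewrite fq | f′q = refl
  ... | no wp | no wq rewrite same w wp wq = refl

-- Components

Matrix : ℕ → Set
Matrix n = Fin n → Fin n → Bool

Closed : ∀ {n} → Matrix n → (Fin n → Bool) → Set
Closed E S = ∀ a b → S a ≡ true → E a b ≡ true → S b ≡ true

card : ∀ {n} → (Fin n → Bool) → ℕ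
card {n} S = ∑[ w ∈ allFin n ] ⟦ S w ⟧

internalPairs : ∀ {n} → Matrix n → (Fin n → Bool) → ℕ
internalPairs {n} E S = ∑[ a ∈ allFin n ] (∑[ b ∈ allFin n ] ⟦ S a ⟧ * (⟦ S b ⟧ * ⟦ E a b ⟧))

-- Reachability is encoded as the least closed set around u, so comparing two graphs needs no paths.
-- `tree` is the fact that a connected graph on c vertices has at least c - 1 edges, each counted in
-- both directions.
record Component {n} (E : Matrix n) (u : Fin n) : Set where
  field
    mem : Fin n → Bool
    root : mem u ≡ true
    closed : Closed E mem
    least : ∀ p → p u ≡ true → Closed E p → ∀ a → mem a ≡ true → p a ≡ true
    tree : (∀ a b → E a b ≡ E b a) → 2 * card mem ≤ internalPairs E mem + 2

private
  insert : ∀ {n} → (Fin n → Bool) → Fin n → Fin n → Bool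
  insert S b w = (w == b) ∨ S w

  ⟦insert⟧ : ∀ {n} (S : Fin n → Bool) b → S b ≡ false → ∀ w → ⟦ insert S b w ⟧ ≡ ⟦ w == b ⟧ + ⟦ S w ⟧
  ⟦insert⟧ S b Sb w with w ≟ᶠ b
  ... | yes refl rewrite Sb = refl
  ... | no _ = refl

  card-insert : ∀ {n} (S : Fin n → Bool) b → S b ≡ false → card (insert S b) ≡ suc (card S)
  card-insert {n} S b Sb = begin
    card (insert S b)                                        ≡⟨ ∑-cong (allFin n) (⟦insert⟧ S b Sb) ⟩
    ∑ (allFin n) (λ w → ⟦ w == b ⟧ + ⟦ S w ⟧)                ≡⟨ ∑-+ (allFin n) _ _ ⟩
    ∑ (allFin n) (λ w → ⟦ w == b ⟧) + card S                 ≡⟨ cong (_+ card S) (∑-δ1 b) ⟩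
    suc (card S)                                             ∎
    where open ≡-Reasoning

  ∑∑-δ : ∀ {n} (a b : Fin n) → ∑[ x ∈ allFin n ] (∑[ y ∈ allFin n ] ⟦ x == a ⟧ * ⟦ y == b ⟧) ≡ 1
  ∑∑-δ {n} a b = trans
    (∑-cong (allFin n) λ x → trans (∑-*ˡ (allFin n) ⟦ x == a ⟧ _) (trans (cong (⟦ x == a ⟧ *_) (∑-δ1 b)) (*-identityʳ _)))
    (∑-δ1 a)

  -- The edge that brings b in yields the two ordered pairs (a, b) and (b, a), which pay for the new
  -- vertex in `tree`.
  pairs-insert : ∀ {n} (E : Matrix n) (S : Fin n → Bool) a b → (∀ x y → E x y ≡ E y x) →
    S a ≡ true → S b ≡ false → E a b ≡ true → internalPairs E S + 2 ≤ internalPairs E (insert S b)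
  pairs-insert {n} E S a b E-sym Sa Sb Eab = begin
    internalPairs E S + 2
      ≡⟨ cong (internalPairs E S +_) (cong₂ _+_ (∑∑-δ a b) (∑∑-δ b a)) ⟨
    internalPairs E S + (∑ V (λ x → ∑ V λ y → ⟦ x == a ⟧ * ⟦ y == b ⟧) + ∑ V (λ x → ∑ V λ y → ⟦ x == b ⟧ * ⟦ y == a ⟧))
      ≡⟨ cong (internalPairs E S +_) (∑∑-+ (λ x y → ⟦ x == a ⟧ * ⟦ y == b ⟧) (λ x y → ⟦ x == b ⟧ * ⟦ y == a ⟧)) ⟨
    internalPairs E S + ∑ V (λ x → ∑ V λ y → ⟦ x == a ⟧ * ⟦ y == b ⟧ + ⟦ x == b ⟧ * ⟦ y == a ⟧)
      ≡⟨ ∑∑-+ (λ x y → ⟦ S x ⟧ * (⟦ S y ⟧ * ⟦ E x y ⟧)) (λ x y → ⟦ x == a ⟧ * ⟦ y == b ⟧ + ⟦ x == b ⟧ * ⟦ y == a ⟧) ⟨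
    ∑ V (λ x → ∑ V λ y → ⟦ S x ⟧ * (⟦ S y ⟧ * ⟦ E x y ⟧) + (⟦ x == a ⟧ * ⟦ y == b ⟧ + ⟦ x == b ⟧ * ⟦ y == a ⟧))
      ≤⟨ ∑-mono V (λ x → ∑-mono V λ y → pointwise x y) ⟩
    internalPairs E (insert S b) ∎
    where
    open ≤-Reasoning
    V = allFin n
    ∑∑-+ : ∀ (f g : Fin n → Fin n → ℕ) → ∑ V (λ x → ∑ V λ y → f x y + g x y) ≡ ∑ V (λ x → ∑ V λ y → f x y) + ∑ V (λ x → ∑ V λ y → g x y)
    ∑∑-+ f g = trans (∑-cong V λ x → ∑-+ V (f x) (g x)) (∑-+ V _ _)
    a≢b : a ≢ b
    a≢b refl = contradiction (trans (sym Sa) Sb) λ ()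
    pointwise : ∀ x y → ⟦ S x ⟧ * (⟦ S y ⟧ * ⟦ E x y ⟧) + (⟦ x == a ⟧ * ⟦ y == b ⟧ + ⟦ x == b ⟧ * ⟦ y == a ⟧)
      ≤ ⟦ insert S b x ⟧ * (⟦ insert S b y ⟧ * ⟦ E x y ⟧)
    pointwise x y with x ≟ᶠ b | y ≟ᶠ b
    pointwise x y | yes refl | yes refl rewrite Sb | ==-≢ (a≢b ∘ sym) = z≤n
    pointwise x y | yes refl | no yb rewrite Sb | ==-≢ (a≢b ∘ sym) with y ≟ᶠ a
    ... | yes refl rewrite Sa | E-sym b a | Eab = ≤-refl
    ... | no _ = z≤n
    pointwise x y | no xb | yes refl rewrite Sb | *-zeroʳ ⟦ S x ⟧ with x ≟ᶠ a
    ... | yes refl rewrite Sa | Eab = ≤-refl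
    ... | no _ = z≤n
    pointwise x y | no xb | no yb rewrite *-zeroʳ ⟦ x == a ⟧ | +-identityʳ (⟦ S x ⟧ * (⟦ S y ⟧ * ⟦ E x y ⟧)) = ≤-refl

module _ {n} (E : Matrix n) (u : Fin n) where

  private
    record Grown (S : Fin n → Bool) : Set where
      field
        root : S u ≡ true
        least : ∀ p → p u ≡ true → Closed E p → ∀ a → S a ≡ true → p a ≡ true
        tree : (∀ a b → E a b ≡ E b a) → 2 * card S ≤ internalPairs E S + 2

    Exit : (Fin n → Bool) → Set
    Exit S = ∃ λ a → ∃ λ b → S a ≡ true × S b ≡ false × E a b ≡ true

    exit? : ∀ S → Dec (Exit S)
    exit? S = any? λ a → any? λ b → (S a ≟ᵇ true) ×-dec ((S b ≟ᵇ false) ×-dec (E a b ≟ᵇ true))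

    finished : ∀ {S} → Grown S → ¬ Exit S → Component E u
    finished {S} G none = record
      { mem = S ; root = Grown.root G ; closed = closed ; least = Grown.least G ; tree = Grown.tree G }
      where
      closed : Closed E S
      closed a b Sa Eab with S b in Sb
      ... | true = refl
      ... | false = ⊥-elim (none (a , b , Sa , Sb , Eab))

    extend : ∀ {S} → Grown S → ∀ {a b} → S a ≡ true → S b ≡ false → E a b ≡ true → Grown (insert S b)
    extend {S} G {a} {b} Sa Sb Eab = record { root = root ; least = least ; tree = tree }
      where
      root : insert S b u ≡ true
      root with u == b
      ... | true = refl
      ... | false = Grown.root G
      least : ∀ p → p u ≡ true → Closed E p → ∀ w → insert S b w ≡ true → p w ≡ true
      least p pu cl w Sw with w ≟ᶠ b
      ... | yes refl = cl a b (Grown.least G p pu cl a Sa) Eab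
      ... | no _ = Grown.least G p pu cl w Sw
      tree : (∀ x y → E x y ≡ E y x) → 2 * card (insert S b) ≤ internalPairs E (insert S b) + 2
      tree E-sym = begin
        2 * card (insert S b)              ≡⟨ cong (2 *_) (card-insert S b Sb) ⟩
        2 * suc (card S)                   ≡⟨ *-suc 2 (card S) ⟩
        2 + 2 * card S                     ≤⟨ +-monoʳ-≤ 2 (Grown.tree G E-sym) ⟩
        2 + (internalPairs E S + 2)        ≡⟨ +-comm 2 _ ⟩
        internalPairs E S + 2 + 2          ≤⟨ +-monoˡ-≤ 2 (pairs-insert E S a b E-sym Sa Sb Eab) ⟩
        internalPairs E (insert S b) + 2   ∎
        where open ≤-Reasoning

    -- Here k is fuel: every extension raises `card S`, which cannot exceed n, so with no fuel left
    -- an exit is impossible.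
    grow : ∀ k S → Grown S → n ≤ k + card S → Component E u
    grow k S G bound with exit? S
    grow k S G bound | no none = finished G none
    grow zero S G bound | yes (a , b , Sa , Sb , Eab) =
      contradiction (≤-trans (≤-reflexive (sym (card-insert S b Sb))) (∑-allFin-≤ n λ w → ⟦⟧≤1 (insert S b w))) (≤⇒≯ bound)
    grow (suc k) S G bound | yes (a , b , Sa , Sb , Eab) =
      grow k (insert S b) (extend G Sa Sb Eab)
        (subst (n ≤_) (trans (sym (+-suc k _)) (cong (k +_) (sym (card-insert S b Sb)))) bound)

    start : Grown (_== u)
    start = record
      { root = ==-refl u
      ; least = λ p pu cl a e → subst (λ x → p x ≡ true) (sym (==-sound e)) pu
      ; tree = λ _ → subst (λ c → 2 * c ≤ internalPairs E (_== u) + 2) (sym (∑-δ1 u)) (m≤n+m 2 _)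
      }

  abstract
    component : Component E u
    component = grow n (_== u) start (m≤m+n n _)

reach : ∀ {n} → Matrix n → Fin n → Fin n → Bool
reach E u = Component.mem (component E u)

reach-mono : ∀ {n} (E E′ : Matrix n) u → (∀ a b → E a b ≡ true → E′ a b ≡ true) →
  ∀ a → reach E u a ≡ true → reach E′ u a ≡ true
reach-mono E E′ u sub = Component.least (component E u) (reach E′ u) (Component.root (component E′ u))
  λ a b ra Eab → Component.closed (component E′ u) a b ra (sub a b Eab)

reach-cong : ∀ {n} (E E′ : Matrix n) u → (∀ a b → E a b ≡ E′ a b) → ∀ a → reach E u a ≡ reach E′ u a
reach-cong E E′ u eq a = iff-≡
  (reach-mono E E′ u (λ x y e → trans (sym (eq x y)) e) a)
  (reach-mono E′ E u (λ x y e → trans (eq x y) e) a)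

-- Graphs as symmetric matrices

pairAt : ∀ n → Fin (length (pairs n)) → Fin n × Fin n
pairAt n = lookup (pairs n)

-- Translation by a fixed vector permutes the cube. Toggling a fixed set of edges is such a
-- translation, and this is where all bijectivity of switchings comes from.
∑-xor : ∀ {m} (a : Vec Bool m) f → ∑ (allVecs m) f ≡ ∑[ b ∈ allVecs m ] f (Vec.zipWith _xor_ b a)
∑-xor Vec.[] f = refl
∑-xor {suc m} (x Vec.∷ a) f = begin
  ∑ (allVecs (suc m)) f
    ≡⟨ ∑-concatMap _ (allVecs m) f ⟩
  ∑ (allVecs m) (both f)
    ≡⟨ ∑-xor a (both f) ⟩
  ∑ (allVecs m) (λ b → both f (Vec.zipWith _xor_ b a))
    ≡⟨ ∑-cong (allVecs m) (swapHead x) ⟩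
  ∑ (allVecs m) (both (λ b → f (Vec.zipWith _xor_ b (x Vec.∷ a))))
    ≡⟨ ∑-concatMap _ (allVecs m) _ ⟨
  ∑ (allVecs (suc m)) (λ b → f (Vec.zipWith _xor_ b (x Vec.∷ a)))
    ∎
  where
  open ≡-Reasoning
  both : (Vec Bool (suc m) → ℕ) → Vec Bool m → ℕ
  both h b = h (true Vec.∷ b) + (h (false Vec.∷ b) + 0)
  swapHead : ∀ x b → both f (Vec.zipWith _xor_ b a) ≡ both (λ b′ → f (Vec.zipWith _xor_ b′ (x Vec.∷ a))) b
  swapHead false b = refl
  swapHead true b = begin
    p + (q + 0)  ≡⟨ cong (p +_) (+-identityʳ q) ⟩
    p + q        ≡⟨ +-comm p q ⟩
    q + p        ≡⟨ cong (q +_) (+-identityʳ p) ⟨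
    q + (p + 0)  ∎
    where
    p = f (true Vec.∷ Vec.zipWith _xor_ b a)
    q = f (false Vec.∷ Vec.zipWith _xor_ b a)

joins : ∀ {n} → Fin n × Fin n → Fin n → Fin n → Bool
joins (p , q) v w = (p == v) ∧ (q == w) ∨ (p == w) ∧ (q == v)

joins-sym : ∀ {n} (p : Fin n × Fin n) v w → joins p v w ≡ joins p w v
joins-sym (p , q) v w = ∨-comm ((p == v) ∧ (q == w)) _

Unique⇒lookup-injective : ∀ {A : Set} {xs : List A} → Unique xs → ∀ i j → lookup xs i ≡ lookup xs j → i ≡ j
Unique⇒lookup-injective (_ ∷ _) zero zero e = refl
Unique⇒lookup-injective (h ∷ _) zero (suc j) e = ⊥-elim (All.lookup h (∈-lookup j) e)
Unique⇒lookup-injective (h ∷ _) (suc i) zero e = ⊥-elim (All.lookup h (∈-lookup i) (sym e))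
Unique⇒lookup-injective (_ ∷ u) (suc i) (suc j) e = cong suc (Unique⇒lookup-injective u i j e)

private
  pairs-unique : ∀ n → Unique (pairs n)
  pairs-unique n = filter⁺ _ (cartesianProduct⁺ (allFin⁺ n) (allFin⁺ n))

  pairAt-< : ∀ {n} i → toℕ (proj₁ (pairAt n i)) < toℕ (proj₂ (pairAt n i))
  pairAt-< {n} i = proj₂ (∈-filter⁻ (λ p → toℕ (proj₁ p) ℕ.<? toℕ (proj₂ p)) {xs = Data.List.cartesianProduct (allFin n) (allFin n)} (∈-lookup i))

  position< : ∀ {n} {v w : Fin n} → toℕ v < toℕ w → ∃ λ i → pairAt n i ≡ (v , w)
  position< {n} {v} {w} v<w = index v,w∈ , sym (lookup-index v,w∈)
    where
    v,w∈ : (v , w) ∈ pairs n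
    v,w∈ = ∈-filter⁺ (λ p → toℕ (proj₁ p) ℕ.<? toℕ (proj₂ p)) (∈-cartesianProduct⁺ (∈-allFin v) (∈-allFin w)) v<w

  joins-self : ∀ {n} (v w : Fin n) → joins (v , w) v w ≡ true
  joins-self v w rewrite ==-refl v | ==-refl w = refl

  joins-sound : ∀ {n} {p q v w : Fin n} → joins (p , q) v w ≡ true → (p ≡ v × q ≡ w) ⊎ (p ≡ w × q ≡ v)
  joins-sound {p = p} {q} {v} {w} e with (p == v) in pv | (q == w) in qw | (p == w) in pw | (q == v) in qv
  ... | true | true | _ | _ = inj₁ (==-sound pv , ==-sound qw)
  ... | true | false | true | true = inj₂ (==-sound pw , ==-sound qv)
  ... | false | _ | true | true = inj₂ (==-sound pw , ==-sound qv)

  position<-unique : ∀ {n} {v w : Fin n} → toℕ v < toℕ w → ∀ {i} → pairAt n i ≡ (v , w) →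
    ∀ j → joins (pairAt n j) v w ≡ (j == i)
  position<-unique {n} {v} {w} v<w {i} e j = iff-≡ to from
    where
    to : joins (pairAt n j) v w ≡ true → (j == i) ≡ true
    to h with joins-sound {p = proj₁ (pairAt n j)} {proj₂ (pairAt n j)} h
    ... | inj₁ (pv , qw) = trans (cong (_== i) (Unique⇒lookup-injective (pairs-unique n) j i (trans (cong₂ _,_ pv qw) (sym e)))) (==-refl i)
    ... | inj₂ (pw , qv) = contradiction (subst (λ p → toℕ (proj₁ p) < toℕ (proj₂ p)) (cong₂ _,_ pw qv) (pairAt-< j)) (<⇒≯ v<w)
    from : (j == i) ≡ true → joins (pairAt n j) v w ≡ true
    from h with refl ← ==-sound {a = j} {i} h = trans (cong (λ p → joins p v w) e) (joins-self v w)

  position : ∀ {n} {v w : Fin n} → v ≢ w → ∃ λ i → ∀ j → joins (pairAt n j) v w ≡ (j == i)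
  position {n} {v} {w} ne with <-cmp (toℕ v) (toℕ w)
  ... | tri< lt _ _ = proj₁ (position< lt) , position<-unique lt (proj₂ (position< lt))
  ... | tri≈ _ eq _ = ⊥-elim (ne (toℕ-injective eq))
  ... | tri> _ _ gt = proj₁ (position< gt) ,
    λ j → trans (joins-sym (pairAt n j) v w) (position<-unique gt (proj₂ (position< gt)) j)

  position-joins : ∀ {n} {v w : Fin n} (ne : v ≢ w) → joins (pairAt n (proj₁ (position ne))) v w ≡ true
  position-joins ne = trans (proj₂ (position ne) _) (==-refl (proj₁ (position ne)))

  lookup-position : ∀ {n} (b : Vec Bool (length (pairs n))) {v w : Fin n} (ne : v ≢ w) j → joins (pairAt n j) v w ≡ true →
    Vec.lookup b (proj₁ (position ne)) ≡ Vec.lookup b j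
  lookup-position b ne j h = cong (Vec.lookup b) (sym (==-sound (trans (sym (proj₂ (position ne) j)) h)))

  does-≟true : ∀ x → does (x ≟ᵇ true) ≡ x
  does-≟true true = refl
  does-≟true false = refl

  ∑-edges : ∀ {n} (ps : List (Fin n × Fin n)) (b : Vec Bool (length ps)) h →
    ∑ (map proj₁ (filter (λ q → T? (proj₂ q)) (zip ps (Vec.toList b)))) h
    ≡ ∑[ i ∈ allFin (length ps) ] ⟦ Vec.lookup b i ⟧ * h (lookup ps i)
  ∑-edges [] Vec.[] h = refl
  ∑-edges (p ∷ ps) (true Vec.∷ b) h = trans
    (cong₂ _+_ (sym (*-identityˡ (h p))) (∑-edges ps b h))
    (sym (∑-allFin-suc (length ps) λ i → ⟦ Vec.lookup (true Vec.∷ b) i ⟧ * h (lookup (p ∷ ps) i)))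
  ∑-edges (p ∷ ps) (false Vec.∷ b) h = trans
    (∑-edges ps b h)
    (sym (∑-allFin-suc (length ps) λ i → ⟦ Vec.lookup (false Vec.∷ b) i ⟧ * h (lookup (p ∷ ps) i)))

  ∈-edges : ∀ {n} {e : Fin n × Fin n} (ps : List (Fin n × Fin n)) (b : Vec Bool (length ps)) →
    e ∈ map proj₁ (filter (λ q → T? (proj₂ q)) (zip ps (Vec.toList b))) →
    ∃ λ i → Vec.lookup b i ≡ true × lookup ps i ≡ e
  ∈-edges (p ∷ ps) (true Vec.∷ b) (here refl) = zero , refl , refl
  ∈-edges (p ∷ ps) (true Vec.∷ b) (there e∈) with i , bi , pi ← ∈-edges ps b e∈ = suc i , bi , pi
  ∈-edges (p ∷ ps) (false Vec.∷ b) e∈ with i , bi , pi ← ∈-edges ps b e∈ = suc i , bi , pi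

abstract

  edge : ∀ {n} → Graph n → Matrix n
  edge b v w with v ≟ᶠ w
  ... | yes _ = false
  ... | no ne = Vec.lookup (Graph.bits b) (proj₁ (position ne))

  edge-irr : ∀ {n} (b : Graph n) (v : Fin n) → edge b v v ≡ false
  edge-irr b v with v ≟ᶠ v
  ... | yes _ = refl
  ... | no ne = ⊥-elim (ne refl)

  edge-joins : ∀ {n} (b : Graph n) (v w : Fin n) i → v ≢ w → joins (pairAt n i) v w ≡ true → edge b v w ≡ Vec.lookup (Graph.bits b) i
  edge-joins b v w i v≢w h with v ≟ᶠ w
  ... | yes e = ⊥-elim (v≢w e)
  ... | no ne = lookup-position (Graph.bits b) ne i h

  edge-sym : ∀ {n} (b : Graph n) (v w : Fin n) → edge b v w ≡ edge b w v
  edge-sym b v w with v ≟ᶠ w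
  ... | yes refl = sym (edge-irr b v)
  ... | no ne = sym (edge-joins b w v (proj₁ (position ne)) (ne ∘ sym) (trans (joins-sym (pairAt _ (proj₁ (position ne))) w v) (position-joins ne)))

  flip : ∀ {n} → Matrix n → Graph n → Graph n
  flip {n} F b = mkGraph (Vec.zipWith _xor_ (Graph.bits b) (Vec.tabulate λ i → F (proj₁ (pairAt n i)) (proj₂ (pairAt n i))))

  ∑-flip : ∀ {n} (F : Matrix n) (f : Graph n → ℕ) → ∑ (allGraphs n) f ≡ ∑[ b ∈ allGraphs n ] f (flip F b)
  ∑-flip {n} F f = trans (∑-map mkGraph vs f) (trans (∑-xor _ (f ∘ mkGraph)) (sym (∑-map mkGraph vs (f ∘ flip F))))
    where
    vs : List (Vec Bool (length (pairs n)))
    vs = allVecs (length (pairs n))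

  edge-flip : ∀ {n} (F : Matrix n) → (∀ a b → F a b ≡ F b a) → ∀ (g : Graph n) a b → a ≢ b → edge (flip F g) a b ≡ edge g a b xor F a b
  edge-flip {n} F F-sym g a b a≢b = begin
    edge (flip F g) a b       ≡⟨ edge-joins (flip F g) a b i a≢b joined ⟩
    Vec.lookup (Graph.bits (flip F g)) i   ≡⟨ lookup-zipWith _xor_ i (Graph.bits g) _ ⟩
    Vec.lookup (Graph.bits g) i xor Vec.lookup (Vec.tabulate (λ i → F (proj₁ (pairAt n i)) (proj₂ (pairAt n i)))) i
                              ≡⟨ cong₂ _xor_ (sym (edge-joins g a b i a≢b joined)) (trans (lookup∘tabulate _ i) Fi) ⟩
    edge g a b xor F a b      ∎
    where
    open ≡-Reasoning
    i : Fin (length (pairs n))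
    i = proj₁ (position a≢b)
    joined : joins (pairAt n i) a b ≡ true
    joined = position-joins a≢b
    -- Stored pairs are increasing, so symmetry of `F` is needed when a comes after b.
    Fi : F (proj₁ (pairAt n i)) (proj₂ (pairAt n i)) ≡ F a b
    Fi with joins-sound {p = proj₁ (pairAt n i)} {proj₂ (pairAt n i)} joined
    ... | inj₁ (pa , qb) = cong₂ F pa qb
    ... | inj₂ (pb , qa) = trans (cong₂ F pb qa) (F-sym b a)

  Adj⇒edge : ∀ {n} (b : Graph n) (v w : Fin n) → Adj b v w → edge b v w ≡ true
  Adj⇒edge {n} b v w (inj₁ e) with ∈-edges (pairs n) (Graph.bits b) e
  ... | i , bi , pi = trans (edge-joins b v w i v≢w (trans (cong (λ p → joins p v w) pi) (joins-self v w))) bi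
    where
    v≢w : v ≢ w
    v≢w refl = <-irrefl refl (subst (λ p → toℕ (proj₁ p) < toℕ (proj₂ p)) pi (pairAt-< i))
  Adj⇒edge b v w (inj₂ e) = trans (edge-sym b v w) (Adj⇒edge b w v (inj₁ e))

  -- Double counting: a stored pair has distinct ends, so if it meets v it joins v to exactly one w;
  -- conversely exactly one index joins v to a given w ≢ v.
  degree-edge : ∀ {n} (b : Graph n) (v : Fin n) → degree b v ≡ ∑[ w ∈ allFin n ] ⟦ edge b v w ⟧
  degree-edge {n} b v = begin
    degree b v
      ≡⟨ length-filter-∑ (λ e → ((proj₁ e == v) ∨ (proj₂ e == v)) ≟ᵇ true) (edges b) ⟩
    ∑ (edges b) (λ e → ⟦ does (((proj₁ e == v) ∨ (proj₂ e == v)) ≟ᵇ true) ⟧)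
      ≡⟨ ∑-cong (edges b) (λ e → cong ⟦_⟧ (does-≟true ((proj₁ e == v) ∨ (proj₂ e == v)))) ⟩
    ∑ (edges b) (λ e → ⟦ (proj₁ e == v) ∨ (proj₂ e == v) ⟧)
      ≡⟨ ∑-edges (pairs n) (Graph.bits b) _ ⟩
    ∑ I (λ i → ⟦ Vec.lookup (Graph.bits b) i ⟧ * ⟦ (proj₁ (pairAt n i) == v) ∨ (proj₂ (pairAt n i) == v) ⟧)
      ≡⟨ ∑-cong I (λ i → cong (⟦ Vec.lookup (Graph.bits b) i ⟧ *_) (sym (∑-joins i))) ⟩
    ∑ I (λ i → ⟦ Vec.lookup (Graph.bits b) i ⟧ * ∑ (allFin n) (λ w → ⟦ joins (pairAt n i) v w ⟧))
      ≡⟨ ∑-cong I (λ i → sym (∑-*ˡ (allFin n) ⟦ Vec.lookup (Graph.bits b) i ⟧ _)) ⟩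
    ∑ I (λ i → ∑ (allFin n) (λ w → ⟦ Vec.lookup (Graph.bits b) i ⟧ * ⟦ joins (pairAt n i) v w ⟧))
      ≡⟨ ∑-swap I (allFin n) _ ⟩
    ∑ (allFin n) (λ w → ∑ I (λ i → ⟦ Vec.lookup (Graph.bits b) i ⟧ * ⟦ joins (pairAt n i) v w ⟧))
      ≡⟨ ∑-cong (allFin n) row ⟩
    ∑ (allFin n) (λ w → ⟦ edge b v w ⟧) ∎
    where
    open ≡-Reasoning
    I : List (Fin (length (pairs n)))
    I = allFin (length (pairs n))

    joins-split : ∀ (p q : Fin n) → p ≢ q → ∀ w → ⟦ joins (p , q) v w ⟧ ≡ ⟦ w == q ⟧ * ⟦ p == v ⟧ + ⟦ w == p ⟧ * ⟦ q == v ⟧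
    joins-split p q p≢q w rewrite ==-sym w q | ==-sym w p with p ≟ᶠ v | q ≟ᶠ w | p ≟ᶠ w | q ≟ᶠ v
    ... | yes refl | yes refl | yes pw | _ = ⊥-elim (p≢q pw)
    ... | yes refl | yes refl | no _ | _ = refl
    ... | yes refl | no _ | yes refl | yes refl = ⊥-elim (p≢q refl)
    ... | yes refl | no _ | yes refl | no _ = refl
    ... | yes refl | no _ | no _ | _ = refl
    ... | no _ | yes _ | yes _ | yes _ = refl
    ... | no _ | yes _ | yes _ | no _ = refl
    ... | no _ | yes _ | no _ | _ = refl
    ... | no _ | no _ | yes _ | yes _ = refl
    ... | no _ | no _ | yes _ | no _ = refl
    ... | no _ | no _ | no _ | _ = refl

    or-split : ∀ (p q : Fin n) → p ≢ q → ⟦ p == v ⟧ + ⟦ q == v ⟧ ≡ ⟦ (p == v) ∨ (q == v) ⟧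
    or-split p q p≢q with p ≟ᶠ v | q ≟ᶠ v
    ... | yes refl | yes refl = ⊥-elim (p≢q refl)
    ... | yes _ | no _ = refl
    ... | no _ | yes _ = refl
    ... | no _ | no _ = refl

    ∑-joins : ∀ i → ∑ (allFin n) (λ w → ⟦ joins (pairAt n i) v w ⟧) ≡ ⟦ (proj₁ (pairAt n i) == v) ∨ (proj₂ (pairAt n i) == v) ⟧
    ∑-joins i = begin
      ∑ (allFin n) (λ w → ⟦ joins (p , q) v w ⟧)
        ≡⟨ ∑-cong (allFin n) (joins-split p q p≢q) ⟩
      ∑ (allFin n) (λ w → ⟦ w == q ⟧ * ⟦ p == v ⟧ + ⟦ w == p ⟧ * ⟦ q == v ⟧)
        ≡⟨ ∑-+ (allFin n) _ _ ⟩
      ∑ (allFin n) (λ w → ⟦ w == q ⟧ * ⟦ p == v ⟧) + ∑ (allFin n) (λ w → ⟦ w == p ⟧ * ⟦ q == v ⟧)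
        ≡⟨ cong₂ _+_ (∑-δ q _) (∑-δ p _) ⟩
      ⟦ p == v ⟧ + ⟦ q == v ⟧
        ≡⟨ or-split p q p≢q ⟩
      ⟦ (p == v) ∨ (q == v) ⟧ ∎
      where
      p q : Fin n
      p = proj₁ (pairAt n i)
      q = proj₂ (pairAt n i)
      p≢q : p ≢ q
      p≢q e = <-irrefl (cong toℕ e) (pairAt-< i)

    loop : ∀ i → joins (pairAt n i) v v ≡ false
    loop i with joins (pairAt n i) v v in e
    ... | false = refl
    ... | true with joins-sound {p = proj₁ (pairAt n i)} {proj₂ (pairAt n i)} e
    ...   | inj₁ (pv , qv) = ⊥-elim (<-irrefl (cong toℕ (trans pv (sym qv))) (pairAt-< i))
    ...   | inj₂ (pv , qv) = ⊥-elim (<-irrefl (cong toℕ (trans pv (sym qv))) (pairAt-< i))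

    row : ∀ w → ∑ I (λ i → ⟦ Vec.lookup (Graph.bits b) i ⟧ * ⟦ joins (pairAt n i) v w ⟧) ≡ ⟦ edge b v w ⟧
    row w with v ≟ᶠ w
    ... | yes refl = trans (∑-cong I λ i → trans (cong (λ x → ⟦ Vec.lookup (Graph.bits b) i ⟧ * ⟦ x ⟧) (loop i)) (*-zeroʳ ⟦ Vec.lookup (Graph.bits b) i ⟧)) (∑-0 I)
    ... | no ne = trans
      (∑-cong I λ i → trans (cong (λ x → ⟦ Vec.lookup (Graph.bits b) i ⟧ * ⟦ x ⟧) (proj₂ (position ne) i)) (*-comm ⟦ Vec.lookup (Graph.bits b) i ⟧ _))
      (∑-δ (proj₁ (position ne)) (λ i → ⟦ Vec.lookup (Graph.bits b) i ⟧))

-- Switchings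

does-sound : ∀ {P : Set} (P? : Dec P) → does P? ≡ true → P
does-sound (yes p) _ = p

module Uniform {n : ℕ} (D : Fin n → ℕ) where

  abstract
    valid : Graph n → Bool
    valid b = does (all? λ a → (∑[ w ∈ allFin n ] ⟦ edge b a w ⟧) ℕ.≟ D a)

    valid-deg : ∀ {b} → valid b ≡ true → ∀ a → ∑[ w ∈ allFin n ] ⟦ edge b a w ⟧ ≡ D a
    valid-deg {b} = does-sound (all? λ a → (∑[ w ∈ allFin n ] ⟦ edge b a w ⟧) ℕ.≟ D a)

    valid-intro : ∀ {b} → (∀ a → ∑[ w ∈ allFin n ] ⟦ edge b a w ⟧ ≡ D a) → valid b ≡ true
    valid-intro {b} = dec-true (all? λ a → (∑[ w ∈ allFin n ] ⟦ edge b a w ⟧) ℕ.≟ D a)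

    valid-count : ∑[ b ∈ allGraphs n ] ⟦ valid b ⟧ ≡ numGraphs D
    valid-count = trans
      (∑-cong (allGraphs n) λ b → cong ⟦_⟧ (iff-≡
        (λ vb → dec-true (degrees? b) λ a → trans (degree-edge b a) (valid-deg vb a))
        (λ e → valid-intro λ a → trans (sym (degree-edge b a)) (does-sound (degrees? b) e a))))
      (sym (length-filter-∑ degrees? (allGraphs n)))
      where
      degrees? : ∀ b → Dec (∀ v → degree b v ≡ D v)
      degrees? b = all? λ v → degree b v ℕ.≟ D v

  -- The expectation of `f` over the uniform model, multiplied by `count`.
  Σvalid : (Graph n → ℕ) → ℕ
  Σvalid f = ∑[ b ∈ allGraphs n ] ⟦ valid b ⟧ * f b

  Σvalid-mono : ∀ {f f′} → (∀ b → valid b ≡ true → f b ≤ f′ b) → Σvalid f ≤ Σvalid f′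
  Σvalid-mono h = ∑-mono (allGraphs n) λ b → ⟦⟧*≤ (valid b) (h b)

  Σvalid-cong : ∀ {f f′} → (∀ b → valid b ≡ true → f b ≡ f′ b) → Σvalid f ≡ Σvalid f′
  Σvalid-cong h = ≤-antisym (Σvalid-mono λ b vb → ≤-reflexive (h b vb)) (Σvalid-mono λ b vb → ≤-reflexive (sym (h b vb)))

  Σvalid-+ : ∀ f f′ → Σvalid (λ b → f b + f′ b) ≡ Σvalid f + Σvalid f′
  Σvalid-+ f f′ = trans (∑-cong (allGraphs n) λ b → *-distribˡ-+ ⟦ valid b ⟧ (f b) (f′ b)) (∑-+ (allGraphs n) _ _)

  Σvalid-*ˡ : ∀ c f → Σvalid (λ b → c * f b) ≡ c * Σvalid f
  Σvalid-*ˡ c f = trans (∑-cong (allGraphs n) λ b → rot ⟦ valid b ⟧ c (f b)) (∑-*ˡ (allGraphs n) c _)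
    where
    rot : ∀ x y z → x * (y * z) ≡ y * (x * z)
    rot = solve-∀

  Σvalid-∑ : ∀ (f : Graph n → Fin n → ℕ) → Σvalid (λ b → ∑ (allFin n) (f b)) ≡ ∑[ v ∈ allFin n ] Σvalid (λ b → f b v)
  Σvalid-∑ f = trans (∑-cong (allGraphs n) λ b → sym (∑-*ˡ (allFin n) ⟦ valid b ⟧ (f b))) (∑-swap (allGraphs n) (allFin n) _)

  count : ℕ
  count = ∑[ b ∈ allGraphs n ] ⟦ valid b ⟧

  Σvalid-const : ∀ c → Σvalid (λ _ → c) ≡ count * c
  Σvalid-const c = ∑-*ʳ (allGraphs n) c _

  leaf-unique : ∀ {b} → valid b ≡ true → ∀ {ℓ} → D ℓ ≡ 1 → ∀ {z w} → edge b ℓ z ≡ true → edge b ℓ w ≡ true → z ≡ w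
  leaf-unique {b} vb {ℓ} Dℓ {z} {w} ℓz ℓw with z ≟ᶠ w
  ... | yes e = e
  ... | no z≢w = contradiction two (λ { (s≤s ()) })
    where
    open ≤-Reasoning
    pointwise : ∀ x → ⟦ x == z ⟧ + ⟦ x == w ⟧ ≤ ⟦ edge b ℓ x ⟧
    pointwise x with x ≟ᶠ z | x ≟ᶠ w
    ... | yes refl | yes refl = ⊥-elim (z≢w refl)
    ... | yes refl | no _ rewrite ℓz = ≤-refl
    ... | no _ | yes refl rewrite ℓw = ≤-refl
    ... | no _ | no _ = z≤n
    two : 2 ≤ 1
    two = begin
      2                                                                ≡⟨ cong₂ _+_ (∑-δ1 z) (∑-δ1 w) ⟨
      ∑ (allFin n) (λ x → ⟦ x == z ⟧) + ∑ (allFin n) (λ x → ⟦ x == w ⟧) ≡⟨ ∑-+ (allFin n) _ _ ⟨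
      ∑ (allFin n) (λ x → ⟦ x == z ⟧ + ⟦ x == w ⟧)                     ≤⟨ ∑-mono (allFin n) pointwise ⟩
      ∑ (allFin n) (λ x → ⟦ edge b ℓ x ⟧)                              ≡⟨ trans (valid-deg vb ℓ) Dℓ ⟩
      1                                                                ∎

  -- The root is excluded even if it has degree one, since the exploration of the core starts there.
  leaf : Fin n → Fin n → Bool
  leaf u ℓ = does (D ℓ ℕ.≟ 1) ∧ not (ℓ == u)

  leaf-deg : ∀ {u ℓ} → leaf u ℓ ≡ true → D ℓ ≡ 1
  leaf-deg {u} {ℓ} e = does-sound (D ℓ ℕ.≟ 1) (proj₁ (∧-true e))

  leaf-root : ∀ u → leaf u u ≡ false
  leaf-root u rewrite ==-refl u = ∧-zeroʳ _

  module Switching (u v : Fin n) (v≢u : v ≢ u) (2≤Dv : 2 ≤ D v) where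

    private
      V = allFin n

    leaf-≢v : ∀ {ℓ} → leaf u ℓ ≡ true → ℓ ≢ v
    leaf-≢v e refl = contradiction (subst (2 ≤_) (leaf-deg e) 2≤Dv) λ { (s≤s ()) }

    -- A switching only touches edges at v and at leaves, so it preserves the graph on the unmasked vertices.
    masked : Fin n → Bool
    masked w = leaf u w ∨ (w == v)

    coreEdge : Graph n → Matrix n
    coreEdge b x y = edge b x y ∧ (not (masked x) ∧ not (masked y))

    live : Graph n → Fin n → Bool
    live b = reach (coreEdge b) u

    masked-u : masked u ≡ false
    masked-u rewrite leaf-root u = ==-≢ (v≢u ∘ sym)

    live-unmasked : ∀ b w → live b w ≡ true → masked w ≡ false
    live-unmasked b w lw = not-true (Component.least (component (coreEdge b) u) (not ∘ masked) (cong not masked-u)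
      (λ x y _ xy → proj₂ (∧-true {not (masked x)} (proj₂ (∧-true {edge b x y} xy)))) w lw)

    module _ (ℓ y z : Fin n) where

      row col : Fin n → Bool
      row w = (w == v) ∨ (w == ℓ)
      col w = (w == y) ∨ (w == z)

      -- the edge set of the 4-cycle v y ℓ z
      cycle : Matrix n
      cycle a b = row a ∧ col b ∨ row b ∧ col a

    switch : (ℓ y z : Fin n) → Graph n → Graph n
    switch ℓ y z = flip (cycle ℓ y z)

    -- Only z has to be tested. If v z is absent then y ≢ z, and ℓ, whose only neighbour is z ≢ v,
    -- is adjacent to neither y nor v; so both new edges are free and not loops.
    bad : Graph n → Fin n → Bool
    bad b z = (z == v) ∨ edge b v z

    -- Then b minus the edges v y, ℓ z plus v z, ℓ y is again simple, with the same degrees.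
    record Good (b : Graph n) (y ℓ z : Fin n) : Set where
      field
        isValid : valid b ≡ true
        vy : edge b v y ≡ true
        isLeaf : leaf u ℓ ≡ true
        ℓz : edge b ℓ z ≡ true
        ok : bad b z ≡ false

    module Switched {b y ℓ z} (G : Good b y ℓ z) where
      open Good G

      b′ : Graph n
      b′ = switch ℓ y z b

      private
        ≢-edge : ∀ {x w} → edge b x w ≡ true → x ≢ w
        ≢-edge {x} xw refl = contradiction (trans (sym xw) (edge-irr b x)) λ ()

        ok′ : (z == v) ≡ false × edge b v z ≡ false
        ok′ with (z == v) | edge b v z | ok
        ... | false | false | _ = refl , refl

        vz : edge b v z ≡ false
        vz = proj₂ ok′

        z≢v : z ≢ v
        z≢v refl = contradiction (trans (sym (==-refl v)) (proj₁ ok′)) λ ()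

        ℓ≢v : ℓ ≢ v
        ℓ≢v = leaf-≢v isLeaf

        y≢z : y ≢ z
        y≢z refl = contradiction (trans (sym vy) vz) λ ()

        only-z : ∀ {w} → w ≢ z → edge b ℓ w ≡ false
        only-z {w} w≢z with edge b ℓ w in e
        ... | false = refl
        ... | true = ⊥-elim (w≢z (leaf-unique isValid (leaf-deg isLeaf) e ℓz))

        y≢ℓ : y ≢ ℓ
        y≢ℓ refl = contradiction (trans (sym (trans (edge-sym b y v) vy)) (only-z (z≢v ∘ sym))) λ ()

        y≢v : y ≢ v
        y≢v = ≢-edge vy ∘ sym

        z≢ℓ : z ≢ ℓ
        z≢ℓ = ≢-edge ℓz ∘ sym

        ℓy : edge b ℓ y ≡ false
        ℓy = only-z y≢z

        isRow isCol : Fin n → Bool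
        isRow = row ℓ y z
        isCol = col ℓ y z

        row-v : isRow v ≡ true
        row-v rewrite ==-refl v = refl
        row-ℓ : isRow ℓ ≡ true
        row-ℓ rewrite ==-≢ ℓ≢v = ==-refl ℓ
        row-y : isRow y ≡ false
        row-y rewrite ==-≢ y≢v = ==-≢ y≢ℓ
        row-z : isRow z ≡ false
        row-z rewrite ==-≢ z≢v = ==-≢ z≢ℓ
        col-y : isCol y ≡ true
        col-y rewrite ==-refl y = refl
        col-z : isCol z ≡ true
        col-z rewrite ==-≢ (y≢z ∘ sym) = ==-refl z
        col-v : isCol v ≡ false
        col-v rewrite ==-≢ (y≢v ∘ sym) = ==-≢ (z≢v ∘ sym)
        col-ℓ : isCol ℓ ≡ false
        col-ℓ rewrite ==-≢ (y≢ℓ ∘ sym) = ==-≢ (z≢ℓ ∘ sym)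
        R-else : ∀ {w} → w ≢ v → w ≢ ℓ → isRow w ≡ false
        R-else wv wℓ rewrite ==-≢ wv = ==-≢ wℓ
        C-else : ∀ {w} → w ≢ y → w ≢ z → isCol w ≡ false
        C-else wy wz rewrite ==-≢ wy = ==-≢ wz

        not-both : ∀ a → isRow a ∧ isCol a ≡ false
        not-both a with a ≟ᶠ v | a ≟ᶠ ℓ
        ... | yes refl | _ = col-v
        ... | no _ | yes refl = col-ℓ
        ... | no _ | no _ = refl

        edge′ : ∀ a w → edge b′ a w ≡ edge b a w xor cycle ℓ y z a w
        edge′ a w with a ≟ᶠ w
        ... | no ne = edge-flip (cycle ℓ y z) (λ p q → ∨-comm (isRow p ∧ isCol q) _) b a w ne
        -- `edge-flip` does not cover the diagonal; there both matrices vanish, and so does the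
        -- cycle, because no vertex lies on both of its sides.
        ... | yes refl rewrite edge-irr b′ a | edge-irr b a | not-both a = refl

        xor-false : ∀ x → x xor false ≡ x
        xor-false true = refl
        xor-false false = refl

        edge′-RC : ∀ {a} → isRow a ≡ true → isCol a ≡ false → ∀ w → edge b′ a w ≡ edge b a w xor isCol w
        edge′-RC {a} Ra Ca w rewrite edge′ a w | Ra | Ca | ∧-zeroʳ (isRow w) with isCol w
        ... | true = refl
        ... | false = refl

        edge′-CR : ∀ {a} → isRow a ≡ false → isCol a ≡ true → ∀ w → edge b′ a w ≡ edge b a w xor isRow w
        edge′-CR {a} Ra Ca w rewrite edge′ a w | Ra | Ca with isRow w
        ... | true = refl
        ... | false = refl

      edge′-away : ∀ {a w} → isRow a ≡ false → isRow w ≡ false → edge b′ a w ≡ edge b a w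
      edge′-away {a} {w} Ra Rw rewrite edge′ a w | Ra | Rw = xor-false _

      private
        edge′-CC : ∀ {a} → isRow a ≡ false → isCol a ≡ false → ∀ w → edge b′ a w ≡ edge b a w
        edge′-CC {a} Ra Ca w rewrite edge′ a w | Ra | Ca | ∧-zeroʳ (isRow w) = xor-false _

        via : ∀ {a w x c} → edge b′ a w ≡ edge b a w xor c → edge b a w ≡ x → ∀ {c′} → c ≡ c′ → edge b′ a w ≡ x xor c′
        via e refl refl = e

        same : ∀ {a w c} → edge b′ a w ≡ edge b a w xor c → c ≡ false → edge b′ a w ≡ edge b a w
        same e refl = trans e (xor-false _)

      edge′-v : ∀ {w} → w ≢ y → w ≢ z → edge b′ v w ≡ edge b v w
      edge′-v {w} wy wz = same (edge′-RC row-v col-v w) (C-else wy wz)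

      private
        deg′ : ∀ a → ∑[ w ∈ V ] ⟦ edge b′ a w ⟧ ≡ ∑[ w ∈ V ] ⟦ edge b a w ⟧
        deg′ a with a ≟ᶠ v | a ≟ᶠ ℓ | a ≟ᶠ y | a ≟ᶠ z
        ... | yes refl | _ | _ | _ = ∑-move (edge b v) (edge b′ v) vy vz
          (via (edge′-RC row-v col-v y) vy col-y) (via (edge′-RC row-v col-v z) vz col-z)
          (λ w wy wz → edge′-v wy wz)
        ... | no _ | yes refl | _ | _ = ∑-move (edge b ℓ) (edge b′ ℓ) ℓz ℓy
          (via (edge′-RC row-ℓ col-ℓ z) ℓz col-z) (via (edge′-RC row-ℓ col-ℓ y) ℓy col-y)
          (λ w wz wy → same (edge′-RC row-ℓ col-ℓ w) (C-else wy wz))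
        ... | no _ | no _ | yes refl | _ = ∑-move (edge b y) (edge b′ y) (trans (edge-sym b y v) vy) (trans (edge-sym b y ℓ) ℓy)
          (via (edge′-CR row-y col-y v) (trans (edge-sym b y v) vy) row-v) (via (edge′-CR row-y col-y ℓ) (trans (edge-sym b y ℓ) ℓy) row-ℓ)
          (λ w wv wℓ → same (edge′-CR row-y col-y w) (R-else wv wℓ))
        ... | no _ | no _ | no _ | yes refl = ∑-move (edge b z) (edge b′ z) (trans (edge-sym b z ℓ) ℓz) (trans (edge-sym b z v) vz)
          (via (edge′-CR row-z col-z ℓ) (trans (edge-sym b z ℓ) ℓz) row-ℓ) (via (edge′-CR row-z col-z v) (trans (edge-sym b z v) vz) row-v)
          (λ w wℓ wv → same (edge′-CR row-z col-z w) (R-else wv wℓ))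
        ... | no av | no aℓ | no ay | no az = ∑-cong V λ w → cong ⟦_⟧ (edge′-CC (R-else av aℓ) (C-else ay az) w)

      -- The inverse switching toggles the same 4-cycle with y and z exchanged, so b′ is again a
      -- legal starting point, with z as neighbour of v and y as neighbour of ℓ.
      good′ : Good b′ z ℓ y
      good′ = record
        { isValid = valid-intro λ a → trans (deg′ a) (valid-deg isValid a)
        ; vy = via (edge′-RC row-v col-v z) vz col-z
        ; isLeaf = isLeaf
        ; ℓz = via (edge′-RC row-ℓ col-ℓ y) ℓy col-y
        ; ok = subst (λ x → x ∨ edge b′ v y ≡ false) (sym (==-≢ y≢v)) (via (edge′-RC row-v col-v y) vy col-y)
        }

      unmasked-R : ∀ {w} → masked w ≡ false → isRow w ≡ false
      unmasked-R {w} mw with w ≟ᶠ v | w ≟ᶠ ℓ | leaf u w in lw | mw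
      ... | yes _ | _ | true | ()
      ... | yes _ | _ | false | ()
      ... | no _ | yes refl | false | _ = contradiction (trans (sym lw) isLeaf) λ ()
      ... | no _ | no _ | _ | _ = refl

      -- Each of the four toggled edges ends at v or ℓ, and both are masked, so the core is
      -- literally the same graph.
      live′ : ∀ w → live b w ≡ live b′ w
      live′ = reach-cong (coreEdge b) (coreEdge b′) u core′
        where
        core′ : ∀ x w → coreEdge b x w ≡ coreEdge b′ x w
        core′ x w with masked x in mx | masked w in mw
        ... | true | _ = trans (∧-zeroʳ _) (sym (∧-zeroʳ _))
        ... | false | true = trans (∧-zeroʳ _) (sym (∧-zeroʳ _))
        ... | false | false = cong (_∧ true) (sym (edge′-away (unmasked-R mx) (unmasked-R mw)))

∑-pull : ∀ {A : Set} (xs : List A) c (e f : A → ℕ) → c * (∑[ x ∈ xs ] (e x * f x)) ≡ ∑[ x ∈ xs ] (c * e x * f x)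
∑-pull xs c e f = trans (sym (∑-*ˡ xs c _)) (∑-cong xs λ x → sym (*-assoc c (e x) (f x)))

∑-split : ∀ {n} (a : Fin n) f → ∑ (allFin n) (λ w → ⟦ not (w == a) ⟧ * f w) + f a ≡ ∑ (allFin n) f
∑-split {n} a f = begin
  ∑ V (λ w → ⟦ not (w == a) ⟧ * f w) + f a                              ≡⟨ cong (∑ V (λ w → ⟦ not (w == a) ⟧ * f w) +_) (∑-δ a f) ⟨
  ∑ V (λ w → ⟦ not (w == a) ⟧ * f w) + ∑ V (λ w → ⟦ w == a ⟧ * f w)     ≡⟨ ∑-+ V _ _ ⟨
  ∑ V (λ w → ⟦ not (w == a) ⟧ * f w + ⟦ w == a ⟧ * f w)                 ≡⟨ ∑-cong V (λ w → one (w == a) (f w)) ⟩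
  ∑ V f                                                                 ∎
  where
  open ≡-Reasoning
  V = allFin n
  one : ∀ x t → ⟦ not x ⟧ * t + ⟦ x ⟧ * t ≡ t
  one true t = *-identityˡ t
  one false t = trans (+-identityʳ _) (*-identityˡ t)

-- Averaging over switchings

module Counting {n : ℕ} (D : Fin n → ℕ) (B : ℕ) where

  open Uniform D

  big : Fin n → Bool
  big w = does (B ℕ.<? D w)

  small : ∀ {w} → big w ≡ false → D w ≤ B
  small {w} e = ≮⇒≥ λ lt → contradiction (trans (sym (dec-true (B ℕ.<? D w) lt)) e) λ ()

  bigDegrees : ℕ
  bigDegrees = ∑[ w ∈ allFin n ] ⟦ big w ⟧ * D w

  -- Bounds the leaves hanging on a bad z: at most B on v itself, at most B on each of at most B
  -- small neighbours of v, and at most `bigDegrees` on big vertices.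
  badBound : ℕ
  badBound = B + (B * B + bigDegrees)

  leaves : Fin n → ℕ
  leaves u = ∑[ ℓ ∈ allFin n ] ⟦ leaf u ℓ ⟧

  module Averages (u v : Fin n) (v≢u : v ≢ u) (2≤Dv : 2 ≤ D v) (Dv≤B : D v ≤ B) where

    open Switching u v v≢u 2≤Dv

    private
      V = allFin n
      m = leaves u
      d = D v

    Y : Graph n → (Fin n → ℕ) → ℕ
    Y b f = ∑[ y ∈ V ] ⟦ edge b v y ⟧ * f y

    Z : Graph n → (Fin n → Fin n → ℕ) → ℕ
    Z b p = ∑[ ℓ ∈ V ] ⟦ leaf u ℓ ⟧ * (∑[ z ∈ V ] ⟦ edge b ℓ z ⟧ * p ℓ z)

    Weight : Set
    Weight = Graph n → Fin n → Fin n → Fin n → ℕ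

    tri : Graph n → (Fin n → Fin n → Fin n → ℕ) → ℕ
    tri b W = Y b λ y → Z b (W y)

    -- Totals over a graph together with an edge v y and a leaf edge ℓ z in it; `GoodTot` keeps the
    -- configurations from which the switching is legal.
    Tot GoodTot : Weight → ℕ
    Tot W = Σvalid λ b → tri b (W b)
    GoodTot W = Tot λ b y ℓ z → ⟦ not (bad b z) ⟧ * W b y ℓ z

    Y-mono : ∀ b {f f′} → (∀ y → f y ≤ f′ y) → Y b f ≤ Y b f′
    Y-mono b h = ∑-mono V λ y → *-monoʳ-≤ ⟦ edge b v y ⟧ (h y)

    Y-+ : ∀ b f f′ → Y b (λ y → f y + f′ y) ≡ Y b f + Y b f′
    Y-+ b f f′ = trans (∑-cong V λ y → *-distribˡ-+ ⟦ edge b v y ⟧ (f y) (f′ y)) (∑-+ V _ _)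

    Y-*ʳ : ∀ b c f → Y b (λ y → f y * c) ≡ Y b f * c
    Y-*ʳ b c f = trans (∑-cong V λ y → sym (*-assoc ⟦ edge b v y ⟧ (f y) c)) (∑-*ʳ V c _)

    Y-const : ∀ {b} → valid b ≡ true → ∀ c → Y b (λ _ → c) ≡ d * c
    Y-const vb c = trans (∑-*ʳ V c _) (cong (_* c) (valid-deg vb v))

    Z-mono : ∀ b {p p′} → (∀ ℓ z → p ℓ z ≤ p′ ℓ z) → Z b p ≤ Z b p′
    Z-mono b h = ∑-mono V λ ℓ → *-monoʳ-≤ ⟦ leaf u ℓ ⟧ (∑-mono V λ z → *-monoʳ-≤ ⟦ edge b ℓ z ⟧ (h ℓ z))

    Z-+ : ∀ b p p′ → Z b (λ ℓ z → p ℓ z + p′ ℓ z) ≡ Z b p + Z b p′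
    Z-+ b p p′ = trans
      (∑-cong V λ ℓ → trans
        (cong (⟦ leaf u ℓ ⟧ *_) (trans (∑-cong V λ z → *-distribˡ-+ ⟦ edge b ℓ z ⟧ (p ℓ z) (p′ ℓ z)) (∑-+ V _ _)))
        (*-distribˡ-+ ⟦ leaf u ℓ ⟧ _ _))
      (∑-+ V _ _)

    Z-ℓ : ∀ {b} → valid b ≡ true → ∀ (f : Fin n → ℕ) → Z b (λ ℓ _ → f ℓ) ≡ ∑[ ℓ ∈ V ] ⟦ leaf u ℓ ⟧ * f ℓ
    Z-ℓ {b} vb f = ∑-cong V λ ℓ → trans (cong (⟦ leaf u ℓ ⟧ *_) (∑-*ʳ V (f ℓ) _)) (deg1 ℓ)
      where
      deg1 : ∀ ℓ → ⟦ leaf u ℓ ⟧ * (∑ V (λ z → ⟦ edge b ℓ z ⟧) * f ℓ) ≡ ⟦ leaf u ℓ ⟧ * f ℓ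
      deg1 ℓ with leaf u ℓ in e
      ... | false = refl
      ... | true rewrite valid-deg vb ℓ | leaf-deg {u} e = cong (_+ 0) (*-identityˡ (f ℓ))

    Z-*ˡ : ∀ b c p → Z b (λ ℓ z → c * p ℓ z) ≡ c * Z b p
    Z-*ˡ b c p = trans
      (∑-cong V λ ℓ → trans
        (cong (⟦ leaf u ℓ ⟧ *_) (trans (∑-cong V λ z → rot ⟦ edge b ℓ z ⟧ c (p ℓ z)) (∑-*ˡ V c _)))
        (rot ⟦ leaf u ℓ ⟧ c _))
      (∑-*ˡ V c _)
      where
      rot : ∀ x y z → x * (y * z) ≡ y * (x * z)
      rot = solve-∀

    tri-mono : ∀ b {W W′} → (∀ y ℓ z → W y ℓ z ≤ W′ y ℓ z) → tri b W ≤ tri b W′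
    tri-mono b h = Y-mono b λ y → Z-mono b (h y)

    tri-product : ∀ b f p → tri b (λ y ℓ z → f y * p ℓ z) ≡ Y b f * Z b p
    tri-product b f p = trans (∑-cong V λ y → cong (⟦ edge b v y ⟧ *_) (Z-*ˡ b (f y) p)) (Y-*ʳ b (Z b p) f)

    ∑³ : (Fin n → Fin n → Fin n → ℕ) → ℕ
    ∑³ f = ∑[ y ∈ V ] (∑[ ℓ ∈ V ] (∑[ z ∈ V ] f y ℓ z))

    private
      ∑³-mono : ∀ {f f′} → (∀ y ℓ z → f y ℓ z ≤ f′ y ℓ z) → ∑³ f ≤ ∑³ f′
      ∑³-mono h = ∑-mono V λ y → ∑-mono V λ ℓ → ∑-mono V λ z → h y ℓ z

      ∑³-reverse : ∀ f → ∑³ (λ y ℓ z → f z ℓ y) ≡ ∑³ f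
      ∑³-reverse f = begin
        ∑ V (λ y → ∑ V λ ℓ → ∑ V λ z → f z ℓ y)  ≡⟨ ∑-cong V (λ y → ∑-swap V V _) ⟩
        ∑ V (λ y → ∑ V λ z → ∑ V λ ℓ → f z ℓ y)  ≡⟨ ∑-swap V V _ ⟩
        ∑ V (λ z → ∑ V λ y → ∑ V λ ℓ → f z ℓ y)  ≡⟨ ∑-cong V (λ z → ∑-swap V V _) ⟩
        ∑ V (λ z → ∑ V λ ℓ → ∑ V λ y → f z ℓ y)  ∎
        where open ≡-Reasoning

      ∑³-out : ∀ {A : Set} (xs : List A) (f : A → Fin n → Fin n → Fin n → ℕ) → ∑[ x ∈ xs ] ∑³ (f x) ≡ ∑³ (λ y ℓ z → ∑[ x ∈ xs ] f x y ℓ z)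
      ∑³-out xs f = trans (∑-swap xs V _) (∑-cong V λ y → trans (∑-swap xs V _) (∑-cong V λ ℓ → ∑-swap xs V _))

      weight : Graph n → Fin n → Fin n → Fin n → ℕ
      weight b y ℓ z = ⟦ valid b ⟧ * ⟦ edge b v y ⟧ * ⟦ leaf u ℓ ⟧ * ⟦ edge b ℓ z ⟧

      flatten : ∀ b W → ⟦ valid b ⟧ * tri b W ≡ ∑³ (λ y ℓ z → weight b y ℓ z * W y ℓ z)
      flatten b W = trans (∑-pull V ⟦ valid b ⟧ _ _) (∑-cong V λ y →
        trans (∑-pull V (⟦ valid b ⟧ * ⟦ edge b v y ⟧) _ _) (∑-cong V λ ℓ →
        ∑-pull V (⟦ valid b ⟧ * ⟦ edge b v y ⟧ * ⟦ leaf u ℓ ⟧) _ _))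

      -- Moving the triple outside fixes the toggled 4-cycle while the graph varies.
      Tot-flat : ∀ W → Tot W ≡ ∑³ (λ y ℓ z → ∑[ b ∈ allGraphs n ] (weight b y ℓ z * W b y ℓ z))
      Tot-flat W = trans (∑-cong (allGraphs n) λ b → flatten b (W b)) (∑³-out (allGraphs n) _)

      goodWeight : Graph n → Fin n → Fin n → Fin n → ℕ → ℕ
      goodWeight b y ℓ z w = weight b y ℓ z * (⟦ not (bad b z) ⟧ * w)

      goodWeight-≤ : ∀ b y ℓ z w {x} → (Good b y ℓ z → w ≤ x) → goodWeight b y ℓ z w ≤ x
      goodWeight-≤ b y ℓ z w h with valid b in e₁ | edge b v y in e₂ | leaf u ℓ in e₃ | edge b ℓ z in e₄ | bad b z in e₅
      ... | false | _ | _ | _ | _ = z≤n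
      ... | true | false | _ | _ | _ = z≤n
      ... | true | true | false | _ | _ = z≤n
      ... | true | true | true | false | _ = z≤n
      ... | true | true | true | true | true = z≤n
      ... | true | true | true | true | false =
        ≤-trans (≤-reflexive (trans (*-identityˡ (1 * w)) (*-identityˡ w)))
          (h (record { isValid = e₁ ; vy = e₂ ; isLeaf = e₃ ; ℓz = e₄ ; ok = e₅ }))

      goodWeight-≥ : ∀ {b y ℓ z} w → Good b y ℓ z → w ≤ goodWeight b y ℓ z w
      goodWeight-≥ w G rewrite Good.isValid G | Good.vy G | Good.isLeaf G | Good.ℓz G | Good.ok G =
        ≤-reflexive (sym (trans (*-identityˡ (1 * w)) (*-identityˡ w)))

    -- For a fixed triple the switching is a translation, so `∑-flip` re-indexes the graphs, and
    -- `good′` ensures that legal configurations land on legal ones. Renaming y and z then restores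
    -- the form of `GoodTot`.
    switching : ∀ (W W′ : Weight) →
      (∀ {b y ℓ z} → Good b y ℓ z → W b y ℓ z ≤ W′ (switch ℓ y z b) z ℓ y) → GoodTot W ≤ GoodTot W′
    switching W W′ h = begin
      GoodTot W
        ≡⟨ Tot-flat _ ⟩
      ∑³ (λ y ℓ z → ∑[ b ∈ allGraphs n ] goodWeight b y ℓ z (W b y ℓ z))
        ≤⟨ ∑³-mono (λ y ℓ z → ∑-mono (allGraphs n) λ b → pointwise b y ℓ z) ⟩
      ∑³ (λ y ℓ z → ∑[ b ∈ allGraphs n ] goodWeight (switch ℓ y z b) z ℓ y (W′ (switch ℓ y z b) z ℓ y))
        ≤⟨ ∑³-mono (λ y ℓ z → ≤-reflexive (sym (∑-flip (cycle ℓ y z) λ b → goodWeight b z ℓ y (W′ b z ℓ y)))) ⟩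
      ∑³ (λ y ℓ z → ∑[ b ∈ allGraphs n ] goodWeight b z ℓ y (W′ b z ℓ y))
        ≡⟨ ∑³-reverse (λ y ℓ z → ∑[ b ∈ allGraphs n ] goodWeight b y ℓ z (W′ b y ℓ z)) ⟩
      ∑³ (λ y ℓ z → ∑[ b ∈ allGraphs n ] goodWeight b y ℓ z (W′ b y ℓ z))
        ≡⟨ Tot-flat _ ⟨
      GoodTot W′ ∎
      where
      open ≤-Reasoning
      pointwise : ∀ b y ℓ z → goodWeight b y ℓ z (W b y ℓ z) ≤ goodWeight (switch ℓ y z b) z ℓ y (W′ (switch ℓ y z b) z ℓ y)
      pointwise b y ℓ z = goodWeight-≤ b y ℓ z (W b y ℓ z) λ G →
        ≤-trans (h G) (goodWeight-≥ (W′ (switch ℓ y z b) z ℓ y) (Switched.good′ G))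

    bad-leaves : ∀ {b} → valid b ≡ true → Z b (λ _ z → ⟦ bad b z ⟧) ≤ badBound
    bad-leaves {b} vb = begin
      Z b (λ _ z → ⟦ bad b z ⟧)
        ≤⟨ ∑-mono V (λ ℓ → ⟦⟧*≤ʳ (leaf u ℓ) _) ⟩
      ∑ V (λ ℓ → ∑ V λ z → ⟦ edge b ℓ z ⟧ * ⟦ bad b z ⟧)
        ≡⟨ ∑-swap V V _ ⟩
      ∑ V (λ z → ∑ V λ ℓ → ⟦ edge b ℓ z ⟧ * ⟦ bad b z ⟧)
        ≡⟨ ∑-cong V (λ z → trans (∑-*ʳ V ⟦ bad b z ⟧ _) (cong (_* ⟦ bad b z ⟧) (column z))) ⟩
      ∑ V (λ z → D z * ⟦ bad b z ⟧)
        ≤⟨ ∑-mono V pointwise ⟩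
      ∑ V (λ z → ⟦ z == v ⟧ * D z + (⟦ edge b v z ⟧ * B + ⟦ big z ⟧ * D z))
        ≡⟨ trans (∑-+ V _ _) (cong₂ _+_ (∑-δ v D) (∑-+ V _ _)) ⟩
      D v + (∑ V (λ z → ⟦ edge b v z ⟧ * B) + bigDegrees)
        ≡⟨ cong (λ x → D v + (x + bigDegrees)) (Y-const vb B) ⟩
      D v + (D v * B + bigDegrees)
        ≤⟨ +-mono-≤ Dv≤B (+-monoˡ-≤ bigDegrees (*-monoˡ-≤ B Dv≤B)) ⟩
      badBound ∎
      where
      open ≤-Reasoning
      column : ∀ z → ∑ V (λ ℓ → ⟦ edge b ℓ z ⟧) ≡ D z
      column z = trans (∑-cong V λ ℓ → cong ⟦_⟧ (edge-sym b ℓ z)) (valid-deg vb z)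
      pointwise : ∀ z → D z * ⟦ bad b z ⟧ ≤ ⟦ z == v ⟧ * D z + (⟦ edge b v z ⟧ * B + ⟦ big z ⟧ * D z)
      pointwise z with z == v | edge b v z
      ... | true | _ = ≤-trans (≤-reflexive (*-comm (D z) 1)) (m≤m+n _ _)
      ... | false | false = ≤-trans (≤-reflexive (*-zeroʳ (D z))) z≤n
      ... | false | true with big z in e
      ...   | true = ≤-trans (≤-reflexive (*-comm (D z) 1)) (m≤n+m (1 * D z) (1 * B))
      ...   | false = ≤-trans (≤-trans (≤-reflexive (*-comm (D z) 1)) (*-monoʳ-≤ 1 (small e))) (m≤m+n (1 * B) _)

    -- The error is the price of illegal configurations: d choices of y, at most `badBound` leaves
    -- on a bad z, weight at most ω each.
    swap : ∀ (W W′ : Weight) ω → (∀ b → valid b ≡ true → ∀ y ℓ z → W b y ℓ z ≤ ω) →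
      (∀ {b y ℓ z} → Good b y ℓ z → W b y ℓ z ≤ W′ (switch ℓ y z b) z ℓ y) →
      Tot W ≤ Tot W′ + count * (d * (ω * badBound))
    swap W W′ ω W≤ω h = begin
      Tot W
        ≤⟨ Σvalid-mono per-graph ⟩
      Σvalid (λ b → tri b (λ y ℓ z → ⟦ not (bad b z) ⟧ * W b y ℓ z) + d * (ω * badBound))
        ≡⟨ trans (Σvalid-+ _ _) (cong (GoodTot W +_) (Σvalid-const _)) ⟩
      GoodTot W + count * (d * (ω * badBound))
        ≤⟨ +-monoˡ-≤ _ (switching W W′ h) ⟩
      GoodTot W′ + count * (d * (ω * badBound))
        ≤⟨ +-monoˡ-≤ _ (Σvalid-mono λ b _ → tri-mono b λ y ℓ z → ⟦⟧*≤ʳ (not (bad b z)) (W′ b y ℓ z)) ⟩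
      Tot W′ + count * (d * (ω * badBound)) ∎
      where
      open ≤-Reasoning
      split : ∀ x {w} → w ≤ ω → w ≤ ⟦ not x ⟧ * w + ω * ⟦ x ⟧
      split true {w} w≤ω = ≤-trans w≤ω (≤-reflexive (sym (*-identityʳ ω)))
      split false {w} w≤ω = ≤-trans (≤-reflexive (sym (*-identityˡ w))) (m≤m+n _ _)
      per-graph : ∀ b → valid b ≡ true →
        tri b (W b) ≤ tri b (λ y ℓ z → ⟦ not (bad b z) ⟧ * W b y ℓ z) + d * (ω * badBound)
      per-graph b vb = begin
        tri b (W b)
          ≤⟨ tri-mono b (λ y ℓ z → split (bad b z) (W≤ω b vb y ℓ z)) ⟩
        tri b (λ y ℓ z → ⟦ not (bad b z) ⟧ * W b y ℓ z + ω * ⟦ bad b z ⟧)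
          ≡⟨ trans (∑-cong V λ y → cong (⟦ edge b v y ⟧ *_) (Z-+ b _ _)) (Y-+ b _ _) ⟩
        tri b (λ y ℓ z → ⟦ not (bad b z) ⟧ * W b y ℓ z) + tri b (λ y ℓ z → ω * ⟦ bad b z ⟧)
          ≡⟨ cong (tri b (λ y ℓ z → ⟦ not (bad b z) ⟧ * W b y ℓ z) +_) (tri-product b (λ _ → ω) (λ _ z → ⟦ bad b z ⟧)) ⟩
        tri b (λ y ℓ z → ⟦ not (bad b z) ⟧ * W b y ℓ z) + Y b (λ _ → ω) * Z b (λ _ z → ⟦ bad b z ⟧)
          ≤⟨ +-monoʳ-≤ _ (*-mono-≤ (≤-reflexive (Y-const vb ω)) (bad-leaves vb)) ⟩
        tri b (λ y ℓ z → ⟦ not (bad b z) ⟧ * W b y ℓ z) + d * ω * badBound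
          ≡⟨ cong (tri b (λ y ℓ z → ⟦ not (bad b z) ⟧ * W b y ℓ z) +_) (*-assoc d ω badBound) ⟩
        tri b (λ y ℓ z → ⟦ not (bad b z) ⟧ * W b y ℓ z) + d * (ω * badBound) ∎

    -- Moments of the live neighbours of v and of the live leaves

    live₁ : Graph n → Fin n → ℕ
    live₁ b w = ⟦ live b w ⟧

    k : Graph n → ℕ
    k b = Y b (live₁ b)

    x : Graph n → Fin n → ℕ
    x b ℓ = ∑[ z ∈ V ] ⟦ edge b ℓ z ⟧ * live₁ b z

    X : Graph n → ℕ
    X b = ∑[ ℓ ∈ V ] ⟦ leaf u ℓ ⟧ * x b ℓ

    -- A switching replaces the neighbour y of v and re-hangs the leaf ℓ. Leaving out y here, and ℓ
    -- in `Xothers`, gives quantities that do not decrease under it.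
    others : Graph n → Fin n → ℕ
    others b y = ∑[ w ∈ V ] ⟦ not (w == y) ⟧ * (⟦ edge b v w ⟧ * live₁ b w)

    Xothers : Graph n → Fin n → ℕ
    Xothers b ℓ = ∑[ w ∈ V ] ⟦ not (w == ℓ) ⟧ * (⟦ leaf u w ⟧ * x b w)

    others-+ : ∀ b y → others b y + ⟦ edge b v y ⟧ * live₁ b y ≡ k b
    others-+ b y = ∑-split y λ w → ⟦ edge b v w ⟧ * live₁ b w

    Xothers-+ : ∀ b ℓ → Xothers b ℓ + ⟦ leaf u ℓ ⟧ * x b ℓ ≡ X b
    Xothers-+ b ℓ = ∑-split ℓ λ w → ⟦ leaf u w ⟧ * x b w

    module _ {b} (vb : valid b ≡ true) where

      k≤d : k b ≤ d
      k≤d = begin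
        Y b (live₁ b)   ≤⟨ Y-mono b (λ y → ⟦⟧≤1 (live b y)) ⟩
        Y b (λ _ → 1)   ≡⟨ Y-const vb 1 ⟩
        d * 1           ≡⟨ *-identityʳ d ⟩
        d               ∎
        where open ≤-Reasoning

      others≤d : ∀ y → others b y ≤ d
      others≤d y = ≤-trans (≤-trans (m≤m+n _ _) (≤-reflexive (others-+ b y))) k≤d

      leaf-x≤1 : ∀ ℓ → ⟦ leaf u ℓ ⟧ * x b ℓ ≤ 1
      leaf-x≤1 ℓ with leaf u ℓ in e
      ... | false = z≤n
      ... | true = begin
        1 * x b ℓ                        ≡⟨ *-identityˡ _ ⟩
        x b ℓ                            ≤⟨ ∑-mono V (λ z → *-monoʳ-≤ ⟦ edge b ℓ z ⟧ (⟦⟧≤1 (live b z))) ⟩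
        ∑ V (λ z → ⟦ edge b ℓ z ⟧ * 1)   ≡⟨ ∑-cong V (λ z → *-identityʳ _) ⟩
        ∑ V (λ z → ⟦ edge b ℓ z ⟧)       ≡⟨ trans (valid-deg vb ℓ) (leaf-deg {u} e) ⟩
        1                                ∎
        where open ≤-Reasoning

      leaf-x≤leaf : ∀ ℓ → ⟦ leaf u ℓ ⟧ * x b ℓ ≤ ⟦ leaf u ℓ ⟧
      leaf-x≤leaf ℓ with leaf u ℓ | leaf-x≤1 ℓ
      ... | false | _ = z≤n
      ... | true | h = h

      X≤m : X b ≤ m
      X≤m = ∑-mono V leaf-x≤leaf

      Xothers≤X : ∀ ℓ → Xothers b ℓ ≤ X b
      Xothers≤X ℓ = ≤-trans (m≤m+n _ _) (≤-reflexive (Xothers-+ b ℓ))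

      Y-others : Y b (others b) + k b ≡ d * k b
      Y-others = begin
        Y b (others b) + k b
          ≡⟨ cong (Y b (others b) +_) (∑-cong V λ y → idem (edge b v y) (live₁ b y)) ⟩
        Y b (others b) + Y b (λ y → ⟦ edge b v y ⟧ * live₁ b y)
          ≡⟨ Y-+ b _ _ ⟨
        Y b (λ y → others b y + ⟦ edge b v y ⟧ * live₁ b y)
          ≡⟨ ∑-cong V (λ y → cong (⟦ edge b v y ⟧ *_) (others-+ b y)) ⟩
        Y b (λ _ → k b)
          ≡⟨ Y-const vb (k b) ⟩
        d * k b ∎
        where
        open ≡-Reasoning
        idem : ∀ e t → ⟦ e ⟧ * t ≡ ⟦ e ⟧ * (⟦ e ⟧ * t)
        idem true t = sym (*-identityˡ _)
        idem false t = refl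

      Y-live-others : Y b (λ y → others b y * live₁ b y) + k b ≡ k b * k b
      Y-live-others = begin
        Y b (λ y → others b y * live₁ b y) + k b
          ≡⟨ cong (Y b (λ y → others b y * live₁ b y) +_) (∑-cong V λ y → idem (edge b v y) (live b y)) ⟩
        Y b (λ y → others b y * live₁ b y) + Y b (λ y → ⟦ edge b v y ⟧ * live₁ b y * live₁ b y)
          ≡⟨ Y-+ b _ _ ⟨
        Y b (λ y → others b y * live₁ b y + ⟦ edge b v y ⟧ * live₁ b y * live₁ b y)
          ≡⟨ ∑-cong V (λ y → cong (⟦ edge b v y ⟧ *_) (trans (sym (*-distribʳ-+ (live₁ b y) (others b y) _)) (trans (cong (_* live₁ b y) (others-+ b y)) (*-comm (k b) _)))) ⟩
        Y b (λ y → live₁ b y * k b)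
          ≡⟨ Y-*ʳ b (k b) (live₁ b) ⟩
        k b * k b ∎
        where
        open ≡-Reasoning
        idem : ∀ e c → ⟦ e ⟧ * ⟦ c ⟧ ≡ ⟦ e ⟧ * (⟦ e ⟧ * ⟦ c ⟧ * ⟦ c ⟧)
        idem true true = refl
        idem true false = refl
        idem false c = refl

      -- The diagonal of the square is at most X, as each leaf contributes at most one. It is split
      -- off because the switching moves ℓ, so only pairs of distinct leaves can be followed.
      X²-≤ : X b * X b ≤ Z b (λ ℓ z → live₁ b z * Xothers b ℓ) + X b
      X²-≤ = begin
        X b * X b
          ≡⟨ ∑-*ʳ V (X b) _ ⟨
        ∑ V (λ ℓ → ⟦ leaf u ℓ ⟧ * x b ℓ * X b)
          ≤⟨ ∑-mono V pointwise ⟩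
        ∑ V (λ ℓ → ⟦ leaf u ℓ ⟧ * (x b ℓ * Xothers b ℓ) + ⟦ leaf u ℓ ⟧ * x b ℓ)
          ≡⟨ ∑-+ V _ _ ⟩
        ∑ V (λ ℓ → ⟦ leaf u ℓ ⟧ * (x b ℓ * Xothers b ℓ)) + X b
          ≡⟨ cong (_+ X b) (∑-cong V λ ℓ → cong (⟦ leaf u ℓ ⟧ *_) (trans (sym (∑-*ʳ V (Xothers b ℓ) _)) (∑-cong V λ z → *-assoc ⟦ edge b ℓ z ⟧ _ _))) ⟩
        Z b (λ ℓ z → live₁ b z * Xothers b ℓ) + X b ∎
        where
        open ≤-Reasoning
        pointwise : ∀ ℓ → ⟦ leaf u ℓ ⟧ * x b ℓ * X b ≤ ⟦ leaf u ℓ ⟧ * (x b ℓ * Xothers b ℓ) + ⟦ leaf u ℓ ⟧ * x b ℓ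
        pointwise ℓ = begin
          lx * X b                                            ≡⟨ cong (lx *_) (Xothers-+ b ℓ) ⟨
          lx * (Xothers b ℓ + lx)                             ≡⟨ *-distribˡ-+ lx (Xothers b ℓ) lx ⟩
          lx * Xothers b ℓ + lx * lx                          ≤⟨ +-mono-≤ (≤-reflexive (*-assoc ⟦ leaf u ℓ ⟧ (x b ℓ) _)) (*-monoʳ-≤ lx (leaf-x≤1 ℓ)) ⟩
          ⟦ leaf u ℓ ⟧ * (x b ℓ * Xothers b ℓ) + lx * 1       ≡⟨ cong (⟦ leaf u ℓ ⟧ * (x b ℓ * Xothers b ℓ) +_) (*-identityʳ lx) ⟩
          ⟦ leaf u ℓ ⟧ * (x b ℓ * Xothers b ℓ) + lx           ∎
          where
          lx = ⟦ leaf u ℓ ⟧ * x b ℓ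

    module _ {b y ℓ z} (G : Good b y ℓ z) where
      open Switched G

      live₁′ : ∀ w → live₁ b w ≡ live₁ b′ w
      live₁′ w = cong ⟦_⟧ (live′ w)

      others′ : others b y ≤ others b′ z
      others′ = ∑-mono V pointwise
        where
        vz : edge b v z ≡ false
        vz with z == v | edge b v z | Good.ok G
        ... | false | false | _ = refl
        pointwise : ∀ w → ⟦ not (w == y) ⟧ * (⟦ edge b v w ⟧ * live₁ b w) ≤ ⟦ not (w == z) ⟧ * (⟦ edge b′ v w ⟧ * live₁ b′ w)
        pointwise w with w ≟ᶠ y | w ≟ᶠ z
        ... | yes _ | _ = z≤n
        ... | no _ | yes refl rewrite vz = z≤n
        ... | no wy | no wz rewrite edge′-v wy wz | live′ w = ≤-refl

      Xothers′ : Xothers b ℓ ≤ Xothers b′ ℓ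
      Xothers′ = ∑-mono V pointwise
        where
        pointwise : ∀ w → ⟦ not (w == ℓ) ⟧ * (⟦ leaf u w ⟧ * x b w) ≤ ⟦ not (w == ℓ) ⟧ * (⟦ leaf u w ⟧ * x b′ w)
        pointwise w with w ≟ᶠ ℓ | leaf u w in lw
        ... | yes _ | _ = z≤n
        ... | no _ | false = z≤n
        ... | no w≢ℓ | true = *-monoʳ-≤ 1 (*-monoʳ-≤ 1 (∑-mono V unchanged))
          where
          -- The leaf w is neither v nor ℓ, and a live t is unmasked, so w t is not among the
          -- toggled edges.
          unchanged : ∀ t → ⟦ edge b w t ⟧ * live₁ b t ≤ ⟦ edge b′ w t ⟧ * live₁ b′ t
          unchanged t rewrite sym (live′ t) with live b t in lt
          ... | false = ≤-reflexive (trans (*-zeroʳ ⟦ edge b w t ⟧) (sym (*-zeroʳ ⟦ edge b′ w t ⟧)))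
          ... | true = ≤-reflexive (cong (λ e → ⟦ e ⟧ * 1) (sym (edge′-away Rw (unmasked-R (live-unmasked b t lt)))))
            where
            Rw : row ℓ y z w ≡ false
            Rw rewrite ==-≢ (leaf-≢v lw) = ==-≢ w≢ℓ

    -- After the exchange the old neighbour y of v hangs on ℓ: up to errors, a neighbour of v is
    -- live no more often than the neighbour of a random leaf.
    first-moment : m * Σvalid k ≤ d * Σvalid X + count * (d * badBound)
    first-moment = begin
      m * Σvalid k
        ≡⟨ Σvalid-*ˡ m k ⟨
      Σvalid (λ b → m * k b)
        ≡⟨ Σvalid-cong (λ b vb → sym (left b vb)) ⟩
      Tot W
        ≤⟨ swap W W′ 1 (λ b _ y ℓ z → ≤-trans (≤-reflexive (*-identityʳ _)) (⟦⟧≤1 (live b y)))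
             (λ {b} {y} G → ≤-reflexive (trans (*-identityʳ _) (trans (live₁′ G y) (sym (*-identityˡ _))))) ⟩
      Tot W′ + count * (d * (1 * badBound))
        ≡⟨ cong₂ _+_ (Σvalid-cong right) (cong (λ t → count * (d * t)) (*-identityˡ badBound)) ⟩
      Σvalid (λ b → d * X b) + count * (d * badBound)
        ≡⟨ cong (_+ count * (d * badBound)) (Σvalid-*ˡ d X) ⟩
      d * Σvalid X + count * (d * badBound) ∎
      where
      open ≤-Reasoning
      W W′ : Weight
      W b y ℓ z = live₁ b y * 1
      W′ b y ℓ z = 1 * live₁ b z
      left : ∀ b → valid b ≡ true → tri b (W b) ≡ m * k b
      left b vb = trans (tri-product b (live₁ b) (λ _ _ → 1)) (trans (cong (k b *_)
        (trans (Z-ℓ vb (λ _ → 1)) (∑-cong V λ ℓ → *-identityʳ _))) (*-comm (k b) m))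
      right : ∀ b → valid b ≡ true → tri b (W′ b) ≡ d * X b
      right b vb = trans (tri-product b (λ _ → 1) (λ _ z → live₁ b z))
        (cong (_* X b) (trans (Y-const vb 1) (*-identityʳ d)))

    -- Equals k (k - 1) on valid graphs, by `Y-live-others`.
    liveNbrPairs : Graph n → ℕ
    liveNbrPairs b = Y b λ y → others b y * live₁ b y

    -- The left side is the total of (d - 1) k X. A live z is moved from its leaf to v while another
    -- live neighbour of v stays, which produces a pair of live neighbours.
    mixed-moment : Σvalid (λ b → Y b (others b) * X b) ≤ m * Σvalid liveNbrPairs + count * (d * (d * badBound))
    mixed-moment = begin
      Σvalid (λ b → Y b (others b) * X b)
        ≡⟨ Σvalid-cong (λ b _ → sym (tri-product b (others b) (λ _ z → live₁ b z))) ⟩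
      Tot W
        ≤⟨ swap W W′ d
             (λ b vb y ℓ z → ≤-trans (*-mono-≤ (others≤d vb y) (⟦⟧≤1 (live b z))) (≤-reflexive (*-identityʳ d)))
             (λ {b} {y} {ℓ} {z} G → ≤-trans (*-mono-≤ (others′ G) (≤-reflexive (live₁′ G z))) (≤-reflexive (sym (*-identityʳ _)))) ⟩
      Tot W′ + count * (d * (d * badBound))
        ≡⟨ cong (_+ count * (d * (d * badBound))) (trans (Σvalid-cong right) (Σvalid-*ˡ m liveNbrPairs)) ⟩
      m * Σvalid liveNbrPairs + count * (d * (d * badBound)) ∎
      where
      open ≤-Reasoning
      W W′ : Weight
      W b y ℓ z = others b y * live₁ b z
      W′ b y ℓ z = others b y * live₁ b y * 1
      right : ∀ b → valid b ≡ true → tri b (W′ b) ≡ m * liveNbrPairs b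
      right b vb = trans (tri-product b (λ y → others b y * live₁ b y) (λ _ _ → 1)) (trans (cong (liveNbrPairs b *_)
        (trans (Z-ℓ vb (λ _ → 1)) (∑-cong V λ ℓ → *-identityʳ _))) (*-comm (liveNbrPairs b) m))

    -- A pair of live leaves becomes a live leaf and a live neighbour of v. Followed by
    -- `mixed-moment`, this bounds E k (k - 1) below by about d (d - 1) E x².
    second-moment : d * Σvalid (λ b → X b * X b) ≤ m * Σvalid (λ b → k b * X b) + count * (d * (m * badBound)) + d * Σvalid X
    second-moment = begin
      d * Σvalid (λ b → X b * X b)
        ≤⟨ *-monoʳ-≤ d (Σvalid-mono λ b vb → X²-≤ vb) ⟩
      d * Σvalid (λ b → Z b (λ ℓ z → live₁ b z * Xothers b ℓ) + X b)
        ≡⟨ trans (cong (d *_) (Σvalid-+ _ X)) (*-distribˡ-+ d _ _) ⟩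
      d * Σvalid (λ b → Z b (λ ℓ z → live₁ b z * Xothers b ℓ)) + d * Σvalid X
        ≡⟨ cong (_+ d * Σvalid X) (trans (sym (Σvalid-*ˡ d _)) (Σvalid-cong left)) ⟩
      Tot W + d * Σvalid X
        ≤⟨ +-monoˡ-≤ (d * Σvalid X) (swap W W′ m
             (λ b vb y ℓ z → ≤-trans (≤-reflexive (*-identityˡ _)) (≤-trans (⟦⟧*≤ʳ (live b z) (Xothers b ℓ)) (≤-trans (Xothers≤X vb ℓ) (X≤m vb))))
             (λ {b} {y} {ℓ} {z} G → ≤-trans (≤-reflexive (*-identityˡ _)) (*-mono-≤ (≤-reflexive (live₁′ G z)) (Xothers′ G)))) ⟩
      Tot W′₀ + count * (d * (m * badBound)) + d * Σvalid X
        ≤⟨ +-monoˡ-≤ (d * Σvalid X) (+-monoˡ-≤ _ (Σvalid-mono right)) ⟩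
      Σvalid (λ b → m * (k b * X b)) + count * (d * (m * badBound)) + d * Σvalid X
        ≡⟨ cong (λ t → t + count * (d * (m * badBound)) + d * Σvalid X) (Σvalid-*ˡ m _) ⟩
      m * Σvalid (λ b → k b * X b) + count * (d * (m * badBound)) + d * Σvalid X ∎
      where
      open ≤-Reasoning
      W W′ : Weight
      W b y ℓ z = 1 * (live₁ b z * Xothers b ℓ)
      W′ b y ℓ z = live₁ b y * Xothers b ℓ
      W′₀ = W′
      left : ∀ b → valid b ≡ true → d * Z b (λ ℓ z → live₁ b z * Xothers b ℓ) ≡ tri b (W b)
      left b vb = sym (trans (tri-product b (λ _ → 1) (λ ℓ z → live₁ b z * Xothers b ℓ))
        (cong (_* Z b (λ ℓ z → live₁ b z * Xothers b ℓ)) (trans (Y-const vb 1) (*-identityʳ d))))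
      right : ∀ b → valid b ≡ true → tri b (W′ b) ≤ m * (k b * X b)
      right b vb = begin
        tri b (W′ b)                         ≡⟨ tri-product b (live₁ b) (λ ℓ _ → Xothers b ℓ) ⟩
        k b * Z b (λ ℓ _ → Xothers b ℓ)      ≤⟨ *-monoʳ-≤ (k b) (Z-mono b λ ℓ _ → Xothers≤X vb ℓ) ⟩
        k b * Z b (λ ℓ _ → X b)              ≡⟨ cong (k b *_) (trans (Z-ℓ vb (λ _ → X b)) (∑-*ʳ V (X b) _)) ⟩
        k b * (m * X b)                      ≡⟨ rot (k b) m (X b) ⟩
        m * (k b * X b)                      ∎
        where
        rot : ∀ x y z → x * (y * z) ≡ y * (x * z)
        rot = solve-∀

    -- From the live core to the component of u

    reached : Graph n → Fin n → Bool
    reached b = reach (edge b) u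

    private
      reachedOrLeaf : Graph n → Fin n → Bool
      reachedOrLeaf b w = live b w ∨ (leaf u w ∧ does (any? λ z → edge b w z ∧ live b z ≟ᵇ true))

      1≤k : ∀ {b y} → edge b v y ≡ true → live b y ≡ true → 1 ≤ k b
      1≤k {b} {y} vy ly = ≤-trans (≤-reflexive (cong₂ (λ s t → ⟦ s ⟧ * ⟦ t ⟧) (sym vy) (sym ly)))
        (∑-member (λ w → ⟦ edge b v w ⟧ * live₁ b w) (∈-allFin y))

      -- An edge out of the live set ends at v, at a leaf or in the core. The first is excluded by k
      -- = 0 and the other two stay in the set; the only edge of an attached leaf leads back to a
      -- live vertex. Hence v can be reached only through a live neighbour.
      reachedOrLeaf-closed : ∀ {b} → valid b ≡ true → k b ≡ 0 → Closed (edge b) (reachedOrLeaf b)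
      reachedOrLeaf-closed {b} vb k≡0 s t ps st with live b s in ls
      ... | true with t ≟ᶠ v
      ...   | yes refl = contradiction (subst (1 ≤_) k≡0 (1≤k (trans (edge-sym b v s) st) ls)) λ ()
      ...   | no t≢v with leaf u t in lt
      ...     | true = trans (cong (live b t ∨_) (dec-true (any? λ z → edge b t z ∧ live b z ≟ᵇ true)
                  (s , ∧-intro (trans (edge-sym b t s) st) ls))) (∨-zeroʳ (live b t))
      ...     | false = cong (_∨ false) (Component.closed (component (coreEdge b) u) s t ls
                  (∧-intro st (∧-intro (cong not (live-unmasked b s ls)) (cong not t-unmasked))))
        where
        t-unmasked : masked t ≡ false
        t-unmasked rewrite lt = ==-≢ t≢v
      reachedOrLeaf-closed {b} vb k≡0 s t ps st | false
        with does-sound (any? λ z → edge b s z ∧ live b z ≟ᵇ true) (proj₂ (∧-true {leaf u s} ps))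
      ... | z , sz∧lz with ∧-true {edge b s z} sz∧lz
      ...   | sz , lz with leaf-unique vb (leaf-deg {u} (proj₁ (∧-true {leaf u s} ps))) sz st
      ...     | refl rewrite lz = refl

    reached⇒1≤k : ∀ {b} → valid b ≡ true → reached b v ≡ true → 1 ≤ k b
    reached⇒1≤k {b} vb rv with k b in e
    ... | suc _ = s≤s z≤n
    ... | zero = contradiction (trans (sym v∈) v∉) λ ()
      where
      v∈ : reachedOrLeaf b v ≡ true
      v∈ = Component.least (component (edge b) u) (reachedOrLeaf b)
        u∈ (reachedOrLeaf-closed vb e) v rv
        where
        u∈ : reachedOrLeaf b u ≡ true
        u∈ rewrite Component.root (component (coreEdge b) u) = refl
      leaf-v : leaf u v ≡ false
      leaf-v with leaf u v in lv
      ... | false = refl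
      ... | true = ⊥-elim (leaf-≢v lv refl)
      live-v : live b v ≡ false
      live-v with live b v in lv
      ... | false = refl
      ... | true = contradiction (trans (sym (live-unmasked b v lv)) masked-v) λ ()
        where
        masked-v : masked v ≡ true
        masked-v rewrite ==-refl v = ∨-zeroʳ _
      v∉ : reachedOrLeaf b v ≡ false
      v∉ rewrite live-v | leaf-v = refl

    live⇒reached : ∀ b w → live b w ≡ true → reached b w ≡ true
    live⇒reached b = reach-mono (coreEdge b) (edge b) u λ s t e → proj₁ (∧-true {edge b s t} e)

    reachedLeaves : Graph n → ℕ
    reachedLeaves b = ∑[ ℓ ∈ V ] ⟦ leaf u ℓ ⟧ * ⟦ reached b ℓ ⟧

    X≤reachedLeaves : ∀ {b} → valid b ≡ true → X b ≤ reachedLeaves b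
    X≤reachedLeaves {b} vb = ∑-mono V pointwise
      where
      pointwise : ∀ ℓ → ⟦ leaf u ℓ ⟧ * x b ℓ ≤ ⟦ leaf u ℓ ⟧ * ⟦ reached b ℓ ⟧
      pointwise ℓ with reached b ℓ in r
      ... | true = ≤-trans (leaf-x≤leaf vb ℓ) (≤-reflexive (sym (*-identityʳ _)))
      ... | false = *-monoʳ-≤ ⟦ leaf u ℓ ⟧ (≤-trans (∑-mono V dead) (≤-reflexive (∑-0 V)))
        where
        dead : ∀ z → ⟦ edge b ℓ z ⟧ * live₁ b z ≤ 0
        dead z with edge b ℓ z in ℓz | live b z in lz
        ... | false | _ = z≤n
        ... | true | false = z≤n
        ... | true | true = contradiction (trans (sym
          (Component.closed (component (edge b) u) z ℓ (live⇒reached b z lz) (trans (edge-sym b z ℓ) ℓz))) r) λ ()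

    P SN : ℕ
    P = Σvalid λ b → ⟦ reached b v ⟧
    SN = Σvalid reachedLeaves

    private
      reached-k : ∀ b → valid b ≡ true → ⟦ reached b v ⟧ ≤ k b
      reached-k b vb with reached b v in r
      ... | false = z≤n
      ... | true = reached⇒1≤k vb r

      -- with k ≤ d live neighbours out of d, 1[k > 0] ≤ k − k (k − 1) / d
      union-bound : ∀ b → valid b ≡ true → d * ⟦ reached b v ⟧ + liveNbrPairs b ≤ d * k b
      union-bound b vb with reached b v in r
      ... | false = begin
        d * 0 + liveNbrPairs b     ≡⟨ cong (_+ liveNbrPairs b) (*-zeroʳ d) ⟩
        liveNbrPairs b             ≤⟨ m≤m+n _ (k b) ⟩
        liveNbrPairs b + k b       ≡⟨ Y-live-others vb ⟩
        k b * k b                  ≤⟨ *-monoˡ-≤ (k b) (k≤d vb) ⟩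
        d * k b                    ∎
        where open ≤-Reasoning
      ... | true = bound (k b) (reached⇒1≤k vb r) (k≤d vb) (Y-live-others vb)
        where
        bound : ∀ j → 1 ≤ j → j ≤ d → liveNbrPairs b + j ≡ j * j → d * 1 + liveNbrPairs b ≤ d * j
        bound (suc j) _ j≤d e = begin
          d * 1 + liveNbrPairs b   ≡⟨ cong₂ _+_ (*-identityʳ d) (+-cancelʳ-≡ (suc j) _ _ (trans e (square j))) ⟩
          d + suc j * j            ≤⟨ +-monoʳ-≤ d (*-monoˡ-≤ j j≤d) ⟩
          d + d * j                ≡⟨ *-suc d j ⟨
          d * suc j                ∎
          where
          open ≤-Reasoning
          square : ∀ j → suc j * suc j ≡ suc j * j + suc j
          square = solve-∀

    reached-bound : m * P ≤ d * SN + count * (d * badBound)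
    reached-bound = begin
      m * P                                      ≤⟨ *-monoʳ-≤ m (Σvalid-mono reached-k) ⟩
      m * Σvalid k                               ≤⟨ first-moment ⟩
      d * Σvalid X + count * (d * badBound)      ≤⟨ +-monoˡ-≤ _ (*-monoʳ-≤ d (Σvalid-mono λ b vb → X≤reachedLeaves vb)) ⟩
      d * SN + count * (d * badBound)            ∎
      where open ≤-Reasoning

    critical-bound : ∀ K → 2 ≤ K → 1 ≤ m →
      K * K * m * P + 2 * K * (d ∸ 1) * SN ≤ K * K * d * SN + (d ∸ 1) * count * m + K * K * count * d * (3 * badBound + 1)
    critical-bound K 2≤K 1≤m = final (d ∸ 1) (sym (m+[n∸m]≡n (≤-trans (s≤s z≤n) 2≤Dv)))
      where
      union : d * P + Σvalid liveNbrPairs ≤ d * Σvalid k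
      union = ≤-trans
        (≤-reflexive (trans (cong (_+ Σvalid liveNbrPairs) (sym (Σvalid-*ˡ d _))) (sym (Σvalid-+ _ liveNbrPairs))))
        (≤-trans (Σvalid-mono union-bound) (≤-reflexive (Σvalid-*ˡ d k)))
      mixed : ∀ e → d ≡ suc e → e * Σvalid (λ b → k b * X b) ≤ m * Σvalid liveNbrPairs + count * (d * (d * badBound))
      mixed e d≡ = ≤-trans (≤-reflexive (trans (sym (Σvalid-*ˡ e _)) (Σvalid-cong λ b vb →
        trans (sym (*-assoc e (k b) (X b))) (cong (_* X b) (sym (+-cancelʳ-≡ (k b) _ _
          (trans (Y-others vb) (trans (cong (_* k b) d≡) (+-comm (k b) (e * k b))))))))) ) mixed-moment
      cauchy : 2 * K * m * Σvalid X ≤ K * K * Σvalid (λ b → X b * X b) + count * (m * m)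
      cauchy = begin
        2 * K * m * Σvalid X
          ≡⟨ Σvalid-*ˡ (2 * K * m) X ⟨
        Σvalid (λ b → 2 * K * m * X b)
          ≤⟨ Σvalid-mono (λ b _ → am-gm (K * X b) m (rearrange K m (X b))) ⟩
        Σvalid (λ b → K * X b * (K * X b) + m * m)
          ≡⟨ trans (Σvalid-+ _ _) (cong₂ _+_ (Σvalid-cong λ b _ → regroup K (X b)) (Σvalid-const (m * m))) ⟩
        Σvalid (λ b → K * K * (X b * X b)) + count * (m * m)
          ≡⟨ cong (_+ count * (m * m)) (Σvalid-*ˡ (K * K) _) ⟩
        K * K * Σvalid (λ b → X b * X b) + count * (m * m) ∎
        where
        open ≤-Reasoning
        rearrange : ∀ K m X → 2 * K * m * X ≡ 2 * (K * X * m)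
        rearrange = solve-∀
        regroup : ∀ K X → K * X * (K * X) ≡ K * K * (X * X)
        regroup = solve-∀
        am-gm : ∀ a c {t} → t ≡ 2 * (a * c) → t ≤ a * a + c * c
        am-gm a c refl = two-products a c
      final : ∀ e → d ≡ suc e →
        K * K * m * P + 2 * K * e * SN ≤ K * K * d * SN + e * count * m + K * K * count * d * (3 * badBound + 1)
      final e d≡ = critical-arithmetic K m d e count badBound P (Σvalid liveNbrPairs) (Σvalid k) (Σvalid X)
        (Σvalid λ b → X b * X b) (Σvalid λ b → k b * X b) SN
        2≤K 1≤m d≡ union first-moment (mixed e d≡) second-moment cauchy (Σvalid-mono λ b vb → X≤reachedLeaves vb)
        (≤-trans (Σvalid-mono λ b vb → X≤m vb) (≤-reflexive (Σvalid-const m)))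

  -- Summation over the vertices for a fixed root u

  module Totals (u : Fin n) where

    private
      V = allFin n
      m = leaves u

    hits : Fin n → ℕ
    hits v = Σvalid λ b → ⟦ reach (edge b) u v ⟧

    leafHits : ℕ
    leafHits = Σvalid λ b → ∑[ ℓ ∈ V ] ⟦ leaf u ℓ ⟧ * ⟦ reach (edge b) u ℓ ⟧

    mid : Fin n → Bool
    mid v = not (v == u) ∧ (does (2 ℕ.≤? D v) ∧ not (big v))

    private
      mid-≢ : ∀ {v} → mid v ≡ true → v ≢ u
      mid-≢ {v} e refl = contradiction (trans (sym (cong not (==-refl v))) (proj₁ (∧-true {not (v == v)} e))) λ ()

      mid-2≤ : ∀ {v} → mid v ≡ true → 2 ≤ D v
      mid-2≤ {v} e = does-sound (2 ℕ.≤? D v) (proj₁ (∧-true {does (2 ℕ.≤? D v)} (proj₂ (∧-true {not (v == u)} e))))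

      mid-≤B : ∀ {v} → mid v ≡ true → D v ≤ B
      mid-≤B {v} e = small (not-true (proj₂ (∧-true {does (2 ℕ.≤? D v)} (proj₂ (∧-true {not (v == u)} e)))))

      hits≤count : ∀ v → hits v ≤ count
      hits≤count v = ≤-trans (Σvalid-mono λ b _ → ⟦⟧≤1 (reach (edge b) u v)) (≤-reflexive (trans (Σvalid-const 1) (*-identityʳ count)))

    leafHits-∑ : leafHits ≡ ∑[ v ∈ V ] ⟦ leaf u v ⟧ * hits v
    leafHits-∑ = trans (Σvalid-∑ _) (∑-cong V λ v → Σvalid-*ˡ ⟦ leaf u v ⟧ _)

    -- With weights d - 2, `Q` is the coefficient of the linear term d p, and `A` that of the
    -- quadratic gain with factor d - 1.
    Q A midHits : ℕ
    Q = ∑[ v ∈ V ] ⟦ mid v ⟧ * (D v * (D v ∸ 2))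
    A = ∑[ v ∈ V ] ⟦ mid v ⟧ * ((D v ∸ 2) * (D v ∸ 1))
    midHits = ∑[ v ∈ V ] ⟦ mid v ⟧ * ((D v ∸ 2) * hits v)

    A≤Q : A ≤ Q
    A≤Q = ∑-mono V λ v → *-monoʳ-≤ ⟦ mid v ⟧
      (≤-trans (*-monoʳ-≤ (D v ∸ 2) (m∸n≤m (D v) 1)) (≤-reflexive (*-comm (D v ∸ 2) (D v))))

    -- From d ≤ 2 (d - 1) for d ≥ 2: the gain is of the same order as the linear term, whatever the
    -- degrees.
    Q≤2A : Q ≤ 2 * A
    Q≤2A = ≤-trans (∑-mono V λ v → ≤-trans (*-monoʳ-≤ ⟦ mid v ⟧ (pointwise (D v))) (≤-reflexive (rot ⟦ mid v ⟧ _)))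
      (≤-reflexive (∑-*ˡ V 2 _))
      where
      rot : ∀ w t → w * (2 * t) ≡ 2 * (w * t)
      rot = solve-∀
      pointwise : ∀ d → d * (d ∸ 2) ≤ 2 * ((d ∸ 2) * (d ∸ 1))
      pointwise 0 = z≤n
      pointwise 1 = z≤n
      pointwise (suc (suc c)) = linear _ _ (c * c) {0} z≤n (certificate c)
        where
        certificate : ∀ c → (2 + c) * c + 0 + c * c ≡ 2 * (c * (1 + c)) + 0
        certificate = solve-∀

    critical-sum : ∀ K → 2 ≤ K → 1 ≤ m →
      K * K * m * midHits + 2 * K * leafHits * A ≤ (K * K * leafHits + K * K * count * (3 * badBound + 1)) * Q + count * m * A
    critical-sum K 2≤K 1≤m = begin
      K * K * m * midHits + 2 * K * leafHits * A
        ≡⟨ cong₂ _+_ (∑-*ˡ V (K * K * m) _) (∑-*ˡ V (2 * K * leafHits) _) ⟨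
      ∑ V (λ v → K * K * m * (⟦ mid v ⟧ * ((D v ∸ 2) * hits v))) + ∑ V (λ v → 2 * K * leafHits * (⟦ mid v ⟧ * ((D v ∸ 2) * (D v ∸ 1))))
        ≡⟨ ∑-+ V _ _ ⟨
      ∑ V (λ v → K * K * m * (⟦ mid v ⟧ * ((D v ∸ 2) * hits v)) + 2 * K * leafHits * (⟦ mid v ⟧ * ((D v ∸ 2) * (D v ∸ 1))))
        ≤⟨ ∑-mono V pointwise ⟩
      ∑ V (λ v → (K * K * leafHits + K * K * count * (3 * badBound + 1)) * (⟦ mid v ⟧ * (D v * (D v ∸ 2))) + count * m * (⟦ mid v ⟧ * ((D v ∸ 2) * (D v ∸ 1))))
        ≡⟨ trans (∑-+ V _ _) (cong₂ _+_ (∑-*ˡ V (K * K * leafHits + K * K * count * (3 * badBound + 1)) _) (∑-*ˡ V (count * m) _)) ⟩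
      (K * K * leafHits + K * K * count * (3 * badBound + 1)) * Q + count * m * A ∎
      where
      open ≤-Reasoning
      gather : ∀ K m w a c P SN →
        K * K * m * (w * (a * P)) + 2 * K * SN * (w * (a * c)) ≡ w * (a * (K * K * m * P + 2 * K * c * SN))
      gather = solve-∀
      spread : ∀ K m w a c d SN g β →
        w * (a * (K * K * d * SN + c * g * m + K * K * g * d * (3 * β + 1)))
        ≡ (K * K * SN + K * K * g * (3 * β + 1)) * (w * (d * a)) + g * m * (w * (a * c))
      spread = solve-∀
      pointwise : ∀ v →
        K * K * m * (⟦ mid v ⟧ * ((D v ∸ 2) * hits v)) + 2 * K * leafHits * (⟦ mid v ⟧ * ((D v ∸ 2) * (D v ∸ 1)))
        ≤ (K * K * leafHits + K * K * count * (3 * badBound + 1)) * (⟦ mid v ⟧ * (D v * (D v ∸ 2))) + count * m * (⟦ mid v ⟧ * ((D v ∸ 2) * (D v ∸ 1)))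
      pointwise v = ≤-trans (≤-reflexive (gather K m ⟦ mid v ⟧ (D v ∸ 2) (D v ∸ 1) (hits v) leafHits))
        (≤-trans (⟦⟧*≤ (mid v) λ e → *-monoʳ-≤ (D v ∸ 2) (Averages.critical-bound u v (mid-≢ e) (mid-2≤ e) (mid-≤B {v} e) K 2≤K 1≤m))
          (≤-reflexive (spread K m ⟦ mid v ⟧ (D v ∸ 2) (D v ∸ 1) (D v) leafHits count badBound)))

    tree-sum : 2 * ∑ V hits ≤ ∑ V (λ v → D v * hits v) + 2 * count
    tree-sum = begin
      2 * ∑ V hits
        ≡⟨ cong (2 *_) (Σvalid-∑ _) ⟨
      2 * Σvalid (λ b → card (reach (edge b) u))
        ≡⟨ Σvalid-*ˡ 2 _ ⟨
      Σvalid (λ b → 2 * card (reach (edge b) u))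
        ≤⟨ Σvalid-mono per-graph ⟩
      Σvalid (λ b → ∑ V (λ v → D v * ⟦ reach (edge b) u v ⟧) + 2)
        ≡⟨ trans (Σvalid-+ _ _) (cong₂ _+_ (trans (Σvalid-∑ _) (∑-cong V λ v → Σvalid-*ˡ (D v) _)) (trans (Σvalid-const 2) (*-comm count 2))) ⟩
      ∑ V (λ v → D v * hits v) + 2 * count ∎
      where
      open ≤-Reasoning
      per-graph : ∀ b → valid b ≡ true → 2 * card (reach (edge b) u) ≤ ∑ V (λ v → D v * ⟦ reach (edge b) u v ⟧) + 2
      per-graph b vb = ≤-trans (Component.tree (component (edge b) u) (edge-sym b)) (+-monoˡ-≤ 2 (∑-mono V row))
        where
        r = reach (edge b) u
        row : ∀ v → ∑ V (λ w → ⟦ r v ⟧ * (⟦ r w ⟧ * ⟦ edge b v w ⟧)) ≤ D v * ⟦ r v ⟧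
        row v = begin
          ∑ V (λ w → ⟦ r v ⟧ * (⟦ r w ⟧ * ⟦ edge b v w ⟧))   ≡⟨ ∑-*ˡ V ⟦ r v ⟧ _ ⟩
          ⟦ r v ⟧ * ∑ V (λ w → ⟦ r w ⟧ * ⟦ edge b v w ⟧)     ≤⟨ *-monoʳ-≤ ⟦ r v ⟧ (∑-mono V λ w → ⟦⟧*≤ʳ (r w) ⟦ edge b v w ⟧) ⟩
          ⟦ r v ⟧ * ∑ V (λ w → ⟦ edge b v w ⟧)               ≡⟨ cong (⟦ r v ⟧ *_) (valid-deg vb v) ⟩
          ⟦ r v ⟧ * D v                                      ≡⟨ *-comm ⟦ r v ⟧ (D v) ⟩
          D v * ⟦ r v ⟧                                      ∎

    private
      -- The share of one vertex in the tree inequality, without subtraction: the weight -1 of a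
      -- leaf stands on the left, d - 2 is kept for middle degrees, a big vertex is charged its
      -- whole degree and a small root at most B.
      cases : ∀ d h root bg → h ≤ count → (bg ≡ false → d ≤ B) →
        d * h + ⟦ does (d ℕ.≟ 1) ∧ not root ⟧ * h
        ≤ 2 * h + (⟦ not root ∧ (does (2 ℕ.≤? d) ∧ not bg) ⟧ * ((d ∸ 2) * h) + (count * (⟦ bg ⟧ * d) + ⟦ root ⟧ * (count * B)))
      cases d h root true h≤g _ = begin
        d * h + ⟦ does (d ℕ.≟ 1) ∧ not root ⟧ * h      ≤⟨ +-mono-≤ (≤-trans (*-monoʳ-≤ d h≤g) (≤-reflexive (flipped d count))) (≤-trans (⟦⟧*≤ʳ (does (d ℕ.≟ 1) ∧ not root) h) (m≤m+n h _)) ⟩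
        count * (1 * d) + 2 * h                        ≡⟨ +-comm _ (2 * h) ⟩
        2 * h + count * (1 * d)                        ≤⟨ +-monoʳ-≤ (2 * h) (≤-trans (m≤m+n _ _) (m≤n+m _ rest)) ⟩
        2 * h + (rest + (count * (1 * d) + ⟦ root ⟧ * (count * B))) ∎
        where
        open ≤-Reasoning
        rest = ⟦ not root ∧ (does (2 ℕ.≤? d) ∧ false) ⟧ * ((d ∸ 2) * h)
        flipped : ∀ d g → d * g ≡ g * (1 * d)
        flipped = solve-∀
      cases d h true false h≤g d≤B rewrite ∧-zeroʳ (does (d ℕ.≟ 1)) | *-zeroʳ count = begin
        d * h + 0                     ≡⟨ +-identityʳ (d * h) ⟩
        d * h                         ≤⟨ *-mono-≤ (d≤B refl) h≤g ⟩
        B * count                     ≡⟨ flipped B count ⟩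
        1 * (count * B)               ≤⟨ m≤n+m _ (2 * h) ⟩
        2 * h + 1 * (count * B)       ∎
        where
        open ≤-Reasoning
        flipped : ∀ d g → d * g ≡ 1 * (g * d)
        flipped = solve-∀
      cases 0 h false false h≤g d≤B = z≤n
      cases 1 h false false h≤g d≤B = ≤-trans (≤-reflexive (certificate h)) (m≤m+n (2 * h) _)
        where
        certificate : ∀ h → 1 * h + 1 * h ≡ 2 * h
        certificate = solve-∀
      cases (suc (suc c)) h false false h≤g d≤B = linear _ _ (count * 0) {0} z≤n (certificate c h count)
        where
        certificate : ∀ c h g → (2 + c) * h + 0 * h + 0 + g * 0 ≡ 2 * h + (1 * (c * h) + (g * 0 + 0)) + 0
        certificate = solve-∀

    -- Leaves have weight d - 2 = -1, so a component with many of them must collect that weight at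
    -- higher degrees. The error gathers the big vertices, the root and the 2 of the tree
    -- inequality.
    leafHits-bound : leafHits ≤ midHits + count * (bigDegrees + B + 2)
    leafHits-bound = linear _ _ 0
      (+-mono-≤ tree-sum (≤-trans (∑-mono V pointwise) (≤-reflexive collect)))
      (trans (cong (λ t → t + (∑ V (λ v → D v * hits v) + 2 * count + (2 * ∑ V hits + (midHits + (count * bigDegrees + count * B)))) + 0) leafHits-∑)
        (certificate (∑ V λ v → ⟦ leaf u v ⟧ * hits v) (∑ V λ v → D v * hits v) (∑ V hits) midHits count bigDegrees B
          (∑-+ V (λ v → D v * hits v) (λ v → ⟦ leaf u v ⟧ * hits v))))
      where
      pointwise : ∀ v → D v * hits v + ⟦ leaf u v ⟧ * hits v
        ≤ 2 * hits v + (⟦ mid v ⟧ * ((D v ∸ 2) * hits v) + (count * (⟦ big v ⟧ * D v) + ⟦ v == u ⟧ * (count * B)))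
      pointwise v = cases (D v) (hits v) (v == u) (big v) (hits≤count v) small
      collect : ∑ V (λ v → 2 * hits v + (⟦ mid v ⟧ * ((D v ∸ 2) * hits v) + (count * (⟦ big v ⟧ * D v) + ⟦ v == u ⟧ * (count * B))))
        ≡ 2 * ∑ V hits + (midHits + (count * bigDegrees + count * B))
      collect = trans (∑-+ V _ _) (cong₂ _+_ (∑-*ˡ V 2 hits)
        (trans (∑-+ V _ _) (cong (midHits +_)
          (trans (∑-+ V _ _) (cong₂ _+_ (∑-*ˡ V count _) (∑-δ u _))))))
      certificate : ∀ L DH H T g S B {s} → s ≡ DH + L →
        L + (DH + 2 * g + (2 * H + (T + (g * S + g * B)))) + 0 ≡ T + g * (S + B + 2) + (2 * H + s)
      certificate L DH H T g S B refl = arithmetic L DH H T g S B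
        where
        arithmetic : ∀ L DH H T g S B →
          L + (DH + 2 * g + (2 * H + (T + (g * S + g * B)))) + 0 ≡ T + g * (S + B + 2) + (2 * H + (DH + L))
        arithmetic = solve-∀

    -- Leaves are counted as they are, middle degrees by `reached-bound`, and the root and the big
    -- vertices trivially; the latter are no more numerous than their degree sum.
    total-hits : (∀ v → 1 ≤ D v) →
      m * ∑ V hits ≤ m * leafHits + ((leafHits + count * badBound) * ∑ V D + (m * count + m * count * bigDegrees))
    total-hits positive = begin
      m * ∑ V hits
        ≡⟨ ∑-*ˡ V m hits ⟨
      ∑ V (λ v → m * hits v)
        ≤⟨ ∑-mono V pointwise ⟩
      ∑ V (λ v → m * (⟦ leaf u v ⟧ * hits v) + ((leafHits + count * badBound) * D v + (⟦ v == u ⟧ * (m * count) + m * count * (⟦ big v ⟧ * D v))))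
        ≡⟨ trans (∑-+ V _ _) (cong₂ _+_ (trans (∑-*ˡ V m _) (cong (m *_) (sym leafHits-∑)))
             (trans (∑-+ V _ _) (cong₂ _+_ (∑-*ˡ V (leafHits + count * badBound) D)
               (trans (∑-+ V _ _) (cong₂ _+_ (∑-δ u _) (∑-*ˡ V (m * count) _)))))) ⟩
      m * leafHits + ((leafHits + count * badBound) * ∑ V D + (m * count + m * count * bigDegrees)) ∎
      where
      open ≤-Reasoning
      mid-hits : ∀ v → mid v ≡ true → m * hits v ≤ (leafHits + count * badBound) * D v
      mid-hits v e = ≤-trans (Averages.reached-bound u v (mid-≢ e) (mid-2≤ e) (mid-≤B {v} e))
        (≤-reflexive (regroup (D v) leafHits count badBound))
        where
        regroup : ∀ d s g β → d * s + g * (d * β) ≡ (s + g * β) * d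
        regroup = solve-∀
      cases₂ : ∀ d h root bg S → 1 ≤ d → h ≤ count → (not root ∧ (does (2 ℕ.≤? d) ∧ not bg) ≡ true → m * h ≤ S * d) →
        m * h ≤ m * (⟦ does (d ℕ.≟ 1) ∧ not root ⟧ * h) + (S * d + (⟦ root ⟧ * (m * count) + m * count * (⟦ bg ⟧ * d)))
      cases₂ d h true bg S 1≤d h≤g _ = begin
        m * h                                                              ≤⟨ *-monoʳ-≤ m h≤g ⟩
        m * count                                                          ≡⟨ *-identityˡ _ ⟨
        1 * (m * count)                                                    ≤⟨ m≤m+n _ _ ⟩
        1 * (m * count) + m * count * (⟦ bg ⟧ * d)                         ≤⟨ m≤n+m _ (S * d) ⟩
        S * d + (1 * (m * count) + m * count * (⟦ bg ⟧ * d))               ≤⟨ m≤n+m _ (m * (⟦ does (d ℕ.≟ 1) ∧ false ⟧ * h)) ⟩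
        m * (⟦ does (d ℕ.≟ 1) ∧ false ⟧ * h) + (S * d + (1 * (m * count) + m * count * (⟦ bg ⟧ * d)))  ∎
      cases₂ d h false true S 1≤d h≤g _ = begin
        m * h                                                              ≤⟨ *-monoʳ-≤ m h≤g ⟩
        m * count                                                          ≡⟨ *-identityʳ _ ⟨
        m * count * 1                                                      ≤⟨ *-monoʳ-≤ (m * count) (≤-trans 1≤d (≤-reflexive (sym (*-identityˡ d)))) ⟩
        m * count * (1 * d)                                                ≤⟨ m≤n+m _ (S * d) ⟩
        S * d + m * count * (1 * d)                                        ≤⟨ m≤n+m _ (m * (⟦ does (d ℕ.≟ 1) ∧ true ⟧ * h)) ⟩
        m * (⟦ does (d ℕ.≟ 1) ∧ true ⟧ * h) + (S * d + m * count * (1 * d))  ∎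
      cases₂ 1 h false false S _ _ _ = ≤-trans (≤-reflexive (cong (m *_) (sym (*-identityˡ h)))) (m≤m+n _ _)
      cases₂ (suc (suc c)) h false false S _ _ mid-bound =
        ≤-trans (mid-bound refl) (≤-trans (m≤m+n _ (m * count * 0)) (m≤n+m _ (m * 0)))
      pointwise : ∀ v → m * hits v
        ≤ m * (⟦ leaf u v ⟧ * hits v) + ((leafHits + count * badBound) * D v + (⟦ v == u ⟧ * (m * count) + m * count * (⟦ big v ⟧ * D v)))
      pointwise v = cases₂ (D v) (hits v) (v == u) (big v) (leafHits + count * badBound) (positive v) (hits≤count v) (mid-hits v)

-- Consequences of the definition of R

-- The negative and the positive part of d (d - 2), whose only negative value is -1 at d = 1.
one hi : ℕ → ℕ
one d = ⟦ does (d ℕ.≟ 1) ⟧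
hi d = d * (d ∸ 2)

module _ where
  open import Data.Integer as ℤ using (ℤ; +_)
  import Data.Integer.Properties as ℤ
  open import Data.Integer.Tactic.RingSolver using () renaming (solve-∀ to solveℤ)

  private
    w-hi-one : ∀ d → w d ≡ + hi d ℤ.- + one d
    w-hi-one 0 = refl
    w-hi-one 1 = refl
    w-hi-one (suc (suc c)) = begin
      + (2 ℕ.+ c) ℤ.* (+ (2 ℕ.+ c) ℤ.- + 2)   ≡⟨ cong (+ (2 ℕ.+ c) ℤ.*_) (cancel (+ c)) ⟩
      + (2 ℕ.+ c) ℤ.* + c                     ≡⟨ ℤ.pos-* (2 ℕ.+ c) c ⟨
      + hi (2 ℕ.+ c)                          ≡⟨ ℤ.+-identityʳ _ ⟨
      + hi (2 ℕ.+ c) ℤ.- + 0                  ∎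
      where
      open ≡-Reasoning
      cancel : ∀ x → + 2 ℤ.+ x ℤ.- + 2 ≡ x
      cancel = solveℤ

    accumulate : ∀ h o d → (+ h ℤ.- + o) ℤ.+ w d ≡ + (h + hi d) ℤ.- + (o + one d)
    accumulate h o d = trans (cong (λ t → (+ h ℤ.- + o) ℤ.+ t) (w-hi-one d)) (rearrange (+ h) (+ o) (+ hi d) (+ one d))
      where
      rearrange : ∀ a b c e → (a ℤ.- b) ℤ.+ (c ℤ.- e) ≡ (a ℤ.+ c) ℤ.- (b ℤ.+ e)
      rearrange = solveℤ

    nonpositive : ∀ h o → does (+ 0 ℤ.<? (+ h ℤ.- + o)) ≡ false → h ≤ o
    nonpositive h o e = ≮⇒≥ λ o<h → contradiction
      (trans (sym (dec-true (+ 0 ℤ.<? (+ h ℤ.- + o)) (0<h-o o<h))) e) λ ()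
      where
      0<h-o : o < h → + 0 ℤ.< + h ℤ.- + o
      0<h-o o<h = subst (+ 0 ℤ.<_) (sym (trans (ℤ.m-n≡m⊖n h o) (ℤ.⊖-≥ (<⇒≤ o<h)))) (ℤ.+<+ (m<n⇒0<n∸m o<h))

  -- The prefix π₁ … π_{j-1} has nonpositive weight, and R sums the rest.
  Rgo-split : ∀ h o d xs → h ≤ o → ∃₂ λ pre post →
    d ∷ xs ≡ pre ++ post × sum post ≡ Rgo (+ h ℤ.- + o) (d ∷ xs) × h + ∑ pre hi ≤ o + ∑ pre one
  Rgo-split h o d [] h≤o = [] , d ∷ [] , refl , +-identityʳ d , +-monoˡ-≤ 0 h≤o
  Rgo-split h o d (d′ ∷ xs) h≤o with does (+ 0 ℤ.<? ((+ h ℤ.- + o) ℤ.+ w d)) in e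
  ... | true = [] , d ∷ d′ ∷ xs , refl , refl , +-monoˡ-≤ 0 h≤o
  ... | false with Rgo-split (h + hi d) (o + one d) d′ xs (nonpositive _ _ (trans (cong (λ t → does (+ 0 ℤ.<? t)) (sym (accumulate h o d))) e))
  ...   | pre , post , xs≡ , R≡ , h≤ = d ∷ pre , post , cong (d ∷_) xs≡ ,
    trans R≡ (cong (λ t → Rgo t (d′ ∷ xs)) (sym (accumulate h o d))) ,
    ≤-trans (≤-reflexive (sym (+-assoc h (hi d) _))) (≤-trans h≤ (≤-reflexive (+-assoc o (one d) _)))

  R-split : ∀ xs → ∃₂ λ pre post → xs ≡ pre ++ post × sum post ≡ Rgo (+ 0) xs × ∑ pre hi ≤ ∑ pre one
  R-split [] = [] , [] , refl , refl , z≤n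
  R-split (d ∷ xs) = Rgo-split 0 0 d xs z≤n

∑-↭ : ∀ {A : Set} {xs ys : List A} f → xs ↭ ys → ∑ xs f ≡ ∑ ys f
∑-↭ f Perm.refl = refl
∑-↭ f (Perm.prep x p) = cong (f x +_) (∑-↭ f p)
∑-↭ f (Perm.swap x y p) = trans (cong (λ t → f x + (f y + t)) (∑-↭ f p)) (exchange (f x) (f y) _)
  where
  exchange : ∀ a b c → a + (b + c) ≡ b + (a + c)
  exchange = solve-∀
∑-↭ f (Perm.trans p q) = trans (∑-↭ f p) (∑-↭ f q)

∑-tabulate : ∀ {n} (D : Fin n → ℕ) f → ∑ (tabulate D) f ≡ ∑ (allFin n) (f ∘ D)
∑-tabulate {n} D f = trans (cong (λ xs → ∑ xs f) (sym (map-tabulate id D))) (∑-map D (allFin n) f)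

sum-filter-∑ : ∀ {P : ℕ → Set} (P? : Decidable P) xs → sum (filter P? xs) ≡ ∑[ x ∈ xs ] ⟦ does (P? x) ⟧ * x
sum-filter-∑ P? [] = refl
sum-filter-∑ P? (x ∷ xs) with does (P? x)
... | true = cong₂ _+_ (sym (*-identityˡ x)) (sum-filter-∑ P? xs)
... | false = sum-filter-∑ P? xs

sum-∑ : ∀ xs → sum xs ≡ ∑ xs id
sum-∑ [] = refl
sum-∑ (x ∷ xs) = cong (x +_) (sum-∑ xs)

module DegreeFacts {n : ℕ} (D : DegSeq n) (B : ℕ) where

  open Counting D B

  private
    V = allFin n

  ones : ℕ
  ones = ∑[ v ∈ V ] one (D v)

  private
    split = R-split (sort (tabulate D))
    pre = proj₁ split
    post = proj₁ (proj₂ split)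

    sum-post : ∑ post id ≡ R D
    sum-post = trans (sym (sum-∑ post)) (proj₁ (proj₂ (proj₂ (proj₂ split))))

    pre-nonpositive : ∑ pre hi ≤ ∑ pre one
    pre-nonpositive = proj₂ (proj₂ (proj₂ (proj₂ split)))

    ∑-split-D : ∀ f → ∑ V (f ∘ D) ≡ ∑ pre f + ∑ post f
    ∑-split-D f = begin
      ∑ V (f ∘ D)                 ≡⟨ ∑-tabulate D f ⟨
      ∑ (tabulate D) f            ≡⟨ ∑-↭ f (sort-↭ (tabulate D)) ⟨
      ∑ (sort (tabulate D)) f     ≡⟨ cong (λ xs → ∑ xs f) (proj₁ (proj₂ (proj₂ split))) ⟩
      ∑ (pre ++ post) f           ≡⟨ ∑-++ pre post f ⟩
      ∑ pre f + ∑ post f          ∎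
      where open ≡-Reasoning

    ones-pre : ∑ pre one ≤ ones
    ones-pre = ≤-trans (m≤m+n _ _) (≤-reflexive (sym (∑-split-D one)))

    -- On the prefix before j, nonpositive total weight lets the degree-one vertices pay for `hi`;
    -- the remaining degrees add up to `R D`.
    charge : ∀ f b → (∀ d → f d ≤ hi d) → (∀ d → f d ≤ b * d) → ∑ V (f ∘ D) ≤ ones + b * R D
    charge f b on-pre on-post = begin
      ∑ V (f ∘ D)             ≡⟨ ∑-split-D f ⟩
      ∑ pre f + ∑ post f      ≤⟨ +-mono-≤ (∑-mono pre on-pre) (∑-mono post on-post) ⟩
      ∑ pre hi + ∑ post (λ d → b * d)  ≤⟨ +-mono-≤ (≤-trans pre-nonpositive ones-pre) (≤-reflexive (trans (∑-*ˡ post b id) (cong (b *_) sum-post))) ⟩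
      ones + b * R D          ∎
      where open ≤-Reasoning

  small-excess : ∑[ v ∈ V ] ⟦ not (big v) ⟧ * hi (D v) ≤ ones + B * R D
  small-excess = charge (λ d → ⟦ not (does (B ℕ.<? d)) ⟧ * hi d) B
    (λ d → ⟦⟧*≤ʳ (not (does (B ℕ.<? d))) (hi d)) on-post
    where
    on-post : ∀ d → ⟦ not (does (B ℕ.<? d)) ⟧ * hi d ≤ B * d
    on-post d with does (B ℕ.<? d) in e
    ... | true = z≤n
    ... | false = begin
      1 * (d * (d ∸ 2))   ≡⟨ *-identityˡ _ ⟩
      d * (d ∸ 2)         ≤⟨ *-monoʳ-≤ d (≤-trans (m∸n≤m d 2) (≮⇒≥ λ B<d → contradiction (trans (sym (dec-true (B ℕ.<? d) B<d)) e) λ ())) ⟩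
      d * B               ≡⟨ *-comm d B ⟩
      B * d               ∎
      where open ≤-Reasoning

  -- A degree d > B has d - 2 ≥ B - 1, so in the prefix (B - 1) d is covered by `hi d`; big degrees
  -- after the prefix are part of R.
  big-excess : (B ∸ 1) * bigDegrees ≤ (B ∸ 1) * R D + ones
  big-excess = ≤-trans (≤-reflexive (sym (∑-*ˡ V (B ∸ 1) _)))
    (≤-trans (charge (λ d → (B ∸ 1) * (⟦ does (B ℕ.<? d) ⟧ * d)) (B ∸ 1) on-pre
        (λ d → *-monoʳ-≤ (B ∸ 1) (⟦⟧*≤ʳ (does (B ℕ.<? d)) d)))
      (≤-reflexive (+-comm ones _)))
    where
    on-pre : ∀ d → (B ∸ 1) * (⟦ does (B ℕ.<? d) ⟧ * d) ≤ hi d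
    on-pre d with does (B ℕ.<? d) in e
    ... | false = ≤-trans (≤-reflexive (*-zeroʳ (B ∸ 1))) z≤n
    ... | true = begin
      (B ∸ 1) * (1 * d)   ≡⟨ cong ((B ∸ 1) *_) (*-identityˡ d) ⟩
      (B ∸ 1) * d         ≤⟨ *-monoˡ-≤ d (∸-monoˡ-≤ {1 + B} {d} 2 (does-sound (B ℕ.<? d) e)) ⟩
      (d ∸ 2) * d         ≡⟨ *-comm (d ∸ 2) d ⟩
      hi d                ∎
      where open ≤-Reasoning

  private
    M-∑ : M D ≡ ∑[ v ∈ V ] ⟦ not (does (D v ℕ.≟ 2)) ⟧ * D v
    M-∑ = trans (sum-filter-∑ (λ d → ¬? (d ℕ.≟ 2)) (tabulate D)) (∑-tabulate D _)

  -- In the prefix a degree d ≥ 3 is at most `hi d`, hence paid for by degree-one vertices. So about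
  -- M / 2 of these must exist when R is small.
  M-bound : M D ≤ 2 * ones + R D
  M-bound = begin
    M D
      ≡⟨ M-∑ ⟩
    ∑ V (f ∘ D)
      ≡⟨ ∑-split-D f ⟩
    ∑ pre f + ∑ post f
      ≤⟨ +-mono-≤ (∑-mono pre on-pre) (∑-mono post λ d → ⟦⟧*≤ʳ (not (does (d ℕ.≟ 2))) d) ⟩
    ∑ pre (λ d → one d + hi d) + ∑ post id
      ≡⟨ cong₂ _+_ (∑-+ pre one hi) sum-post ⟩
    ∑ pre one + ∑ pre hi + R D
      ≤⟨ +-monoˡ-≤ (R D) (+-mono-≤ ones-pre (≤-trans pre-nonpositive (≤-trans ones-pre (≤-reflexive (sym (+-identityʳ ones)))))) ⟩
    2 * ones + R D ∎
    where
    open ≤-Reasoning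
    f : ℕ → ℕ
    f d = ⟦ not (does (d ℕ.≟ 2)) ⟧ * d
    on-pre : ∀ d → f d ≤ one d + hi d
    on-pre 0 = z≤n
    on-pre 1 = ≤-refl
    on-pre 2 = z≤n
    on-pre (suc (suc (suc c))) = begin
      1 * (3 + c)             ≡⟨ *-comm 1 (3 + c) ⟩
      (3 + c) * 1             ≤⟨ *-monoʳ-≤ (3 + c) (s≤s z≤n) ⟩
      (3 + c) * suc c         ∎

  degree-sum : ∑ V D ≤ 2 * n + M D
  degree-sum = begin
    ∑ V D                                                           ≤⟨ ∑-mono V (λ v → pointwise (D v)) ⟩
    ∑ V (λ v → 2 * 1 + ⟦ not (does (D v ℕ.≟ 2)) ⟧ * D v)             ≡⟨ ∑-+ V _ _ ⟩
    ∑ V (λ v → 2 * 1) + ∑ V (λ v → ⟦ not (does (D v ℕ.≟ 2)) ⟧ * D v) ≡⟨ cong₂ _+_ (∑-*ˡ V 2 (λ _ → 1)) (sym M-∑) ⟩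
    2 * ∑ V (λ v → 1) + M D                                         ≤⟨ +-monoˡ-≤ (M D) (*-monoʳ-≤ 2 (∑-allFin-≤ n λ _ → ≤-refl)) ⟩
    2 * n + M D                                                     ∎
    where
    open ≤-Reasoning
    pointwise : ∀ d → d ≤ 2 * 1 + ⟦ not (does (d ℕ.≟ 2)) ⟧ * d
    pointwise 0 = z≤n
    pointwise 1 = s≤s z≤n
    pointwise 2 = ≤-refl
    pointwise (suc (suc (suc c))) = ≤-trans (≤-reflexive (sym (*-identityˡ (3 + c)))) (m≤n+m (1 * (3 + c)) 2)

-- Large components

connected-pairs : ∀ {n} (D : DegSeq n) → Positive D → ∀ K → 2 ≤ K →
  precision (K * K * K) * R D ≤ M D → threshold (K * K * K) ≤ M D →
  ∀ u → K * (∑[ v ∈ allFin n ] Counting.Totals.hits D (cutoff (K * K * K)) u v) ≤ 42 * Uniform.count D * n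
connected-pairs {n} D positive K 2≤K R-small M-large u =
  total-arithmetic K m n count badBound bigDegrees leafHits (∑ V hits) (∑ V D) 1≤m m≤n
    (total-hits positive) density degrees (≤-trans (*-mono-≤ K≤c β≤) bad-small) (≤-trans (*-mono-≤ K≤c 1+S≤) big-small)
  where
  V = allFin n
  c = K * K * K
  B = cutoff c
  open Uniform D
  open Counting D B
  open Totals u
  open DegreeFacts D B
  m = leaves u

  1≤K : 1 ≤ K
  1≤K = ≤-trans (s≤s z≤n) 2≤K

  K≤c : K ≤ c
  K≤c = ≤-trans (≤-reflexive (sym (*-identityˡ K))) (*-monoˡ-≤ K (*-mono-≤ 1≤K 1≤K))

  -- The 1 is u itself, which `leaf u` leaves out.
  ones≤ : ones ≤ m + 1
  ones≤ = ≤-trans (∑-mono V λ v → pointwise (does (D v ℕ.≟ 1)) (v == u))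
    (≤-reflexive (trans (∑-+ V _ _) (cong (λ t → m + t) (∑-δ1 u))))
    where
    pointwise : ∀ s t → ⟦ s ⟧ ≤ ⟦ s ∧ not t ⟧ + ⟦ t ⟧
    pointwise false t = z≤n
    pointwise true false = ≤-refl
    pointwise true true = ≤-refl

  open Smallness c (R D) bigDegrees ones m (M D) (≤-trans 1≤K K≤c) big-excess M-bound ones≤ R-small M-large

  m≤n : m ≤ n
  m≤n = ∑-allFin-≤ n λ v → ⟦⟧≤1 (leaf u v)

  Q≤ : Q ≤ m + (1 + B * R D)
  Q≤ = begin
    Q                                          ≤⟨ ∑-mono V (λ v → *-monoˡ-≤ (hi (D v)) (⟦⟧-mono {mid v} λ e → proj₂ (∧-true {does (2 ℕ.≤? D v)} (proj₂ (∧-true {not (v == u)} e))))) ⟩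
    ∑ V (λ v → ⟦ not (big v) ⟧ * hi (D v))     ≤⟨ small-excess ⟩
    ones + B * R D                             ≤⟨ +-monoˡ-≤ (B * R D) ones≤ ⟩
    m + 1 + B * R D                            ≡⟨ +-assoc m 1 _ ⟩
    m + (1 + B * R D)                          ∎
    where open ≤-Reasoning

  leafHits≤ : leafHits ≤ count * m
  leafHits≤ = ≤-trans (Σvalid-mono λ b _ → ∑-mono V λ ℓ → ≤-trans (*-monoʳ-≤ ⟦ leaf u ℓ ⟧ (⟦⟧≤1 (reach (edge b) u ℓ))) (≤-reflexive (*-identityʳ _)))
    (≤-reflexive (Σvalid-const m))

  density : K * leafHits ≤ 6 * count * m
  density = density-arithmetic K m (1 + B * R D) count badBound (bigDegrees + B + 2) midHits leafHits A Q 1≤K 1≤m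
    (critical-sum K 2≤K 1≤m) leafHits-bound A≤Q Q≤2A Q≤ leafHits≤ excess-small bad-small big-small

  degrees : ∑ V D ≤ 5 * n
  degrees = ≤-trans degree-sum (≤-trans (+-monoʳ-≤ (2 * n) (≤-trans M≤3m (*-monoʳ-≤ 3 m≤n))) (≤-reflexive (add n)))
    where
    add : ∀ n → 2 * n + 3 * n ≡ 5 * n
    add = solve-∀

  β≤ : badBound ≤ 3 * badBound + 1
  β≤ = ≤-trans (m≤m+n badBound _) (m≤m+n _ 1)

  1+S≤ : 1 + bigDegrees ≤ bigDegrees + B + 2
  1+S≤ = ≤-trans (≤-reflexive (+-comm 1 bigDegrees)) (+-mono-≤ (m≤m+n bigDegrees B) (s≤s z≤n))

-- Passage between rational and natural inequalities

module _ where
  open import Data.Integer as ℤ using (ℤ; +_; -[1+_])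
  import Data.Integer.Properties as ℤ

  -- abstract, since the reduction to lowest terms in _/_ must not be unfolded
  abstract

    ratio : ℕ → ℕ → ℚ
    ratio b k = + b / suc k

    fraction : ∀ b k → toℚᵘ (ratio b k) ℚᵘ.≃ mkℚᵘ (+ b) k
    fraction b k = ℚ.toℚᵘ-fromℚᵘ (mkℚᵘ (+ b) k)

    0<ratio : ∀ k → 0ℚ ℚ.< ratio 1 k
    0<ratio k = ℚ.positive⁻¹ (ratio 1 k) {{ℚ.normalize-pos 1 (suc k)}}

  private
    ≤ᵘ-intro : ∀ {a b k l} → a * suc l ≤ b * suc k → mkℚᵘ (+ a) k ℚᵘ.≤ mkℚᵘ (+ b) l
    ≤ᵘ-intro {a} {b} {k} {l} h = *≤* (subst₂ ℤ._≤_ (ℤ.pos-* a (suc l)) (ℤ.pos-* b (suc k)) (ℤ.+≤+ h))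

    ≤ᵘ-elim : ∀ {a b k l} → mkℚᵘ (+ a) k ℚᵘ.≤ mkℚᵘ (+ b) l → a * suc l ≤ b * suc k
    ≤ᵘ-elim {a} {b} {k} {l} (*≤* h) = ℤ.drop‿+≤+ (subst₂ ℤ._≤_ (sym (ℤ.pos-* a (suc l))) (sym (ℤ.pos-* b (suc k))) h)

    natural : ∀ k → toℚᵘ (ℕ→ℚ k) ℚᵘ.≃ mkℚᵘ (+ k) 0
    natural k = ℚ.toℚᵘ-fromℚᵘ (mkℚᵘ (+ k) 0)

    scaled : ∀ p {b k} g → toℚᵘ p ℚᵘ.≃ mkℚᵘ (+ b) k → toℚᵘ (p ℚ.* ℕ→ℚ g) ℚᵘ.≃ mkℚᵘ (+ (b * g)) k
    scaled p {b} {k} g p≃ = ℚᵘ.≃-trans (ℚ.toℚᵘ-homo-* p (ℕ→ℚ g)) (ℚᵘ.≃-trans (ℚᵘ.*-cong p≃ (natural g))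
      (*≡* (cong₂ ℤ._*_ (sym (ℤ.pos-* b g)) (cong (λ t → + suc t) (sym (*-identityʳ k))))))

  ≤-scaled : ∀ {a b k g} → a * suc k ≤ b * g → ℕ→ℚ a ℚ.≤ ratio b k ℚ.* ℕ→ℚ g
  ≤-scaled {a} {b} {k} {g} h = ℚ.toℚᵘ-cancel-≤
    (ℚᵘ.≤-respˡ-≃ (ℚᵘ.≃-sym (natural a)) (ℚᵘ.≤-respʳ-≃ (ℚᵘ.≃-sym (scaled (ratio b k) g (fraction b k)))
      (≤ᵘ-intro (≤-trans h (≤-reflexive (sym (*-identityʳ (b * g))))))))

  scaled-≤ : ∀ p {a b k g} → toℚᵘ p ℚᵘ.≃ mkℚᵘ (+ b) k → ℕ→ℚ a ℚ.≤ p ℚ.* ℕ→ℚ g → a * suc k ≤ b * g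
  scaled-≤ p {a} {b} {k} {g} p≃ h = ≤-trans
    (≤ᵘ-elim (ℚᵘ.≤-respˡ-≃ (natural a) (ℚᵘ.≤-respʳ-≃ (scaled p g p≃) (ℚ.toℚᵘ-mono-≤ h))))
    (≤-reflexive (*-identityʳ (b * g)))

  fraction-scaled-≤ : ∀ δ k {a g} → δ ℚ.≤ ratio 1 k → ℕ→ℚ a ℚ.≤ δ ℚ.* ℕ→ℚ g → suc k * a ≤ g
  fraction-scaled-≤ δ k {a} {g} δ≤ h = subst₂ _≤_ (*-comm a (suc k)) (*-identityˡ g)
    (scaled-≤ (ratio 1 k) {a} {1} {k} {g} (fraction 1 k)
      (ℚ.≤-trans h (ℚ.*-monoʳ-≤-nonNeg (ℕ→ℚ g) {{ℚ.normalize-nonNeg g 1}} δ≤)))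

  -- A positive rational is at least the reciprocal of its denominator.
  positive-scaled-≤ : ∀ {γ} → 0ℚ ℚ.< γ → ∀ {n k} → γ ℚ.* ℕ→ℚ n ℚ.≤ ℕ→ℚ k → n ≤ ℚ.↧ₙ γ * k
  positive-scaled-≤ {γ} 0<γ {n} {k} h with γ | ℚ.positive 0<γ | h
  ... | mkℚ (+ suc p) q-1 c | _ | h′ = begin
    n               ≤⟨ m≤m+n n (p * n) ⟩
    suc p * n       ≡⟨ *-identityʳ (suc p * n) ⟨
    suc p * n * 1   ≤⟨ ≤ᵘ-elim (ℚᵘ.≤-respˡ-≃ (scaled (mkℚ (+ suc p) q-1 c) n ℚᵘ.≃-refl) (ℚᵘ.≤-respʳ-≃ (natural k) (ℚ.toℚᵘ-mono-≤ h′))) ⟩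
    k * suc q-1     ≡⟨ *-comm k (suc q-1) ⟩
    suc q-1 * k     ∎
    where open ≤-Reasoning
  ... | mkℚ (+ 0) _ _ | () | _
  ... | mkℚ -[1+ _ ] _ _ | () | _

  fraction-≤-positive : ∀ {ε} → 0ℚ ℚ.< ε → ∀ b k → b * ℚ.↧ₙ ε ≤ suc k → ratio b k ℚ.≤ ε
  fraction-≤-positive {ε} 0<ε b k h with ε | ℚ.positive 0<ε | h
  ... | mkℚ (+ suc p) q-1 c | _ | h′ = ℚ.toℚᵘ-cancel-≤ (ℚᵘ.≤-respˡ-≃ (ℚᵘ.≃-sym (fraction b k))
    (≤ᵘ-intro (≤-trans h′ (m≤m+n (suc k) (p * suc k)))))
  ... | mkℚ (+ 0) _ _ | () | _
  ... | mkℚ -[1+ _ ] _ _ | () | _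

-- Counting the graphs with a large component

∈-allVecs : ∀ {m} (b : Vec Bool m) → b ∈ allVecs m
∈-allVecs Vec.[] = here refl
∈-allVecs {suc m} (x Vec.∷ b) = ∈-concatMap⁺ _ (Any.map (λ { refl → choose x }) (∈-allVecs b))
  where
  choose : ∀ x → (x Vec.∷ b) ∈ (true Vec.∷ b) ∷ (false Vec.∷ b) ∷ []
  choose true = here refl
  choose false = there (here refl)

∈-allGraphs : ∀ {n} (g : Graph n) → g ∈ allGraphs n
∈-allGraphs g = ∈-map⁺ mkGraph (∈-allVecs (Graph.bits g))

reach-trans : ∀ {n} (E : Matrix n) {a b c} → reach E a b ≡ true → reach E b c ≡ true → reach E a c ≡ true
reach-trans E {a} {b} ab bc = Component.least (component E b) (reach E a) ab (Component.closed (component E a)) _ bc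

reach-edge : ∀ {n} (E : Matrix n) {a b} → E a b ≡ true → reach E a b ≡ true
reach-edge E {a} ab = Component.closed (component E a) a _ (Component.root (component E a)) ab

reach-sym : ∀ {n} (E : Matrix n) → (∀ a b → E a b ≡ E b a) → ∀ {a b} → reach E a b ≡ true → reach E b a ≡ true
reach-sym E E-sym {a} = Component.least (component E a) (λ w → reach E w a) (Component.root (component E a))
  (λ s t sa st → reach-trans E (reach-edge E (trans (E-sym t s) st)) sa) _

Reach⇒reach : ∀ {n} {g : Graph n} {u v} → Reach g u v → reach (edge g) u v ≡ true
Reach⇒reach {g = g} {u} here = Component.root (component (edge g) u)
Reach⇒reach {g = g} {u} (step {w} {v} r a) = Component.closed (component (edge g) u) w v (Reach⇒reach r) (Adj⇒edge g w v a)

-- A component of order k contributes k² ordered pairs, while the expected number of pairs is the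
-- sum over u of the bounds in `connected-pairs`.
connectedPairs : ∀ {n} → Graph n → ℕ
connectedPairs {n} g = ∑[ u ∈ allFin n ] (∑[ v ∈ allFin n ] ⟦ reach (edge g) u v ⟧)

∑-All : ∀ {A : Set} {P : A → Set} {xs : List A} {c f} → (∀ {x} → P x → c ≤ f x) → All P xs → length xs * c ≤ ∑ xs f
∑-All h [] = z≤n
∑-All h (p ∷ ps) = +-mono-≤ (h p) (∑-All h ps)

large⇒connectedPairs : ∀ {n} {γ} → 0ℚ ℚ.< γ → (g : Graph n) → HasLargeComponent γ g →
  n * n ≤ ℚ.↧ₙ γ * ℚ.↧ₙ γ * connectedPairs g
large⇒connectedPairs {n} {γ} 0<γ g (u , vs , unique , reached , large) = begin
  n * n                             ≤⟨ *-mono-≤ n≤ n≤ ⟩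
  c * length vs * (c * length vs)   ≡⟨ regroup c (length vs) ⟩
  c * c * (length vs * length vs)   ≤⟨ *-monoʳ-≤ (c * c) (≤-trans (∑-All row reach-vs) (∑-⊆ _ unique (All.universal ∈-allFin vs))) ⟩
  c * c * connectedPairs g          ∎
  where
  open ≤-Reasoning
  c = ℚ.↧ₙ γ
  n≤ : n ≤ c * length vs
  n≤ = positive-scaled-≤ 0<γ large
  regroup : ∀ c k → c * k * (c * k) ≡ c * c * (k * k)
  regroup = solve-∀
  reach-vs : All (λ v → reach (edge g) u v ≡ true) vs
  reach-vs = All.map Reach⇒reach reached
  row : ∀ {a} → reach (edge g) u a ≡ true → length vs ≤ ∑[ v ∈ allFin n ] ⟦ reach (edge g) a v ⟧
  row {a} ua = begin
    length vs                                          ≡⟨ *-identityʳ (length vs) ⟨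
    length vs * 1                                      ≤⟨ ∑-All (λ {v} uv → ≤-reflexive (cong ⟦_⟧ (sym (reach-trans (edge g) (reach-sym (edge g) (edge-sym g) ua) uv)))) reach-vs ⟩
    ∑ vs (λ v → ⟦ reach (edge g) a v ⟧)                ≤⟨ ∑-⊆ _ unique (All.universal ∈-allFin vs) ⟩
    ∑ (allFin n) (λ v → ⟦ reach (edge g) a v ⟧)        ∎

module LargeCount {n} (D : DegSeq n) where
  open Uniform D

  valid-of : ∀ {g} → HasDegrees g D → valid g ≡ true
  valid-of {g} h = valid-intro λ a → trans (sym (degree-edge g a)) (h a)

  length-≤-count : ∀ {E : Graph n → Set} gs → Unique gs → All (λ g → HasDegrees g D × E g) gs → length gs ≤ count
  length-≤-count gs unique all = begin
    length gs                      ≡⟨ *-identityʳ (length gs) ⟨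
    length gs * 1                  ≤⟨ ∑-All (λ (h , _) → ≤-reflexive (cong ⟦_⟧ (sym (valid-of h)))) all ⟩
    ∑ gs (λ g → ⟦ valid g ⟧)       ≤⟨ ∑-⊆ _ unique (All.universal ∈-allGraphs gs) ⟩
    count                          ∎
    where open ≤-Reasoning

  -- Markov's inequality for `connectedPairs`.
  large-count : ∀ {γ} → 0ℚ ℚ.< γ → ∀ gs → Unique gs → All (λ g → HasDegrees g D × HasLargeComponent γ g) gs →
    length gs * (n * n) ≤ ℚ.↧ₙ γ * ℚ.↧ₙ γ * Σvalid connectedPairs
  large-count {γ} 0<γ gs unique all = begin
    length gs * (n * n)
      ≤⟨ ∑-All weight all ⟩
    ∑ gs (λ g → ⟦ valid g ⟧ * (c * c * connectedPairs g))
      ≤⟨ ∑-⊆ _ unique (All.universal ∈-allGraphs gs) ⟩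
    Σvalid (λ g → c * c * connectedPairs g)
      ≡⟨ Σvalid-*ˡ (c * c) connectedPairs ⟩
    c * c * Σvalid connectedPairs ∎
    where
    open ≤-Reasoning
    c = ℚ.↧ₙ γ
    weight : ∀ {g} → HasDegrees g D × HasLargeComponent γ g → n * n ≤ ⟦ valid g ⟧ * (c * c * connectedPairs g)
    weight {g} (h , large) = ≤-trans (large⇒connectedPairs 0<γ g large)
      (≤-reflexive (trans (sym (*-identityˡ _)) (cong (λ t → ⟦ t ⟧ * (c * c * connectedPairs g)) (sym (valid-of h)))))

nonempty : ∀ {n} (D : DegSeq n) → 1 ≤ M D → 1 ≤ n
nonempty {suc n} D _ = s≤s z≤n

large-bound : ∀ {n} (D : DegSeq n) {γ} → 0ℚ ℚ.< γ → Positive D → ∀ K → 2 ≤ K →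
  precision (K * K * K) * R D ≤ M D → threshold (K * K * K) ≤ M D →
  ∀ gs → Unique gs → All (λ g → HasDegrees g D × HasLargeComponent γ g) gs →
  length gs * K ≤ 42 * (ℚ.↧ₙ γ * ℚ.↧ₙ γ) * Uniform.count D
large-bound {n} D {γ} 0<γ positive K 2≤K R-small M-large gs unique all =
  *-cancelʳ-≤ _ _ n (*-cancelʳ-≤ _ _ n (begin
    length gs * K * n * n                                  ≡⟨ regroup₁ (length gs) K n ⟩
    K * (length gs * (n * n))                              ≤⟨ *-monoʳ-≤ K (large-count 0<γ gs unique all) ⟩
    K * (c * c * Σvalid connectedPairs)                    ≡⟨ regroup₂ K (c * c) (Σvalid connectedPairs) ⟩
    c * c * (K * Σvalid connectedPairs)                    ≤⟨ *-monoʳ-≤ (c * c) pairs-bound ⟩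
    c * c * (n * (42 * count * n))                         ≡⟨ regroup₃ (c * c) n count ⟩
    42 * (c * c) * count * n * n                           ∎))
  where
  open ≤-Reasoning
  open Uniform D
  open LargeCount D
  open Counting D (cutoff (K * K * K))
  V = allFin n
  c = ℚ.↧ₙ γ
  instance
    n≢0 : NonZero n
    n≢0 = >-nonZero (nonempty D (≤-trans (≤-trans (s≤s z≤n) (m≤n+m 4 _)) M-large))
  regroup₁ : ∀ a K n → a * K * n * n ≡ K * (a * (n * n))
  regroup₁ = solve-∀
  regroup₂ : ∀ K c x → K * (c * x) ≡ c * (K * x)
  regroup₂ = solve-∀
  regroup₃ : ∀ c n g → c * (n * (42 * g * n)) ≡ 42 * c * g * n * n
  regroup₃ = solve-∀
  pairs-∑ : Σvalid connectedPairs ≡ ∑[ u ∈ V ] (∑[ v ∈ V ] Totals.hits u v)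
  pairs-∑ = trans (Σvalid-∑ _) (∑-cong V λ u → Σvalid-∑ _)
  pairs-bound : K * Σvalid connectedPairs ≤ n * (42 * count * n)
  pairs-bound = begin
    K * Σvalid connectedPairs                              ≡⟨ cong (K *_) pairs-∑ ⟩
    K * ∑ V (λ u → ∑ V (Totals.hits u))                    ≡⟨ ∑-*ˡ V K _ ⟨
    ∑ V (λ u → K * ∑ V (Totals.hits u))                    ≤⟨ ∑-mono V (connected-pairs D positive K 2≤K R-small M-large) ⟩
    ∑ V (λ u → 42 * count * n)                             ≡⟨ ∑-*ʳ′ ⟩
    ∑ V (λ u → 1) * (42 * count * n)                       ≤⟨ *-monoˡ-≤ (42 * count * n) (∑-allFin-≤ n λ _ → ≤-refl) ⟩
    n * (42 * count * n)                                   ∎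
    where
    ∑-*ʳ′ : ∑ V (λ u → 42 * count * n) ≡ ∑ V (λ u → 1) * (42 * count * n)
    ∑-*ʳ′ = trans (∑-cong V λ _ → sym (*-identityˡ _)) (∑-*ʳ V (42 * count * n) (λ _ → 1))

-- The choice of K and the rate

module _ {P : ℕ → Set} (P? : Decidable P) where

  -- Zero is the default value and may fail `P`, hence the alternative in `largest-sound`.
  largest : ℕ → ℕ
  largest zero = zero
  largest (suc N) with P? (suc N)
  ... | yes _ = suc N
  ... | no _ = largest N

  largest-sound : ∀ N → largest N ≡ 0 ⊎ P (largest N)
  largest-sound zero = inj₁ refl
  largest-sound (suc N) with P? (suc N)
  ... | yes p = inj₂ p
  ... | no _ = largest-sound N

  largest-max : ∀ {K} N → K ≤ N → P K → K ≤ largest N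
  largest-max zero K≤0 p = K≤0
  largest-max (suc N) K≤ p with P? (suc N)
  ... | yes _ = K≤
  ... | no ¬p with m≤n⇒m<n∨m≡n K≤
  ...   | inj₁ K<sN = largest-max N (≤-pred K<sN) p
  ...   | inj₂ refl = contradiction p ¬p

cube : ℕ → ℕ
cube K = K * K * K

module Rate (λf : ℕ → ℕ) (δ : ℕ → ℚ) where

  -- What λ(n) ≤ M and R ≤ δ(n) M must deliver for `large-bound` at K; the denominator of the ratio
  -- is `precision (cube K)`.
  Admissible : ℕ → ℕ → Set
  Admissible n K = threshold (cube K) ≤ λf n × δ n ℚ.≤ ratio 1 (24 * cube K * cutoff (cube K))

  admissible? : ∀ n → Decidable (Admissible n)
  admissible? n K = (threshold (cube K) ℕ.≤? λf n) ×-dec (δ n ℚ.≤? ratio 1 (24 * cube K * cutoff (cube K)))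

  best : ℕ → ℕ
  best n = largest (admissible? n) n

  best-admissible : ∀ n → 2 ≤ best n → Admissible n (best n)
  best-admissible n 2≤best = positive (largest-sound (admissible? n) n)
    where
    positive : best n ≡ 0 ⊎ Admissible n (best n) → Admissible n (best n)
    positive (inj₁ best≡0) = contradiction (subst (2 ≤_) best≡0 2≤best) λ ()
    positive (inj₂ admissible) = admissible

  -- Each fixed K is admissible from some n on. Adding K to that index places K within the search
  -- range up to n.
  best→∞ : TendsToInfinity λf → TendsToZero δ → TendsToInfinity best
  best→∞ λ→∞ δ→0 K = K + (N₁ + N₂) , λ n N≤n → largest-max (admissible? n) n
    (≤-trans (m≤m+n K _) N≤n)
    ( proj₂ λ-eventually n (≤-trans (≤-trans (m≤m+n N₁ N₂) (m≤n+m _ K)) N≤n)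
    , proj₂ δ-eventually n (≤-trans (≤-trans (m≤n+m N₂ N₁) (m≤n+m _ K)) N≤n))
    where
    λ-eventually = λ→∞ (threshold (cube K))
    δ-eventually = δ→0 (ratio 1 (24 * cube K * cutoff (cube K))) (0<ratio _)
    N₁ = proj₁ λ-eventually
    N₂ = proj₁ δ-eventually

-- The denominator K + 1 never vanishes. For K ≥ 2 passing to it costs at most a factor 2; for K ≤
-- 1, including the default 0, the trivial bound a ≤ g suffices.
round-up : ∀ {a g} K C → a ≤ g → 1 ≤ C → (2 ≤ K → a * K ≤ C * g) → a * suc K ≤ 2 * C * g
round-up {a} {g} K C a≤g 1≤C h with 2 ℕ.≤? K
... | no ≰ = begin
  a * suc K     ≤⟨ *-mono-≤ a≤g (≰⇒> ≰) ⟩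
  g * 2         ≡⟨ *-comm g 2 ⟩
  2 * g         ≤⟨ *-monoˡ-≤ g (*-monoʳ-≤ 2 1≤C) ⟩
  2 * C * g     ∎
  where open ≤-Reasoning
... | yes 2≤K = linear _ _ 0 (+-mono-≤ (*-monoʳ-≤ 2 (h 2≤K)) (*-monoʳ-≤ a (≤-trans (s≤s z≤n) 2≤K))) (certificate a g K C)
  where
  certificate : ∀ a g K C → a * suc K + (2 * (C * g) + a * K) + 0 ≡ 2 * C * g + (2 * (a * K) + a * 1)
  certificate = solve-∀

theorem1 : (λf : ℕ → ℕ) → TendsToInfinity λf →
    (δ : ℕ → ℚ) → (∀ n → 0ℚ ℚ.≤ δ n) → TendsToZero δ →
    (γ : ℚ) → 0ℚ ℚ.< γ →
    Σ (ℕ → ℚ) λ η → TendsToZero η ×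
    (∀ (n : ℕ) (D : DegSeq n) → Positive D → Feasible D →
    λf n ≤ M D →
    ℕ→ℚ (R D) ℚ.≤ δ n ℚ.* ℕ→ℚ (M D) →
    ProbAtMost D (HasLargeComponent γ) (η n))
theorem1 λf λ→∞ δ _ δ→0 γ 0<γ = η , η→0 , bound
  where
  open Rate λf δ

  C : ℕ
  C = 42 * (ℚ.↧ₙ γ * ℚ.↧ₙ γ)

  η : ℕ → ℚ
  η n = ratio (2 * C) (best n)

  η→0 : TendsToZero η
  η→0 ε 0<ε = proj₁ eventually , λ n N≤n →
    fraction-≤-positive 0<ε (2 * C) (best n) (≤-trans (proj₂ eventually n N≤n) (n≤1+n _))
    where
    eventually = best→∞ λ→∞ δ→0 (2 * C * ℚ.↧ₙ ε)

  bound : ∀ n (D : DegSeq n) → Positive D → Feasible D → λf n ≤ M D →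
    ℕ→ℚ (R D) ℚ.≤ δ n ℚ.* ℕ→ℚ (M D) → ProbAtMost D (HasLargeComponent γ) (η n)
  bound n D positive _ λ≤M R≤δM gs unique all = ≤-scaled {length gs} {2 * C} {best n} {numGraphs D}
    (subst (λ t → length gs * suc (best n) ≤ 2 * C * t) valid-count
      (round-up (best n) C (length-≤-count gs unique all) 1≤C large))
    where
    open Uniform D
    open LargeCount D
    1≤C : 1 ≤ C
    1≤C = s≤s z≤n
    large : 2 ≤ best n → length gs * best n ≤ C * count
    large 2≤best = large-bound D 0<γ positive (best n) 2≤best
      (fraction-scaled-≤ (δ n) (24 * cube (best n) * cutoff (cube (best n))) (proj₂ (best-admissible n 2≤best)) R≤δM)
      (≤-trans (proj₁ (best-admissible n 2≤best)) λ≤M) gs unique all
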